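{- The satisfiability problem for $\mathrm{PL}[\perp_{\rm c},\subseteq,\sim]$ is in $\mathrm{AEXPTIME(poly)}$.
   Context: Team semantics. For a finite set $D$ of proposition symbols, an assignment is a function $s:D\to\{0,1\}$, and a team with domain $D$ is a set $X$ of such assignments; $s(\vec p)=(s(p_1),\dots,s(p_n))$ for $\vec p=(p_1,\dots,p_n)$. Formulas of $\mathrm{PL}$: $\varphi::= p\mid \neg p\mid (\varphi\wedge\varphi)\mid(\varphi\vee\varphi)$. Semantics: $X\models p$ iff $s(p)=1$ for all $s\in X$; $X\models \neg p$ iff $s(p)=0$ for all $s\in X$; $X\models\varphi\wedge\psi$ iff both hold; $X\models\varphi\vee\psi$ iff there are $Y,Z$ with $Y\cup Z=X$, $Y\models\varphi$, $Z\models\psi$. Independence atom: $X\models \vec q\perp_{\vec p}\vec r$ iff for all $s,t\in X$ with $s(\vec p)=t(\vec p)$ there is $u\in X$ with $u(\vec p\vec q)=s(\vec p\vec q)$ and $u(\vec r)=t(\vec r)$. Inclusion atom (equal-length tuples): $X\models\vec p\subseteq\vec q$ iff for every $s\in X$ there is $t\in X$ with $s(\vec p)=t(\vec q)$. Classical negation: $X\models\sim\varphi$ iff $X\not\models\varphi$. $\mathrm{PL}[\perp_{\rm c},\subseteq,\sim]$ is $\mathrm{PL}$ extended by independence atoms, inclusion atoms and $\sim$. A formula is satisfiable if some non-empty team (whose domain contains its proposition symbols) satisfies it. $\mathrm{AEXPTIME(poly)}$ is the class of problems decidable by an alternating Turing machine in time $2^{p(n)}$, $p$ a polynomial, with polynomially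 many alternations. -}

module Defs where

open import Data.Nat using (ℕ; zero; suc; _+_; _*_; _^_)
open import Data.Nat.Binary.Base using (ℕᵇ; 2[1+_]; 1+[2_]) renaming (zero to zeroᵇ; fromℕ to toBin)
open import Data.Bool using (Bool; true; false)
open import Data.Fin using (Fin)
open import Data.Maybe using (Maybe; just; nothing)
open import Data.Sum using (_⊎_; inj₁; inj₂)
open import Data.Product using (Σ; _×_; _,_; ∃)
open import Data.List using (List; []; _∷_; _++_; length; concatMap; map)
open import Data.Vec using (Vec; toList)
open import Data.List.Membership.Propositional using (_∈_)
open import Data.List.Relation.Unary.Any using (Any)
open import Data.List.Relation.Unary.All using (All)
open import Data.Unit using (⊤)
open import Data.Empty using (⊥)
open import Relation.Nullary using (¬_)
open import Relation.Binary.PropositionalEquality using (_≡_)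

data Fm : Set where
  atom  : ℕ → Fm
  natom : ℕ → Fm
  _∧ᶠ_  : Fm → Fm → Fm
  _∨ᶠ_  : Fm → Fm → Fm
  indep : (ps qs rs : List ℕ) → Fm               -- qs ⊥_ps rs
  incl  : {k : ℕ} → Vec ℕ k → Vec ℕ k → Fm
  ∼_    : Fm → Fm

vars : Fm → List ℕ
vars (atom p) = p ∷ []
vars (natom p) = p ∷ []
vars (φ ∧ᶠ ψ) = vars φ ++ vars ψ
vars (φ ∨ᶠ ψ) = vars φ ++ vars ψ
vars (indep ps qs rs) = ps ++ qs ++ rs
vars (incl ps qs) = toList ps ++ toList qs
vars (∼ φ) = vars φ

-- Team semantics.  A team with (finite) domain D : List ℕ is represented
-- by a finite list of assignments ℕ → Bool, where only the values on D
-- matter: two assignments are identified iff they agree on D.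

Assignment : Set
Assignment = ℕ → Bool

Team : Set
Team = List Assignment

_[_]≐_[_] : Assignment → List ℕ → Assignment → List ℕ → Set
s [ [] ]≐ t [ [] ] = ⊤
s [ x ∷ xs ]≐ t [ y ∷ ys ] = (s x ≡ t y) × (s [ xs ]≐ t [ ys ])
s [ [] ]≐ t [ _ ∷ _ ] = ⊥
s [ _ ∷ _ ]≐ t [ [] ] = ⊥

_∈[_]_ : Assignment → List ℕ → Team → Set
s ∈[ D ] X = Any (λ t → s [ D ]≐ t [ D ]) X

_⊆[_]_ : Team → List ℕ → Team → Set
Y ⊆[ D ] X = All (λ s → s ∈[ D ] X) Y

_⊨[_]_ : Team → List ℕ → Fm → Set
X ⊨[ D ] atom p = All (λ s → s p ≡ true) X
X ⊨[ D ] natom p = All (λ s → s p ≡ false) X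
X ⊨[ D ] (φ ∧ᶠ ψ) = (X ⊨[ D ] φ) × (X ⊨[ D ] ψ)
X ⊨[ D ] (φ ∨ᶠ ψ) =
  Σ Team λ Y → Σ Team λ Z →
    (Y ⊆[ D ] X) × (Z ⊆[ D ] X) ×
    (∀ {s} → s ∈ X → (s ∈[ D ] Y) ⊎ (s ∈[ D ] Z)) ×
    (Y ⊨[ D ] φ) × (Z ⊨[ D ] ψ)
X ⊨[ D ] indep ps qs rs =
  ∀ {s t} → s ∈ X → t ∈ X → s [ ps ]≐ t [ ps ] →
    Σ Assignment λ u → (u ∈ X) × (u [ ps ++ qs ]≐ s [ ps ++ qs ]) × (u [ rs ]≐ t [ rs ])
X ⊨[ D ] incl ps qs =
  ∀ {s} → s ∈ X → Σ Assignment λ t → (t ∈ X) × (s [ toList ps ]≐ t [ toList qs ])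
X ⊨[ D ] (∼ φ) = ¬ (X ⊨[ D ] φ)

Satisfiable : Fm → Set
Satisfiable φ = Σ (List ℕ) λ D → (All (λ x → x ∈ D) (vars φ)) ×
                Σ Team λ X → (¬ X ≡ []) × (X ⊨[ D ] φ)

-- Encoding of formulas as words over a finite alphabet (symbol indices
-- written in binary, so the length is polynomial in the usual size).

data Sym : Set where
  sVar sD1 sD2 sNeg sAnd sOr sLp sRp sIndep sIncl sTilde : Sym

encBin : ℕᵇ → List Sym
encBin zeroᵇ = []
encBin 2[1+ b ] = sD2 ∷ encBin b
encBin 1+[2 b ] = sD1 ∷ encBin b

encVar : ℕ → List Sym
encVar x = sVar ∷ encBin (toBin x)

encList : List ℕ → List Sym
encList xs = sLp ∷ (concatMap encVar xs ++ (sRp ∷ []))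

encode : Fm → List Sym
encode (atom p) = encVar p
encode (natom p) = sNeg ∷ encVar p
encode (φ ∧ᶠ ψ) = sLp ∷ (encode φ ++ (sAnd ∷ (encode ψ ++ (sRp ∷ []))))
encode (φ ∨ᶠ ψ) = sLp ∷ (encode φ ++ (sOr ∷ (encode ψ ++ (sRp ∷ []))))
encode (indep ps qs rs) = sIndep ∷ (encList qs ++ (encList ps ++ encList rs))
encode (incl ps qs) = sIncl ∷ (encList (toList ps) ++ encList (toList qs))
encode (∼ φ) = sTilde ∷ encode φ

SAT : List Sym → Set
SAT w = Σ Fm λ φ → (encode φ ≡ w) × Satisfiable φ

data Kind : Set where
  exist univ accept reject : Kind

data Move : Set where
  left right stay : Move

record ATM : Set where
  field
    nQ    : ℕ
    nW    : ℕ
    start : Fin nQ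
    kind  : Fin nQ → Kind
    -- tape symbols: nothing = blank, inj₁ = input symbol, inj₂ = work symbol
    δ     : Fin nQ → Maybe (Sym ⊎ Fin nW) → List (Fin nQ × Maybe (Sym ⊎ Fin nW) × Move)

module _ (M : ATM) where
  open ATM M

  Γ : Set
  Γ = Maybe (Sym ⊎ Fin nW)

  record Config : Set where
    constructor conf
    field
      st    : Fin nQ
      lft   : List Γ     -- cells left of the head, nearest first
      hd    : Γ
      rgt   : List Γ

  initConf : List Sym → Config
  initConf [] = conf start [] nothing []
  initConf (a ∷ w) = conf start [] (just (inj₁ a)) (map (λ b → just (inj₁ b)) w)

  apply : Config → Fin nQ × Γ × Move → Config
  apply (conf _ l _ r) (q , b , stay) = conf q l b r
  apply (conf _ [] _ r) (q , b , left) = conf q [] b r        -- left end: stay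
  apply (conf _ (a ∷ l) _ r) (q , b , left) = conf q l a (b ∷ r)
  apply (conf _ l _ []) (q , b , right) = conf q (b ∷ l) nothing []
  apply (conf _ l _ (a ∷ r)) (q , b , right) = conf q (b ∷ l) a r

  succs : Config → List Config
  succs c = map (apply c) (δ (Config.st c) (Config.hd c))

  -- Mode: the kind of the current block of branching states (if any).
  data Mode : Set where
    none ∃m ∀m : Mode

  -- Budget m newMode a P: continue in block newMode; entering a new
  -- block (other than the first) costs one alternation.
  Budget : Mode → Mode → ℕ → (ℕ → Set) → Set
  Budget none _ a P = P a
  Budget ∃m ∃m a P = P a
  Budget ∀m ∀m a P = P a
  Budget _ _ zero P = ⊥
  Budget _ _ (suc a) P = P a

  Acc : ℕ → ℕ → Mode → Config → Set
  Node : ℕ → ℕ → Mode → Kind → Config → Set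
  Acc t a m c = Node t a m (kind (Config.st c)) c
  Node _ _ _ accept _ = ⊤
  Node _ _ _ reject _ = ⊥
  Node zero _ _ exist _ = ⊥
  Node zero _ _ univ _ = ⊥
  Node (suc t) a m exist c = Budget m ∃m a (λ a' → Any (Acc t a' ∃m) (succs c))
  Node (suc t) a m univ c = Budget m ∀m a (λ a' → All (Acc t a' ∀m) (succs c))

  AcceptsWithin : ℕ → ℕ → List Sym → Set
  AcceptsWithin t a w = Acc t a none (initConf w)

-- Polynomial bounds: every polynomial is dominated by some c·nᶜ + c.
poly : ℕ → ℕ → ℕ
poly c n = c * n ^ c + c

-- L ∈ AEXPTIME(poly): some ATM decides L in time 2^{p(n)} with at most
-- p(n) alternations (clocked formulation), for a polynomial p.
InAEXPTIMEpoly : (List Sym → Set) → Set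
InAEXPTIMEpoly L =
  Σ ATM λ M → Σ ℕ λ c → ∀ w →
    (L w → AcceptsWithin M (2 ^ poly c (length w)) (poly c (length w)) w) ×
    (AcceptsWithin M (2 ^ poly c (length w)) (poly c (length w)) w → L w)

{-# OPTIONS --safe #-}
module Submission where

-- A team over the variables of φ is written on the tape as a list of
-- assignments, each given by the names of its true variables, and φ is evaluated
-- by a game that walks down one branch of its syntax tree: a conjunction lets the
-- opponent of the verifier choose a conjunct; a disjunction lets the verifier
-- tag each assignment with the parts it belongs to and the opponent choose a part;
-- ∼ exchanges the players.  An atom is settled by finitely many selections of
-- assignments and variables, ending with the comparison of two names.  So each
-- connective costs a bounded number of alternations and time polynomial in
-- the length of the tape.  By locality, a satisfiable φ holds in a team of
-- assignments to vars φ, of which there are at most 2 ^ |φ|.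
--
-- The game is programmed for an alternating machine with eight stacks, which a
-- one-tape machine simulates with one track per stack; a parser running
-- in parallel (by universal branching) checks that the input encodes a formula.

open import Defs
open import Data.Nat
open import Data.Nat.Properties hiding (_≟_)
import Data.Nat.Properties as ℕ
open import Data.Nat.Binary.Base using (ℕᵇ; 2[1+_]; 1+[2_]; toℕ) renaming (zero to zeroᵇ; fromℕ to toBin)
import Data.Nat.Binary.Properties as ℕᵇ
open import Data.Bool using (Bool; true; false; if_then_else_; not; T; _∧_)
import Data.Bool as Bool
open import Data.Bool.Properties using (T-∧)
open import Data.Fin as Fin using (Fin; zero; suc; #_)
open import Data.Maybe using (Maybe; just; nothing)
open import Data.Sum as Sum using (_⊎_; inj₁; inj₂)
open import Data.Product using (_×_; _,_; ∃-syntax; proj₁; proj₂)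
open import Data.List as List using (List; []; _∷_; _++_; _ʳ++_; length; map; concatMap; concat; reverse; head; drop; cartesianProduct; cartesianProductWith; allFin)
import Data.List.Properties as List
open import Data.Vec as Vec using (Vec; []; _∷_; lookup; _[_]≔_)
open import Data.Vec.Properties as Vec using (lookup-map; map-[]≔; lookup∘update; lookup∘update′; []≔-lookup; []≔-idempotent; []≔-commutes; lookup-replicate)
open import Data.List.Membership.Propositional using (_∈_; find) renaming (lose to witness)
open import Data.List.Membership.Propositional.Properties
open import Data.List.Membership.DecPropositional ℕᵇ._≟_ using (_∈?_)
open import Data.List.Relation.Unary.Any as Any using (Any; here; there)
import Data.List.Relation.Unary.Any.Properties as Any
open import Data.List.Relation.Unary.All as All using (All; []; _∷_)
import Data.List.Relation.Unary.All.Properties as All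
open import Data.Nat.Solver using (module +-*-Solver)
open import Data.Unit using (⊤; tt)
open import Data.Empty using (⊥; ⊥-elim)
open import Function using (_∘_; id; case_of_)
open import Function.Bundles using (Equivalence)
open import Relation.Nullary using (¬_; Dec; yes; no; does; contradiction)
open import Relation.Nullary.Decidable using (_⊎-dec_; _×-dec_; dec-true; dec-false; decidable-stable)
open import Relation.Binary.PropositionalEquality

-- The obstacle is that acceptance is bounded in time and in alternations while `∼` exchanges the
-- players: that the verifier does not win within given bounds is not by itself a win of her
-- opponent. A position is therefore specified by `Val`, which promises bounds wherever acceptance
-- is asserted, whoever moves, and asks for none where acceptance is assumed. Such positions are
-- determined, and searching the bounded game decides them; this stands in for excluded middle when
-- two negations have to cancel.
--
-- Alternations are linear in the formula, but guessing, tagging and copying a team take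
-- exponentially many steps. Such a phase must not change the mover, so deterministic steps belong
-- to the current mover, and a universal condition on the team is played as the opponent's search
-- for a counterexample.
--
-- Malformed inputs need no separate treatment: the parser has to win as well, and its win supplies
-- the formula in terms of which the evaluation is then read. The stack machine takes 2^O(n) steps,
-- and one stack operation is a walk along a tape of at most that length, so that passing to one
-- tape roughly doubles the exponent.

-- Finite types and their numberings

record Enum (A : Set) : Set where
  field
    elems    : List A
    complete : ∀ a → a ∈ elems

  size : ℕ
  size = length elems

  enc : A → Fin size
  enc a = Any.index (complete a)

  dec : Fin size → A
  dec = List.lookup elems

  dec∘enc : ∀ a → dec (enc a) ≡ a
  dec∘enc a = sym (Any.lookup-index (complete a))

open Enum using (elems; complete)

enumFin : ∀ n → Enum (Fin n)
enumFin n = record { elems = allFin n ; complete = ∈-allFin }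

enumBool : Enum Bool
enumBool = record { elems = false ∷ true ∷ []
                  ; complete = λ { false → here refl ; true → there (here refl) } }

enumMaybe : ∀ {A} → Enum A → Enum (Maybe A)
enumMaybe E = record
  { elems = nothing ∷ map just (elems E)
  ; complete = λ { nothing → here refl ; (just a) → there (∈-map⁺ just (complete E a)) } }

enum× : ∀ {A B} → Enum A → Enum B → Enum (A × B)
enum× E F = record
  { elems = cartesianProduct (elems E) (elems F)
  ; complete = λ (a , b) → ∈-cartesianProduct⁺ (complete E a) (complete F b) }

enumVec : ∀ {A} → Enum A → ∀ n → Enum (Vec A n)
enumVec E zero = record { elems = [] ∷ [] ; complete = λ { [] → here refl } }
enumVec E (suc n) = record
  { elems = cartesianProductWith _∷_ (elems E) (elems (enumVec E n))
  ; complete = λ { (x ∷ xs) → ∈-cartesianProductWith⁺ _∷_ (complete E x) (complete (enumVec E n) xs) } }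

enumSym : Enum Sym
enumSym = record { elems = syms ; complete = all }
  where
  syms : List Sym
  syms = sVar ∷ sD1 ∷ sD2 ∷ sNeg ∷ sAnd ∷ sOr ∷ sLp ∷ sRp ∷ sIndep ∷ sIncl ∷ sTilde ∷ []
  all : ∀ x → x ∈ syms
  all sVar   = ∈-lookup {xs = syms} (# 0)
  all sD1    = ∈-lookup {xs = syms} (# 1)
  all sD2    = ∈-lookup {xs = syms} (# 2)
  all sNeg   = ∈-lookup {xs = syms} (# 3)
  all sAnd   = ∈-lookup {xs = syms} (# 4)
  all sOr    = ∈-lookup {xs = syms} (# 5)
  all sLp    = ∈-lookup {xs = syms} (# 6)
  all sRp    = ∈-lookup {xs = syms} (# 7)
  all sIndep = ∈-lookup {xs = syms} (# 8)
  all sIncl  = ∈-lookup {xs = syms} (# 9)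
  all sTilde = ∈-lookup {xs = syms} (# 10)

-- Alternating programs over K stacks.  `win`, `lose` and `branch` refer to
-- the player who is currently moving, and `flip` passes the move to the
-- opponent; so one program text serves both polarities of a subformula.

data Code (K : ℕ) (L : Set) : Set where
  push     : Fin K → Sym → Code K L → Code K L
  pop      : Fin K → (Maybe Sym → Code K L) → Code K L
  branch   : Code K L → Code K L → Code K L
  flip     : Code K L → Code K L
  goto     : L → Code K L
  win lose : Code K L

Store : ℕ → Set
Store K = Vec (List Sym) K

module Semantics {K : ℕ} {L : Set} (prog : L → Code K L) where

  -- The existential player (m = true when she moves) wins within t steps
  -- and a changes of the mover.
  Wins : ℕ → ℕ → Bool → Code K L → Store K → Set
  Wins zero    _       _     _            _ = ⊥
  Wins (suc t) a       m     (push i x c) σ = Wins t a m c (σ [ i ]≔ (x ∷ lookup σ i))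
  Wins (suc t) a       m     (pop i k)    σ = Wins t a m (k (head (lookup σ i))) (σ [ i ]≔ drop 1 (lookup σ i))
  Wins (suc t) a       true  (branch c d) σ = Wins t a true c σ ⊎ Wins t a true d σ
  Wins (suc t) a       false (branch c d) σ = Wins t a false c σ × Wins t a false d σ
  Wins (suc t) zero    m     (flip c)     σ = ⊥
  Wins (suc t) (suc a) m     (flip c)     σ = Wins t a (not m) c σ
  Wins (suc t) a       m     (goto l)     σ = Wins t a m (prog l) σ
  Wins (suc t) a       m     win          σ = T m
  Wins (suc t) a       m     lose         σ = T (not m)

  Wins-mono : ∀ {t t′ a a′} m c σ → t ≤ t′ → a ≤ a′ → Wins t a m c σ → Wins t′ a′ m c σ
  Wins-mono m (push i x c) σ (s≤s p) q w = Wins-mono m c _ p q w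
  Wins-mono m (pop i k) σ (s≤s p) q w = Wins-mono m (k (head (lookup σ i))) _ p q w
  Wins-mono true (branch c d) σ (s≤s p) q (inj₁ w) = inj₁ (Wins-mono true c σ p q w)
  Wins-mono true (branch c d) σ (s≤s p) q (inj₂ w) = inj₂ (Wins-mono true d σ p q w)
  Wins-mono false (branch c d) σ (s≤s p) q (w , v) = Wins-mono false c σ p q w , Wins-mono false d σ p q v
  Wins-mono m (flip c) σ (s≤s p) (s≤s q) w = Wins-mono (not m) c σ p q w
  Wins-mono m (goto l) σ (s≤s p) q w = Wins-mono m (prog l) σ p q w
  Wins-mono m win σ (s≤s p) q w = w
  Wins-mono m lose σ (s≤s p) q w = w

  Wins? : ∀ t a m c σ → Dec (Wins t a m c σ)
  Wins? zero a m c σ = no id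
  Wins? (suc t) a m (push i x c) σ = Wins? t a m c _
  Wins? (suc t) a m (pop i k) σ = Wins? t a m (k (head (lookup σ i))) _
  Wins? (suc t) a true (branch c d) σ = Wins? t a true c σ ⊎-dec Wins? t a true d σ
  Wins? (suc t) a false (branch c d) σ = Wins? t a false c σ ×-dec Wins? t a false d σ
  Wins? (suc t) zero m (flip c) σ = no id
  Wins? (suc t) (suc a) m (flip c) σ = Wins? t a (not m) c σ
  Wins? (suc t) a m (goto l) σ = Wins? t a m (prog l) σ
  Wins? (suc t) a true win σ = yes tt
  Wins? (suc t) a false win σ = no id
  Wins? (suc t) a true lose σ = no id
  Wins? (suc t) a false lose σ = yes tt

-- Finite control: the subprograms of a program

module Compile {K : ℕ} {L : Set} (prog : L → Code K L) (labels : Enum L)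
               (inp : Fin K) (l₀ : L) where

  open Semantics prog

  -- Control states are to be subprograms. A `pop` continues with a function, but on the finite type
  -- `Maybe Sym`, so only finitely many subprograms arise. As codes contain functions they are not
  -- compared: a state is a position in a list, obtained from a membership proof.
  subs : Code K L → List (Code K L)
  subs c@(push _ _ d)  = c ∷ subs d
  subs c@(pop _ k)     = c ∷ concatMap (λ s → subs (k s)) (elems (enumMaybe enumSym))
  subs c@(branch d e)  = c ∷ subs d ++ subs e
  subs c@(flip d)      = c ∷ subs d
  subs c               = c ∷ []

  subs-self : ∀ c → c ∈ subs c
  subs-self (push _ _ _) = here refl
  subs-self (pop _ _)    = here refl
  subs-self (branch _ _) = here refl
  subs-self (flip _)     = here refl
  subs-self (goto _)     = here refl
  subs-self win          = here refl
  subs-self lose         = here refl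

  ∈-subs-pop : ∀ {i c} k s → c ∈ subs (k s) → c ∈ subs (pop i k)
  ∈-subs-pop k s p = there (∈-concat⁺′ p (∈-map⁺ (λ s → subs (k s)) (complete (enumMaybe enumSym) s)))

  data _◁_ : Code K L → Code K L → Set where
    push    : ∀ {i x c} → c ◁ push i x c
    pop     : ∀ {i k} s → k s ◁ pop i k
    branchˡ : ∀ {c d} → c ◁ branch c d
    branchʳ : ∀ {c d} → d ◁ branch c d
    flip    : ∀ {c} → c ◁ flip c

  subs-child : ∀ {c d} → d ◁ c → d ∈ subs c
  subs-child push       = there (subs-self _)
  subs-child (pop {k = k} s) = ∈-subs-pop k s (subs-self _)
  subs-child branchˡ    = there (∈-++⁺ˡ (subs-self _))
  subs-child branchʳ    = there (∈-++⁺ʳ _ (subs-self _))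
  subs-child flip       = there (subs-self _)

  subs-closed : ∀ e {c d} → d ◁ c → c ∈ subs e → d ∈ subs e
  subs-closed (push _ _ _) r (here refl) = subs-child r
  subs-closed (push _ _ e) r (there p) = there (subs-closed e r p)
  subs-closed (pop i k) r (here refl) = subs-child r
  subs-closed (pop i k) r (there p)
    with s , q ← Any.satisfied (∈-concatMap⁻ (λ s → subs (k s)) {xs = elems (enumMaybe enumSym)} p)
    = ∈-subs-pop k s (subs-closed (k s) r q)
  subs-closed (branch _ _) r (here refl) = subs-child r
  subs-closed (branch e f) r (there p) with ∈-++⁻ (subs e) p
  ... | inj₁ q = there (∈-++⁺ˡ (subs-closed e r q))
  ... | inj₂ q = there (∈-++⁺ʳ (subs e) (subs-closed f r q))
  subs-closed (flip _) r (here refl) = subs-child r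
  subs-closed (flip e) r (there p) = there (subs-closed e r p)
  subs-closed (goto _) r (here refl) = subs-child r
  subs-closed win r (here refl) = subs-child r
  subs-closed lose r (here refl) = subs-child r

  abstract
    codes : List (Code K L)
    codes = concatMap (λ l → subs (prog l)) (elems labels)

    codes-prog : ∀ l → prog l ∈ codes
    codes-prog l = ∈-concat⁺′ (subs-self (prog l)) (∈-map⁺ (λ l → subs (prog l)) (complete labels l))

    codes-closed : ∀ {c d} → d ◁ c → c ∈ codes → d ∈ codes
    codes-closed r p
      with l , q ← Any.satisfied (∈-concatMap⁻ (λ l → subs (prog l)) {xs = elems labels} p)
      = ∈-concat⁺′ (subs-closed (prog l) r q) (∈-map⁺ (λ l → subs (prog l)) (complete labels l))

    N : ℕ
    N = length codes

    code : Fin N → Code K L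
    code = List.lookup codes

    q₀ : Fin N
    q₀ = Any.index (codes-prog l₀)

    code-q₀ : code q₀ ≡ prog l₀
    code-q₀ = sym (Any.lookup-index (codes-prog l₀))

  data Instr : Set where
    push     : Fin K → Sym → Fin N → Instr
    pop      : Fin K → (Maybe Sym → Fin N) → Instr
    branch   : Fin N → Fin N → Instr
    flip     : Fin N → Instr
    goto     : Fin N → Instr
    win lose : Instr

  -- A relation and not an equation between codes: the continuations of a `pop` are only known to
  -- agree symbol by symbol.
  data _implements_ : Instr → Code K L → Set where
    push   : ∀ {i x q c} → code q ≡ c → push i x q implements push i x c
    pop    : ∀ {i f k} → (∀ s → code (f s) ≡ k s) → pop i f implements pop i k
    branch : ∀ {q r c d} → code q ≡ c → code r ≡ d → branch q r implements branch c d
    flip   : ∀ {q c} → code q ≡ c → flip q implements flip c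
    goto   : ∀ {q l} → code q ≡ prog l → goto q implements goto l
    win    : win implements win
    lose   : lose implements lose

  abstract
    resolve : ∀ c → c ∈ codes → Instr
    resolve (push i x c) p = push i x (Any.index (codes-closed push p))
    resolve (pop i k)    p = pop i (λ s → Any.index (codes-closed (pop s) p))
    resolve (branch c d) p = branch (Any.index (codes-closed branchˡ p)) (Any.index (codes-closed branchʳ p))
    resolve (flip c)     p = flip (Any.index (codes-closed flip p))
    resolve (goto l)     p = goto (Any.index (codes-prog l))
    resolve win          p = win
    resolve lose         p = lose

    instr : Fin N → Instr
    instr q = resolve (code q) (∈-lookup q)

    resolve-ok : ∀ c p → resolve c p implements c
    resolve-ok (push i x c) p = push (sym (Any.lookup-index (codes-closed push p)))
    resolve-ok (pop i k)    p = pop (λ s → sym (Any.lookup-index (codes-closed (pop s) p)))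
    resolve-ok (branch c d) p = branch (sym (Any.lookup-index (codes-closed branchˡ p)))
                                       (sym (Any.lookup-index (codes-closed branchʳ p)))
    resolve-ok (flip c)     p = flip (sym (Any.lookup-index (codes-closed flip p)))
    resolve-ok (goto l)     p = goto (sym (Any.lookup-index (codes-prog l)))
    resolve-ok win          p = win
    resolve-ok lose         p = lose

    instr-implements : ∀ q {c} → code q ≡ c → ∃[ I ] instr q ≡ I × I implements c
    instr-implements q refl = instr q , refl , resolve-ok (code q) (∈-lookup q)

  -- The one-tape machine

  -- A tape cell carries one track per stack, with the bottom of each stack
  -- in cell 0; the Boolean marks cell 0 itself.
  Cell : Set
  Cell = Bool × Vec (Maybe Sym) K

  abstract
    enumCell : Enum Cell
    enumCell = enum× enumBool (enumVec (enumMaybe enumSym) K)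

  -- Between instructions the head rests on cell 0 in phase `begin`. A push or pop walks right
  -- (`scan`) to the first cell that is empty on its track; a pop of a nonempty stack then steps
  -- left and deletes there (`erase`); `return` goes back to the marked cell. `init` only sets the
  -- mark.
  data Phase : Set where
    init begin scan erase return : Phase

  enumPhase : Enum Phase
  enumPhase = record
    { elems = init ∷ begin ∷ scan ∷ erase ∷ return ∷ []
    ; complete = λ { init → here refl ; begin → there (here refl) ; scan → there (there (here refl))
                   ; erase → there (there (there (here refl)))
                   ; return → there (there (there (there (here refl)))) } }

  State : Set
  State = Phase × Bool × Fin N

  abstract
    enumState : Enum State
    enumState = enum× enumPhase (enum× enumBool (enumFin N))

  module C = Enum enumCell
  module Q = Enum enumState

  -- Deterministic states also get the kind of the player to move, so a whole stack operation stays
  -- in one block of branching states and only a `flip` can cost an alternation.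
  kindOf : Bool → Kind
  kindOf true  = exist
  kindOf false = univ

  verdict : Bool → Kind
  verdict true  = accept
  verdict false = reject

  kindI : Bool → Instr → Kind
  kindI m win  = verdict m
  kindI m lose = verdict (not m)
  kindI m _    = kindOf m

  kindS : State → Kind
  kindS (begin , m , q) = kindI m (instr q)
  kindS (_     , m , q) = kindOf m

  Out : Set
  Out = List (State × Cell × Move)

  beginI : Bool → Fin N → Cell → Instr → Out
  beginI m q c (push _ _ _) = ((scan , m , q) , c , stay) ∷ []
  beginI m q c (pop _ _)    = ((scan , m , q) , c , stay) ∷ []
  beginI m q c (branch r s) = ((begin , m , r) , c , stay) ∷ ((begin , m , s) , c , stay) ∷ []
  beginI m q c (flip r)     = ((begin , not m , r) , c , stay) ∷ []
  beginI m q c (goto r)     = ((begin , m , r) , c , stay) ∷ []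
  beginI m q c win          = []
  beginI m q c lose         = []

  scanPush : Bool → Fin N → Cell → Fin K → Sym → Fin N → Maybe Sym → Out
  scanPush m q (h , v) i x r (just _) = ((scan , m , q) , (h , v) , right) ∷ []
  scanPush m q (h , v) i x r nothing  = ((return , m , r) , (h , v [ i ]≔ just x) , stay) ∷ []

  scanPop : Bool → Fin N → Cell → (Maybe Sym → Fin N) → Maybe Sym → Out
  scanPop m q (h , v)     f (just _) = ((scan , m , q) , (h , v) , right) ∷ []
  scanPop m q (true , v)  f nothing  = ((begin , m , f nothing) , (true , v) , stay) ∷ []
  scanPop m q (false , v) f nothing  = ((erase , m , q) , (false , v) , left) ∷ []

  scanI : Bool → Fin N → Cell → Instr → Out
  scanI m q c (push i x r) = scanPush m q c i x r (lookup (proj₂ c) i)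
  scanI m q c (pop i f)    = scanPop m q c f (lookup (proj₂ c) i)
  scanI m q c _            = []

  eraseI : Bool → Cell → Instr → Out
  eraseI m (h , v) (pop i f) = ((return , m , f (lookup v i)) , (h , v [ i ]≔ nothing) , stay) ∷ []
  eraseI m c       _         = []

  returnO : Bool → Fin N → Cell → Out
  returnO m q (true , v)  = ((begin , m , q) , (true , v) , stay) ∷ []
  returnO m q (false , v) = ((return , m , q) , (false , v) , left) ∷ []

  trans′ : State → Cell → Out
  trans′ (init , m , q)   (_ , v) = ((begin , m , q) , (true , v) , stay) ∷ []
  trans′ (begin , m , q)  c = beginI m q c (instr q)
  trans′ (scan , m , q)   c = scanI m q c (instr q)
  trans′ (erase , m , q)  c = eraseI m c (instr q)
  trans′ (return , m , q) c = returnO m q c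

  blank : Vec (Maybe Sym) K
  blank = Vec.replicate K nothing

  -- Unwritten cells are read as cells too, an input symbol being an entry of track `inp`. So the
  -- input needs no conversion: the initial tape represents a store in which `inp` holds the word
  -- with its first symbol at the bottom.
  view : Maybe (Sym ⊎ Fin C.size) → Cell
  view nothing         = false , blank
  view (just (inj₁ x)) = false , blank [ inp ]≔ just x
  view (just (inj₂ w)) = C.dec w

  put : Cell → Maybe (Sym ⊎ Fin C.size)
  put c = just (inj₂ (C.enc c))

  M : ATM
  M = record
    { nQ = Q.size
    ; nW = C.size
    ; start = Q.enc (init , true , q₀)
    ; kind = λ s → kindS (Q.dec s)
    ; δ = λ s γ → map (λ (s′ , c , mv) → Q.enc s′ , put c , mv) (trans′ (Q.dec s) (view γ))
    }

  -- Configurations, and runs that keep the mover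

  module Cf = Config

  nth : {A : Set} → List (Maybe A) → ℕ → Maybe A
  nth []       _       = nothing
  nth (x ∷ xs) zero    = x
  nth (x ∷ xs) (suc j) = nth xs j

  upd : {A : Set} → (ℕ → A) → ℕ → A → ℕ → A
  upd g p v j = if j ≡ᵇ p then v else g j

  nth-upd : ∀ {A : Set} (xs : List (Maybe A)) {x} y ys j →
            nth (xs ++ y ∷ ys) j ≡ upd (nth (xs ++ x ∷ ys)) (length xs) y j
  nth-upd []       y ys zero    = refl
  nth-upd []       y ys (suc j) = refl
  nth-upd (x ∷ xs) y ys zero    = refl
  nth-upd (x ∷ xs) y ys (suc j) = nth-upd xs y ys j

  nth-blank : ∀ {A : Set} (xs : List (Maybe A)) j → nth (xs ++ nothing ∷ []) j ≡ nth xs j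
  nth-blank []       zero    = refl
  nth-blank []       (suc j) = refl
  nth-blank (x ∷ xs) zero    = refl
  nth-blank (x ∷ xs) (suc j) = nth-blank xs j

  upd-map : ∀ {A B : Set} (f : A → B) {g : ℕ → A} {g′ : ℕ → B} p v {w} →
            (∀ j → f (g j) ≡ g′ j) → f v ≡ w → ∀ j → f (upd g p v j) ≡ upd g′ p w j
  upd-map f p v e e′ j with j ≡ᵇ p
  ... | true  = e′
  ... | false = e j

  upd-self : ∀ {A : Set} (g : ℕ → A) p j → upd g p (g p) j ≡ g j
  upd-self g p j with j ≡ᵇ p in eq
  ... | true  = cong g (sym (≡ᵇ⇒≡ j p (subst T (sym eq) tt)))
  ... | false = refl

  cells : Config M → List (Γ M)
  cells c = reverse (Cf.lft c) ++ Cf.hd c ∷ Cf.rgt c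

  -- Contents are compared pointwise and through `view`, so a tape may be prolonged by blanks, and
  -- an unwritten cell is as good as the encoded cell it stands for.
  record At (s : State) (p : ℕ) (g : ℕ → Cell) (c : Config M) : Set where
    constructor at
    field
      state   : Cf.st c ≡ Q.enc s
      pos     : length (Cf.lft c) ≡ p
      content : ∀ j → view (nth (cells c) j) ≡ g j

  head-view : ∀ {s p g c} → At s p g c → view (Cf.hd c) ≡ g p
  head-view {c = conf _ l h r} (at _ refl e) = trans (cong view (sym here-hd)) (e (length l))
    where
    nth-here : ∀ (xs : List (Γ M)) {ys} → nth (xs ++ h ∷ ys) (length xs) ≡ h
    nth-here []       = refl
    nth-here (x ∷ xs) = nth-here xs
    here-hd : nth (reverse l ++ h ∷ r) (length l) ≡ h
    here-hd = subst (λ k → nth (reverse l ++ h ∷ r) k ≡ h) (List.length-reverse l) (nth-here (reverse l))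

  moveTo : Move → ℕ → ℕ
  moveTo left  = pred
  moveTo right = suc
  moveTo stay  = id

  write : ∀ {s p g c} v → At s p g c → ∀ j →
          view (nth (reverse (Cf.lft c) ++ put v ∷ Cf.rgt c) j) ≡ upd g p v j
  write {g = g} {c = conf _ l h r} v (at _ refl e) j =
    trans (cong view (nth-upd (reverse l) (put v) r j))
      (trans (upd-map view {nth (reverse l ++ h ∷ r)} {g} (length (reverse l)) (put v) e (C.dec∘enc v) j)
             (cong (λ k → upd g k v j) (List.length-reverse l)))

  reverse-∷ : ∀ {A : Set} (x : A) xs ys → reverse (x ∷ xs) ++ ys ≡ reverse xs ++ x ∷ ys
  reverse-∷ x xs ys = trans (cong (_++ ys) (List.unfold-reverse x xs)) (List.++-assoc (reverse xs) (x ∷ []) ys)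

  apply-At : ∀ {s p g c} s′ v mv → At s p g c →
             At s′ (moveTo mv p) (upd g p v) (apply M c (Q.enc s′ , put v , mv))
  apply-At {c = conf _ l h r} s′ v stay A@(at _ refl e) = at refl refl (write v A)
  apply-At {c = conf _ [] h r} s′ v left A@(at _ refl e) = at refl refl (write v A)
  apply-At {c = conf _ (b ∷ l) h r} s′ v left A@(at _ refl e) = at refl refl
    λ j → trans (cong (λ z → view (nth z j)) (sym (reverse-∷ b l (put v ∷ r)))) (write v A j)
  apply-At {c = conf _ l h []} s′ v right A@(at _ refl e) = at refl refl
    λ j → trans (cong (λ z → view (nth z j)) (reverse-∷ (put v) l (nothing ∷ [])))
      (trans (cong view (trans (cong (λ z → nth z j) (sym (List.++-assoc (reverse l) (put v ∷ []) (nothing ∷ []))))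
                               (nth-blank (reverse l ++ put v ∷ []) j)))
             (write v A j))
  apply-At {c = conf _ l h (b ∷ r)} s′ v right A@(at _ refl e) = at refl refl
    λ j → trans (cong (λ z → view (nth z j)) (reverse-∷ (put v) l (b ∷ r))) (write v A j)

  mode : Bool → Mode M
  mode true  = ∃m
  mode false = ∀m

  -- `fwd` serves completeness and `bwd` soundness. The states passed are deterministic and of the
  -- kind of `m`, so an accepting run from `c` has to spend these `j` steps, and the alternation
  -- budget stays the same.
  record Runs (j : ℕ) (m : Bool) (c c′ : Config M) : Set where
    field
      fwd : ∀ {t a} → Acc M t a (mode m) c′ → Acc M (j + t) a (mode m) c
      bwd : ∀ {t a} → Acc M t a (mode m) c → ∃[ t′ ] t ≡ j + t′ × Acc M t′ a (mode m) c′

  open Runs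

  kind-At : ∀ {s p g c} → At s p g c → ATM.kind M (Cf.st c) ≡ kindS s
  kind-At {s} (at e _ _) = cong kindS (trans (cong Q.dec e) (Q.dec∘enc s))

  succs-At : ∀ {s p g c} → At s p g c →
             succs M c ≡ map (λ (s′ , v , mv) → apply M c (Q.enc s′ , put v , mv)) (trans′ s (g p))
  succs-At {s} {p} {g} {c} A@(at e _ _) =
    trans (sym (List.map-∘ (trans′ (Q.dec (Cf.st c)) (view (Cf.hd c)))))
          (cong₂ (λ x y → map (λ (s′ , v , mv) → apply M c (Q.enc s′ , put v , mv)) (trans′ x y))
                 (trans (cong Q.dec e) (Q.dec∘enc s)) (head-view A))

  runs-one : ∀ m {c c′} → ATM.kind M (Cf.st c) ≡ kindOf m → succs M c ≡ c′ ∷ [] → Runs 1 m c c′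
  runs-one true {c} {c′} k s = record { fwd = fw ; bwd = λ {t} {a} → bw t a }
    where
    fw : ∀ {t a} → Acc M t a ∃m c′ → Acc M (suc t) a ∃m c
    fw w rewrite k | s = here w
    bw : ∀ t a → Acc M t a ∃m c → ∃[ t′ ] t ≡ suc t′ × Acc M t′ a ∃m c′
    bw zero a w rewrite k = ⊥-elim w
    bw (suc t) a w rewrite k | s with w
    ... | here w′ = t , refl , w′
  runs-one false {c} {c′} k s = record { fwd = fw ; bwd = λ {t} {a} → bw t a }
    where
    fw : ∀ {t a} → Acc M t a ∀m c′ → Acc M (suc t) a ∀m c
    fw w rewrite k | s = w ∷ []
    bw : ∀ t a → Acc M t a ∀m c → ∃[ t′ ] t ≡ suc t′ × Acc M t′ a ∀m c′
    bw zero a w rewrite k = ⊥-elim w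
    bw (suc t) a w rewrite k | s with w
    ... | w′ ∷ [] = t , refl , w′

  Snapshot : Set
  Snapshot = State × ℕ × (ℕ → Cell)

  Reach : Bool → ℕ → Snapshot → Snapshot → Set
  Reach m j (s , p , g) (s′ , p′ , g′) =
    ∀ c → At s p g c → ∃[ c′ ] At s′ p′ g′ c′ × Runs j m c c′

  reach-refl : ∀ {m X} → Reach m 0 X X
  reach-refl c A = c , A , record { fwd = id ; bwd = λ w → _ , refl , w }

  reach-trans : ∀ {m j k X Y Z} → Reach m j X Y → Reach m k Y Z → Reach m (j + k) X Z
  reach-trans {m} {j} {k} R S c A with R c A
  ... | c₁ , A₁ , r₁ with S c₁ A₁
  ... | c₂ , A₂ , r₂ = c₂ , A₂ , record
    { fwd = λ {t} {a} w → subst (λ z → Acc M z a (mode m) c) (sym (+-assoc j k t)) (fwd r₁ (fwd r₂ w))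
    ; bwd = λ w → let t₁ , e₁ , w₁ = bwd r₁ w ; t₂ , e₂ , w₂ = bwd r₂ w₁
                  in t₂ , trans e₁ (trans (cong (j +_) e₂) (sym (+-assoc j k t₂))) , w₂ }

  reach-step : ∀ {m s p g s′ v} mv {g′} → kindS s ≡ kindOf m → trans′ s (g p) ≡ (s′ , v , mv) ∷ [] →
               (∀ j → upd g p v j ≡ g′ j) → Reach m 1 (s , p , g) (s′ , moveTo mv p , g′)
  reach-step {s′ = s′} {v} mv k tr e c A with apply-At s′ v mv A
  ... | at e₁ e₂ e₃ = _ , at e₁ e₂ (λ j → trans (e₃ j) (e j)) ,
    runs-one _ (trans (kind-At A) k) (trans (succs-At A) (cong (map _) tr))

  -- Stacks as tracks of the tape

  fromBottom : List Sym → ℕ → Maybe Sym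
  fromBottom []       j = nothing
  fromBottom (x ∷ xs) j = upd (fromBottom xs) (length xs) (just x) j

  upd-≡ : ∀ {A : Set} (g : ℕ → A) p v → upd g p v p ≡ v
  upd-≡ g p v with p ≡ᵇ p in eq
  ... | true  = refl
  ... | false = ⊥-elim (subst T eq (≡⇒≡ᵇ p p refl))

  upd-≢ : ∀ {A : Set} (g : ℕ → A) {p j} v → j ≢ p → upd g p v j ≡ g j
  upd-≢ g {p} {j} v ne with j ≡ᵇ p in eq
  ... | true  = ⊥-elim (ne (≡ᵇ⇒≡ j p (subst T (sym eq) tt)))
  ... | false = refl

  upd-cases : ∀ {A : Set} (g g′ : ℕ → A) p v → g′ p ≡ v → (∀ {j} → j ≢ p → g j ≡ g′ j) →
              ∀ j → upd g p v j ≡ g′ j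
  upd-cases g g′ p v e f j with j ℕ.≟ p
  ... | yes refl = trans (upd-≡ g p v) (sym e)
  ... | no ne    = trans (upd-≢ g v ne) (f ne)

  fromBottom-≥ : ∀ xs {j} → length xs ≤ j → fromBottom xs j ≡ nothing
  fromBottom-≥ []       _ = refl
  fromBottom-≥ (x ∷ xs) p =
    trans (upd-≢ (fromBottom xs) (just x) (λ { refl → <-irrefl refl p })) (fromBottom-≥ xs (<⇒≤ p))

  fromBottom-< : ∀ xs {j} → j < length xs → ∃[ x ] fromBottom xs j ≡ just x
  fromBottom-< (x ∷ xs) {j} (s≤s p) with j ℕ.≟ length xs
  ... | yes refl = x , upd-≡ (fromBottom xs) (length xs) (just x)
  ... | no ne with y , e ← fromBottom-< xs (≤∧≢⇒< p ne)
    = y , trans (upd-≢ (fromBottom xs) (just x) ne) e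

  tape : Store K → ℕ → Cell
  tape σ j = (j ≡ᵇ 0) , Vec.map (λ xs → fromBottom xs j) σ

  track : ∀ σ i j → lookup (proj₂ (tape σ j)) i ≡ fromBottom (lookup σ i) j
  track σ i j = lookup-map i _ σ

  tape-[]≔ : ∀ σ i xs j → tape (σ [ i ]≔ xs) j ≡ ((j ≡ᵇ 0) , proj₂ (tape σ j) [ i ]≔ fromBottom xs j)
  tape-[]≔ σ i xs j = cong (_ ,_) (map-[]≔ _ σ i)

  tape-same : ∀ σ i xs j → fromBottom xs j ≡ fromBottom (lookup σ i) j → tape σ j ≡ tape (σ [ i ]≔ xs) j
  tape-same σ i xs j e = sym (trans (tape-[]≔ σ i xs j)
    (cong (_ ,_) (trans (cong (proj₂ (tape σ j) [ i ]≔_) (trans e (sym (track σ i j))))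
                        ([]≔-lookup (proj₂ (tape σ j)) i))))

  tape-push : ∀ σ i x → let p = length (lookup σ i) in
              ∀ j → upd (tape σ) p ((p ≡ᵇ 0) , proj₂ (tape σ p) [ i ]≔ just x) j ≡
                    tape (σ [ i ]≔ (x ∷ lookup σ i)) j
  tape-push σ i x = upd-cases (tape σ) (tape (σ [ i ]≔ (x ∷ xs))) (length xs) _
    (trans (tape-[]≔ σ i (x ∷ xs) _)
           (cong (λ z → _ , proj₂ (tape σ (length xs)) [ i ]≔ z) (upd-≡ (fromBottom xs) (length xs) (just x))))
    (λ ne → tape-same σ i (x ∷ xs) _ (upd-≢ (fromBottom xs) (just x) ne))
    where xs = lookup σ i

  tape-pop : ∀ σ i {x xs} → lookup σ i ≡ x ∷ xs → let p = length xs in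
             ∀ j → upd (tape σ) p ((p ≡ᵇ 0) , proj₂ (tape σ p) [ i ]≔ nothing) j ≡
                   tape (σ [ i ]≔ xs) j
  tape-pop σ i {x} {xs} e = upd-cases (tape σ) (tape (σ [ i ]≔ xs)) (length xs) _
    (trans (tape-[]≔ σ i xs _)
           (cong (λ z → _ , proj₂ (tape σ (length xs)) [ i ]≔ z) (fromBottom-≥ xs ≤-refl)))
    (λ {j} ne → tape-same σ i xs _ (sym (trans (cong (λ z → fromBottom z j) e)
                                               (upd-≢ (fromBottom xs) (just x) ne))))

  trans′-scan : ∀ {m q c I} → instr q ≡ I → trans′ (scan , m , q) c ≡ scanI m q c I
  trans′-scan refl = refl

  data Scans (i : Fin K) : Instr → Set where
    push : ∀ {x r} → Scans i (push i x r)
    pop  : ∀ {f} → Scans i (pop i f)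

  scan-one : ∀ {i I m q h v x} → Scans i I → lookup v i ≡ just x →
             scanI m q (h , v) I ≡ ((scan , m , q) , (h , v) , right) ∷ []
  scan-one {m = m} {q} {h} {v} (push {x} {r}) e = cong (scanPush m q (h , v) _ x r) e
  scan-one {m = m} {q} {h} {v} (pop {f}) e = cong (scanPop m q (h , v) f) e

  reach-scan : ∀ {m q σ i} → Scans i (instr q) → ∀ p → p ≤ length (lookup σ i) →
               Reach m p ((scan , m , q) , 0 , tape σ) ((scan , m , q) , p , tape σ)
  reach-scan S zero _ = reach-refl
  reach-scan {m} {q} {σ} {i} S (suc p) l =
    subst (λ z → Reach m z ((scan , m , q) , 0 , tape σ) ((scan , m , q) , suc p , tape σ)) (+-comm p 1)
      (reach-trans {Y = (scan , m , q) , p , tape σ}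
        (reach-scan S p (<⇒≤ l))
        (reach-step right refl
          (scan-one S (trans (track σ i p) (proj₂ (fromBottom-< (lookup σ i) l))))
          (upd-self (tape σ) p)))

  reach-return : ∀ {m q σ} p → Reach m (suc p) ((return , m , q) , p , tape σ) ((begin , m , q) , 0 , tape σ)
  reach-return {m} {q} {σ} zero = reach-step {g = tape σ} stay refl refl (upd-self (tape σ) 0)
  reach-return {m} {q} {σ} (suc p) =
    reach-trans {Y = (return , m , q) , p , tape σ}
      (reach-step {g = tape σ} left refl refl (upd-self (tape σ) (suc p))) (reach-return p)

  reach-push : ∀ {m q σ i x r} → instr q ≡ push i x r → ∃[ j ] j ≤ 2 * length (lookup σ i) + 5 ×
               Reach m (suc j) ((begin , m , q) , 0 , tape σ) ((begin , m , r) , 0 , tape (σ [ i ]≔ (x ∷ lookup σ i)))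
  reach-push {m} {q} {σ} {i} {x} {r} e = p + (1 + suc p) , bound ,
    reach-trans {Y = (scan , m , q) , 0 , tape σ}
      (reach-step stay (cong (kindI m) e) (cong (beginI m q _) e) (upd-self (tape σ) 0))
    (reach-trans {Y = (scan , m , q) , p , tape σ}
      (reach-scan (subst (Scans i) (sym e) push) p ≤-refl)
    (reach-trans {Y = (return , m , r) , p , tape (σ [ i ]≔ (x ∷ lookup σ i))}
      (reach-step stay refl
        (trans (trans′-scan e) (cong (scanPush m q _ i x r) (trans (track σ i p) (fromBottom-≥ (lookup σ i) ≤-refl))))
        (tape-push σ i x))
      (reach-return p)))
    where
    p = length (lookup σ i)
    bound : p + (1 + suc p) ≤ 2 * p + 5
    bound = ≤-trans (≤-reflexive (solve 1 (λ p → p :+ (con 1 :+ (con 1 :+ p)) := con 2 :* p :+ con 2) refl p))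
                    (+-monoʳ-≤ (2 * p) (s≤s (s≤s z≤n)))
      where open +-*-Solver

  reach-pop : ∀ {m q σ i f} → instr q ≡ pop i f → ∃[ j ] j ≤ 2 * length (lookup σ i) + 5 ×
              Reach m (suc j) ((begin , m , q) , 0 , tape σ)
                    ((begin , m , f (head (lookup σ i))) , 0 , tape (σ [ i ]≔ drop 1 (lookup σ i)))
  reach-pop {m} {q} {σ} {i} {f} e with lookup σ i in el
  ... | [] = 1 , s≤s z≤n ,
    reach-trans {Y = (scan , m , q) , 0 , tape σ}
      (reach-step stay (cong (kindI m) e) (cong (beginI m q _) e) (upd-self (tape σ) 0))
      (reach-step stay refl
        (trans (trans′-scan e) (cong (scanPop m q _ f) (trans (track σ i 0) (cong (λ z → fromBottom z 0) el))))
        (λ j → trans (upd-self (tape σ) 0 j) (tape-same σ i [] j (sym (cong (λ z → fromBottom z j) el)))))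
  ... | x ∷ xs = suc (length xs) + (1 + (1 + suc (length xs))) , bound ,
    reach-trans {Y = (scan , m , q) , 0 , tape σ}
      (reach-step stay (cong (kindI m) e) (cong (beginI m q _) e) (upd-self (tape σ) 0))
    (reach-trans {Y = (scan , m , q) , suc p , tape σ}
      (reach-scan (subst (Scans i) (sym e) pop) (suc p) (≤-reflexive (sym (cong length el))))
    (reach-trans {Y = (erase , m , q) , p , tape σ}
      (reach-step left refl
        (trans (trans′-scan e) (cong (scanPop m q _ f)
          (trans (track σ i (suc p)) (fromBottom-≥ (lookup σ i) (≤-reflexive (cong length el))))))
        (upd-self (tape σ) (suc p)))
    (reach-trans {Y = (return , m , f (just x)) , p , tape (σ [ i ]≔ xs)}
      (reach-step stay refl
        (trans (cong (eraseI m _) e)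
          (cong (λ z → ((return , m , f z) , ((p ≡ᵇ 0) , proj₂ (tape σ p) [ i ]≔ nothing) , stay) ∷ [])
            (trans (track σ i p) (trans (cong (λ z → fromBottom z p) el) (upd-≡ (fromBottom xs) p (just x))))))
        (tape-pop σ i el))
      (reach-return p))))
    where
    p = length xs
    bound : suc p + (1 + (1 + suc p)) ≤ 2 * suc p + 5
    bound = ≤-trans (≤-reflexive (solve 1 (λ p → (con 1 :+ p) :+ (con 1 :+ (con 1 :+ (con 1 :+ p))) := con 2 :* (con 1 :+ p) :+ con 2) refl p))
                    (+-monoʳ-≤ (2 * suc p) (s≤s (s≤s z≤n)))
      where open +-*-Solver

  -- Changes of the mover and branching

  ModeKind : Bool → Kind → Set
  ModeKind m k = k ≡ kindOf m ⊎ k ≡ accept ⊎ k ≡ reject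

  kindI-mode : ∀ m I → ModeKind m (kindI m I)
  kindI-mode m (push _ _ _) = inj₁ refl
  kindI-mode m (pop _ _)    = inj₁ refl
  kindI-mode m (branch _ _) = inj₁ refl
  kindI-mode m (flip _)     = inj₁ refl
  kindI-mode m (goto _)     = inj₁ refl
  kindI-mode true win       = inj₂ (inj₁ refl)
  kindI-mode false win      = inj₂ (inj₂ refl)
  kindI-mode true lose      = inj₂ (inj₂ refl)
  kindI-mode false lose     = inj₂ (inj₁ refl)

  -- Entering the other player's block is charged one alternation, whereas a verdict is free; one
  -- unit covers both cases.
  switch : ∀ {t a k c} m → ModeKind (not m) k → Node M t a (mode (not m)) k c → Node M t (suc a) (mode m) k c
  switch m (inj₂ (inj₁ refl)) _ = tt
  switch m (inj₂ (inj₂ refl)) ()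
  switch {zero} true  (inj₁ refl) ()
  switch {zero} false (inj₁ refl) ()
  switch {suc t} true  (inj₁ refl) w = w
  switch {suc t} false (inj₁ refl) w = w

  -- What remains of the budget depends on whether a verdict has been reached, and soundness does
  -- not count alternations; hence just some `b`.
  unswitch : ∀ {t a k c} m → ModeKind (not m) k → Node M t a (mode m) k c → ∃[ b ] Node M t b (mode (not m)) k c
  unswitch m (inj₂ (inj₁ refl)) _ = 0 , tt
  unswitch m (inj₂ (inj₂ refl)) ()
  unswitch {zero} true  (inj₁ refl) ()
  unswitch {zero} false (inj₁ refl) ()
  unswitch {suc t} {suc a} true  (inj₁ refl) w = a , w
  unswitch {suc t} {suc a} false (inj₁ refl) w = a , w
  unswitch {suc t} {zero} true  (inj₁ refl) ()
  unswitch {suc t} {zero} false (inj₁ refl) ()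

  Snap : Bool → Fin N → Store K → Config M → Set
  Snap m q σ = At (begin , m , q) 0 (tape σ)

  snap-kind : ∀ {m q σ c} → Snap m q σ c → ATM.kind M (Cf.st c) ≡ kindI m (instr q)
  snap-kind A = kind-At A

  snap-mode : ∀ {m q σ c} → Snap m q σ c → ModeKind m (ATM.kind M (Cf.st c))
  snap-mode {m} {q} A = subst (ModeKind m) (sym (kind-At A)) (kindI-mode m (instr q))

  reach-stay : ∀ {m m′ q r σ} → kindI m (instr q) ≡ kindOf m →
               beginI m q (tape σ 0) (instr q) ≡ ((begin , m′ , r) , tape σ 0 , stay) ∷ [] →
               Reach m 1 ((begin , m , q) , 0 , tape σ) ((begin , m′ , r) , 0 , tape σ)
  reach-stay {σ = σ} k e = reach-step {g = tape σ} stay k e (upd-self (tape σ) 0)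

  module _ {m q r s σ c} (e : instr q ≡ branch r s) (A : Snap m q σ c) where

    cˡ cʳ : Config M
    cˡ = apply M c (Q.enc (begin , m , r) , put (tape σ 0) , stay)
    cʳ = apply M c (Q.enc (begin , m , s) , put (tape σ 0) , stay)

    branch-succs : succs M c ≡ cˡ ∷ cʳ ∷ []
    branch-succs = trans (succs-At A) (cong (map _) (cong (beginI m q (tape σ 0)) e))

    branch-kind : ATM.kind M (Cf.st c) ≡ kindOf m
    branch-kind = trans (snap-kind A) (cong (kindI m) e)

    snapˡ : Snap m r σ cˡ
    snapˡ with at e₁ e₂ e₃ ← apply-At (begin , m , r) (tape σ 0) stay A
      = at e₁ e₂ (λ j → trans (e₃ j) (upd-self (tape σ) 0 j))

    snapʳ : Snap m s σ cʳ
    snapʳ with at e₁ e₂ e₃ ← apply-At (begin , m , s) (tape σ 0) stay A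
      = at e₁ e₂ (λ j → trans (e₃ j) (upd-self (tape σ) 0 j))

  Both : Bool → Set → Set → Set
  Both true  P Q = P ⊎ Q
  Both false P Q = P × Q

  branch-fwd : ∀ m {c c₁ c₂ t a} → ATM.kind M (Cf.st c) ≡ kindOf m → succs M c ≡ c₁ ∷ c₂ ∷ [] →
               Both m (Acc M t a (mode m) c₁) (Acc M t a (mode m) c₂) → Acc M (suc t) a (mode m) c
  branch-fwd true  k s w rewrite k | s with w
  ... | inj₁ w₁ = here w₁
  ... | inj₂ w₂ = there (here w₂)
  branch-fwd false k s (w₁ , w₂) rewrite k | s = w₁ ∷ w₂ ∷ []

  branch-bwd : ∀ m {c c₁ c₂} t {a} → ATM.kind M (Cf.st c) ≡ kindOf m → succs M c ≡ c₁ ∷ c₂ ∷ [] →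
               Acc M t a (mode m) c → ∃[ t′ ] t ≡ suc t′ × Both m (Acc M t′ a (mode m) c₁) (Acc M t′ a (mode m) c₂)
  branch-bwd true  zero    k s w rewrite k = ⊥-elim w
  branch-bwd false zero    k s w rewrite k = ⊥-elim w
  branch-bwd true  (suc t) k s w rewrite k | s with w
  ... | here w₁ = t , refl , inj₁ w₁
  ... | there (here w₂) = t , refl , inj₂ w₂
  branch-bwd false (suc t) k s w rewrite k | s with w
  ... | w₁ ∷ w₂ ∷ [] = t , refl , w₁ , w₂

  length-push : ∀ (σ : Store K) i x {t S} → (∀ j → length (lookup σ j) + suc t ≤ S) →
                ∀ j → length (lookup (σ [ i ]≔ (x ∷ lookup σ i)) j) + t ≤ S
  length-push σ i x {t} b j with i Fin.≟ j
  ... | yes refl rewrite lookup∘update i σ (x ∷ lookup σ i) =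
    ≤-trans (≤-reflexive (sym (+-suc _ t))) (b i)
  ... | no ne rewrite lookup∘update′ (ne ∘ sym) σ (x ∷ lookup σ i) =
    ≤-trans (+-monoʳ-≤ _ (n≤1+n t)) (b j)

  length-pop : ∀ (σ : Store K) i {t S} → (∀ j → length (lookup σ j) + suc t ≤ S) →
               ∀ j → length (lookup (σ [ i ]≔ drop 1 (lookup σ i)) j) + t ≤ S
  length-pop σ i {t} b j with i Fin.≟ j
  ... | yes refl rewrite lookup∘update i σ (drop 1 (lookup σ i)) =
    ≤-trans (+-mono-≤ (shorter (lookup σ i)) (n≤1+n t)) (b i)
    where
    shorter : ∀ (xs : List Sym) → length (drop 1 xs) ≤ length xs
    shorter []       = z≤n
    shorter (_ ∷ xs) = n≤1+n _
  ... | no ne rewrite lookup∘update′ (ne ∘ sym) σ (drop 1 (lookup σ i)) =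
    ≤-trans (+-monoʳ-≤ _ (n≤1+n t)) (b j)

  -- Simulation of the stack machine

  module _ (S : ℕ) where

    W : ℕ
    W = 2 * S + 6

    fits : ∀ {l t j} → l + suc t ≤ S → j ≤ 2 * l + 5 → suc j ≤ W
    fits {l} {t} {j} b p = ≤-trans (s≤s p) (≤-trans (≤-reflexive (sym (+-suc (2 * l) 5)))
      (+-monoˡ-≤ 6 (*-monoʳ-≤ 2 (≤-trans (m≤m+n l (suc t)) b))))

    drop-steps : ∀ {t j T} → suc j ≤ W → suc t * W ≤ T → ∃[ T′ ] T ≡ suc j + T′ × t * W ≤ T′
    drop-steps {t} {j} {T} p q = T ∸ suc j , sym (m+[n∸m]≡n (≤-trans p (≤-trans (m≤m+n W _) q))) ,
      ≤-trans (≤-reflexive (sym (m+n∸m≡n W (t * W)))) (∸-mono q p)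

    -- Height plus remaining steps stays at most `S`, because a step raises a stack by at most one.
    -- So every stack operation walks at most `S` cells each way and fits into `W` tape steps,
    -- whatever has been pushed before.
    simulate : ∀ t {T a m q d σ c} → t * W ≤ T → (∀ i → length (lookup σ i) + t ≤ S) → code q ≡ d →
               Snap m q σ c → Wins t a m d σ → Acc M T a (mode m) c
    simulate zero _ _ _ _ ()
    simulate (suc t) {m = m} {q} {d} {σ} l b eq A w with instr-implements q eq
    simulate (suc t) {m = m} {q} {_} {σ} l b eq A w | push i x r , e , push g
      with j , p , R ← reach-push {m} {q} {σ} e
      with T′ , refl , l′ ← drop-steps {t} (fits {t = t} (b i) p) l
      with c′ , A′ , runs ← R _ A
      = fwd runs (simulate t l′ (length-push σ i x b) g A′ w)
    simulate (suc t) {m = m} {q} {_} {σ} l b eq A w | pop i f , e , pop g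
      with j , p , R ← reach-pop {m} {q} {σ} e
      with T′ , refl , l′ ← drop-steps {t} (fits {t = t} (b i) p) l
      with c′ , A′ , runs ← R _ A
      = fwd runs (simulate t l′ (length-pop σ i b) (g _) A′ w)
    simulate (suc t) {a = a} {m} {q} {_} {σ} l b eq A w | branch r s , e , branch {c = d} {d′} g g′
      with T′ , refl , l′ ← drop-steps {t} {j = 0} (≤-trans (s≤s z≤n) (m≤n+m 6 (2 * S))) l
      = branch-fwd m (branch-kind {σ = σ} e A) (branch-succs {σ = σ} e A) (go m w
          (λ v → simulate t l′ b′ g (snapˡ {σ = σ} e A) v) (λ v → simulate t l′ b′ g′ (snapʳ {σ = σ} e A) v))
      where
      b′ : ∀ i → length (lookup σ i) + t ≤ S
      b′ i = ≤-trans (+-monoʳ-≤ _ (n≤1+n t)) (b i)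
      go : ∀ m {P P′} → Wins (suc t) a m (branch d d′) σ →
           (Wins t a m d σ → P) → (Wins t a m d′ σ → P′) → Both m P P′
      go true (inj₁ w) f g = inj₁ (f w)
      go true (inj₂ w) f g = inj₂ (g w)
      go false (w , w′) f g = f w , g w′
    simulate (suc t) {a = suc a} {m} {q} {_} {σ} l b eq A w | flip r , e , flip g
      with T′ , refl , l′ ← drop-steps {t} {j = 0} (≤-trans (s≤s z≤n) (m≤n+m 6 (2 * S))) l
      with c′ , A′ , runs ← reach-stay {m} {not m} {q} {r} {σ} (cong (kindI m) e) (cong (beginI m q _) e) _ A
      = fwd runs (switch m (snap-mode A′) (simulate t l′ (λ i → ≤-trans (+-monoʳ-≤ _ (n≤1+n t)) (b i)) g A′ w))
    simulate (suc t) {m = m} {q} {_} {σ} l b eq A w | goto r , e , goto g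
      with T′ , refl , l′ ← drop-steps {t} {j = 0} (≤-trans (s≤s z≤n) (m≤n+m 6 (2 * S))) l
      with c′ , A′ , runs ← reach-stay {m} {m} {q} {r} {σ} (cong (kindI m) e) (cong (beginI m q _) e) _ A
      = fwd runs (simulate t l′ (λ i → ≤-trans (+-monoʳ-≤ _ (n≤1+n t)) (b i)) g A′ w)
    simulate (suc t) {m = true} l b eq A w | win , e , win rewrite snap-kind A | e = tt
    simulate (suc t) {m = false} l b eq A w | lose , e , lose rewrite snap-kind A | e = tt

  -- An instruction consumes several tape steps at once, so the induction is on a bound `n` for `t`.
  -- Each instruction takes at least one tape step, so `t` bounds both the instructions and the
  -- flips; the extra unit is due to `win` and `lose`, which take a step of `Wins` while the machine
  -- accepts in time zero.
  unsimulate : ∀ n t {a m q d σ c} → t ≤ n → code q ≡ d → Snap m q σ c → Acc M t a (mode m) c →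
               Wins (suc t) (suc t) m d σ
  unsimulate n t {a} {m} {q} {d} {σ} l eq A w with instr-implements q eq
  unsimulate n t {m = true} l eq A w | win , e , win = tt
  unsimulate n t {m = false} l eq A w | win , e , win rewrite snap-kind A | e = ⊥-elim w
  unsimulate n t {m = true} l eq A w | lose , e , lose rewrite snap-kind A | e = ⊥-elim w
  unsimulate n t {m = false} l eq A w | lose , e , lose = tt
  unsimulate n t {a} {m} {q} {_} {σ} l eq A w | push i x r , e , push {c = d} g
    with j , p , R ← reach-push {m} {q} {σ} e
    with c′ , A′ , runs ← R _ A
    with t′ , refl , w′ ← bwd runs w
    with s≤s {n = n′} l′ ← l
    = Wins-mono m d _ (s≤s (m≤n+m t′ j)) (s≤s (m≤n+m t′ (suc j)))
        (unsimulate n′ t′ (≤-trans (m≤n+m t′ j) l′) g A′ w′)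
  unsimulate n t {a} {m} {q} {_} {σ} l eq A w | pop i f , e , pop {k = k} g
    with j , p , R ← reach-pop {m} {q} {σ} e
    with c′ , A′ , runs ← R _ A
    with t′ , refl , w′ ← bwd runs w
    with s≤s {n = n′} l′ ← l
    = Wins-mono m (k (head (lookup σ i))) _ (s≤s (m≤n+m t′ j)) (s≤s (m≤n+m t′ (suc j)))
        (unsimulate n′ t′ (≤-trans (m≤n+m t′ j) l′) (g _) A′ w′)
  unsimulate n t {a} {m} {q} {_} {σ} l eq A w | branch r s , e , branch {c = d} {d′} g g′
    with t′ , refl , w′ ← branch-bwd m t (branch-kind {σ = σ} e A) (branch-succs {σ = σ} e A) w
    with s≤s {n = n′} l′ ← l
    = go m w′ (λ v → Wins-mono {t = suc t′} {a = suc t′} m d σ ≤-refl (n≤1+n _) (unsimulate n′ t′ l′ g (snapˡ {σ = σ} e A) v))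
              (λ v → Wins-mono {t = suc t′} {a = suc t′} m d′ σ ≤-refl (n≤1+n _) (unsimulate n′ t′ l′ g′ (snapʳ {σ = σ} e A) v))
    where
    go : ∀ m {u b P P′} → Both m P P′ → (P → Wins u b m d σ) → (P′ → Wins u b m d′ σ) →
         Wins (suc u) b m (branch d d′) σ
    go true (inj₁ w) f g = inj₁ (f w)
    go true (inj₂ w) f g = inj₂ (g w)
    go false (w , w′) f g = f w , g w′
  unsimulate n t {a} {m} {q} {_} {σ} l eq A w | flip r , e , flip g
    with c′ , A′ , runs ← reach-stay {m} {not m} {q} {r} {σ} (cong (kindI m) e) (cong (beginI m q _) e) _ A
    with t′ , refl , w′ ← bwd runs w
    with s≤s {n = n′} l′ ← l
    with b , v ← unswitch m (snap-mode A′) w′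
    = unsimulate n′ t′ l′ g A′ v
  unsimulate n t {a} {m} {q} {_} {σ} l eq A w | goto r , e , goto {l = l₁} g
    with c′ , A′ , runs ← reach-stay {m} {m} {q} {r} {σ} (cong (kindI m) e) (cong (beginI m q _) e) _ A
    with t′ , refl , w′ ← bwd runs w
    with s≤s {n = n′} l′ ← l
    = Wins-mono {t = suc t′} {a = suc t′} m (prog l₁) σ ≤-refl (n≤1+n _) (unsimulate n′ t′ l′ g A′ w′)

  -- The input as initial store

  initial : List Sym → Store K
  initial w = Vec.replicate K [] [ inp ]≔ reverse w

  fromBottom-snoc-zero : ∀ xs x → fromBottom (xs ++ x ∷ []) 0 ≡ just x
  fromBottom-snoc-zero []       x = refl
  fromBottom-snoc-zero (y ∷ ys) x rewrite List.length-++ ys {x ∷ []} | +-comm (length ys) 1 =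
    fromBottom-snoc-zero ys x

  fromBottom-snoc-suc : ∀ xs x j → fromBottom (xs ++ x ∷ []) (suc j) ≡ fromBottom xs j
  fromBottom-snoc-suc []       x j = refl
  fromBottom-snoc-suc (y ∷ ys) x j rewrite List.length-++ ys {x ∷ []} | +-comm (length ys) 1 =
    cong (λ z → if j ≡ᵇ length ys then just y else z) (fromBottom-snoc-suc ys x j)

  fromBottom-reverse : ∀ w j → fromBottom (reverse w) j ≡ nth (map just w) j
  fromBottom-reverse [] j = refl
  fromBottom-reverse (x ∷ w) zero rewrite List.unfold-reverse x w = fromBottom-snoc-zero (reverse w) x
  fromBottom-reverse (x ∷ w) (suc j) rewrite List.unfold-reverse x w =
    trans (fromBottom-snoc-suc (reverse w) x j) (fromBottom-reverse w j)

  blank-[]≔ : ∀ i → blank [ i ]≔ nothing ≡ blank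
  blank-[]≔ i = trans (cong (blank [ i ]≔_) (sym (lookup-replicate i nothing))) ([]≔-lookup blank i)

  view-input : ∀ w j → proj₂ (view (nth (map (λ b → just (inj₁ b)) w) j)) ≡ blank [ inp ]≔ nth (map just w) j
  view-input []      j       = sym (blank-[]≔ inp)
  view-input (x ∷ w) zero    = refl
  view-input (x ∷ w) (suc j) = view-input w j

  view-flag : ∀ w j → proj₁ (view (nth (map (λ b → just (inj₁ b)) w) j)) ≡ false
  view-flag []      j       = refl
  view-flag (x ∷ w) zero    = refl
  view-flag (x ∷ w) (suc j) = view-flag w j

  cells-init : ∀ w j → nth (cells (initConf M w)) j ≡ nth (map (λ b → just (inj₁ b)) w) j
  cells-init []      zero    = refl
  cells-init []      (suc j) = refl
  cells-init (x ∷ w) j       = refl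

  init-content : ℕ → List Sym → Cell
  init-content j w = view (nth (map (λ b → just (inj₁ b)) w) j)

  At-init : ∀ w → At (init , true , q₀) 0 (λ j → init-content j w) (initConf M w)
  At-init w = at (st w) (pos w) (λ j → cong view (cells-init w j))
    where
    st : ∀ w → Cf.st (initConf M w) ≡ Q.enc (init , true , q₀)
    st []      = refl
    st (x ∷ w) = refl
    pos : ∀ w → length (Cf.lft (initConf M w)) ≡ 0
    pos []      = refl
    pos (x ∷ w) = refl

  tape-initial : ∀ w j → tape (initial w) j ≡ ((j ≡ᵇ 0) , proj₂ (init-content j w))
  tape-initial w j = trans (tape-[]≔ (Vec.replicate K []) inp (reverse w) j)
    (cong (_ ,_) (trans (cong₂ (λ u z → u [ inp ]≔ z) (empty K) (fromBottom-reverse w j)) (sym (view-input w j))))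
    where
    empty : ∀ n → Vec.map (λ xs → fromBottom xs j) (Vec.replicate n []) ≡ Vec.replicate n nothing
    empty zero    = refl
    empty (suc n) = cong (nothing ∷_) (empty n)

  reach-init : ∀ w → Reach true 1 ((init , true , q₀) , 0 , λ j → init-content j w)
                                  ((begin , true , q₀) , 0 , tape (initial w))
  reach-init w = reach-step {g = λ j → init-content j w} stay refl refl
    (λ { zero → sym (tape-initial w 0)
       ; (suc j) → trans (cong (_, proj₂ (init-content (suc j) w)) (view-flag w (suc j)))
                         (sym (tape-initial w (suc j))) })

  -- The first block is free of charge and the start state is existential, so the run may be
  -- analysed as if an existential block had already been entered.
  none-∃m : ∀ t a {c} → ATM.kind M (Cf.st c) ≡ exist → Acc M t a none c ≡ Acc M t a ∃m c
  none-∃m zero    a k rewrite k = refl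
  none-∃m (suc t) a k rewrite k = refl

  length-initial : ∀ w i → length (lookup (initial w) i) ≤ length w
  length-initial w i with inp Fin.≟ i
  ... | yes refl rewrite lookup∘update inp (Vec.replicate K []) (reverse w) = ≤-reflexive (List.length-reverse w)
  ... | no ne rewrite lookup∘update′ (ne ∘ sym) (Vec.replicate K []) (reverse w) | lookup-replicate {A = List Sym} i [] = z≤n

  compile-complete : ∀ {t a} w → Wins t a true (prog l₀) (initial w) →
                     ∀ {T} → t * (2 * (length w + t) + 6) ≤ T → AcceptsWithin M (suc T) a w
  compile-complete {t} {a} w won {T} l
    with c′ , A′ , runs ← reach-init w (initConf M w) (At-init w)
    = subst id (sym (none-∃m (suc T) a (kind-At (At-init w))))
        (fwd runs (simulate (length w + t) t l (λ i → +-monoˡ-≤ t (length-initial w i)) code-q₀ A′ won))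

  compile-sound : ∀ {T a} w → AcceptsWithin M T a w → ∃[ t ] ∃[ b ] Wins t b true (prog l₀) (initial w)
  compile-sound {T} {a} w acc
    with c′ , A′ , runs ← reach-init w (initConf M w) (At-init w)
    with t , _ , v ← bwd runs (subst id (none-∃m T a (kind-At (At-init w))) acc)
    = suc t , suc t , unsimulate t t ≤-refl code-q₀ A′ v

-- Linear inequalities between naturals, decided coefficientwise.

data Lin (n : ℕ) : Set where
  var  : Fin n → Lin n
  con  : ℕ → Lin n
  _⊕_  : Lin n → Lin n → Lin n
  _⊛_  : ℕ → Lin n → Lin n

infixl 6 _⊕_
infixl 7 _⊛_

module _ {n : ℕ} where

  ⟦_⟧ : Lin n → Vec ℕ n → ℕ
  ⟦ var i ⟧ ρ = lookup ρ i
  ⟦ con c ⟧ ρ = c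
  ⟦ d ⊕ e ⟧ ρ = ⟦ d ⟧ ρ + ⟦ e ⟧ ρ
  ⟦ c ⊛ e ⟧ ρ = c * ⟦ e ⟧ ρ

Coeffs : ℕ → Set
Coeffs n = ℕ × Vec ℕ n

unit : ∀ {n} → Fin n → Vec ℕ n
unit zero    = 1 ∷ Vec.replicate _ 0
unit (suc i) = 0 ∷ unit i

coeffs : ∀ {n} → Lin n → Coeffs n
coeffs (var i) = 0 , unit i
coeffs (con c) = c , Vec.replicate _ 0
coeffs (d ⊕ e) = proj₁ (coeffs d) + proj₁ (coeffs e) , Vec.zipWith _+_ (proj₂ (coeffs d)) (proj₂ (coeffs e))
coeffs (c ⊛ e) = c * proj₁ (coeffs e) , Vec.map (c *_) (proj₂ (coeffs e))

dot : ∀ {n} → Vec ℕ n → Vec ℕ n → ℕ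
dot []       []       = 0
dot (c ∷ cs) (x ∷ xs) = c * x + dot cs xs

dot-zero : ∀ {n} (ρ : Vec ℕ n) → dot (Vec.replicate n 0) ρ ≡ 0
dot-zero []      = refl
dot-zero (x ∷ ρ) = dot-zero ρ

dot-unit : ∀ {n} i (ρ : Vec ℕ n) → dot (unit i) ρ ≡ lookup ρ i
dot-unit zero    (x ∷ ρ) = trans (cong₂ _+_ (+-identityʳ x) (dot-zero ρ)) (+-identityʳ x)
dot-unit (suc i) (x ∷ ρ) = dot-unit i ρ

+-interchange : ∀ a b c d → (a + b) + (c + d) ≡ (a + c) + (b + d)
+-interchange a b c d = solve 4 (λ a b c d → (a :+ b) :+ (c :+ d) := (a :+ c) :+ (b :+ d)) refl a b c d
  where open +-*-Solver

dot-+ : ∀ {n} (u v ρ : Vec ℕ n) → dot (Vec.zipWith _+_ u v) ρ ≡ dot u ρ + dot v ρ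
dot-+ []      []      []      = refl
dot-+ (c ∷ u) (d ∷ v) (x ∷ ρ) =
  trans (cong₂ _+_ (*-distribʳ-+ x c d) (dot-+ u v ρ)) (+-interchange (c * x) (d * x) (dot u ρ) (dot v ρ))

dot-* : ∀ {n} c (u ρ : Vec ℕ n) → dot (Vec.map (c *_) u) ρ ≡ c * dot u ρ
dot-* c []      []      = sym (*-zeroʳ c)
dot-* c (d ∷ u) (x ∷ ρ) =
  trans (cong₂ _+_ (*-assoc c d x) (dot-* c u ρ)) (sym (*-distribˡ-+ c (d * x) (dot u ρ)))

coeffs-sound : ∀ {n} (e : Lin n) ρ → ⟦ e ⟧ ρ ≡ proj₁ (coeffs e) + dot (proj₂ (coeffs e)) ρ
coeffs-sound (var i) ρ = sym (dot-unit i ρ)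
coeffs-sound (con c) ρ = sym (trans (cong (c +_) (dot-zero ρ)) (+-identityʳ c))
coeffs-sound (d ⊕ e) ρ =
  trans (cong₂ _+_ (coeffs-sound d ρ) (coeffs-sound e ρ))
    (trans (+-interchange (proj₁ (coeffs d)) _ (proj₁ (coeffs e)) _)
           (cong (_ +_) (sym (dot-+ (proj₂ (coeffs d)) (proj₂ (coeffs e)) ρ))))
coeffs-sound (c ⊛ e) ρ =
  trans (cong (c *_) (coeffs-sound e ρ))
    (trans (*-distribˡ-+ c (proj₁ (coeffs e)) _) (cong (_ +_) (sym (dot-* c (proj₂ (coeffs e)) ρ))))

_≤ᵛ_ : ∀ {n} → Vec ℕ n → Vec ℕ n → Bool
[]      ≤ᵛ []      = true
(c ∷ u) ≤ᵛ (d ∷ v) = (c ≤ᵇ d) ∧ (u ≤ᵛ v)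

dot-mono : ∀ {n} (u v ρ : Vec ℕ n) → T (u ≤ᵛ v) → dot u ρ ≤ dot v ρ
dot-mono []      []      []      _ = z≤n
dot-mono (c ∷ u) (d ∷ v) (x ∷ ρ) p with q , r ← Equivalence.to T-∧ p =
  +-mono-≤ (*-monoˡ-≤ x (≤ᵇ⇒≤ c d q)) (dot-mono u v ρ r)

_≤ˡ_ : ∀ {n} → Lin n → Lin n → Bool
d ≤ˡ e = (proj₁ (coeffs d) ≤ᵇ proj₁ (coeffs e)) ∧ (proj₂ (coeffs d) ≤ᵛ proj₂ (coeffs e))

-- Comparing coefficients is enough because the variables are natural numbers. For concrete `d` and
-- `e` the side condition evaluates to `⊤`, so only the two expressions and the values have to be
-- given.
linear : ∀ {n} (d e : Lin n) → {T (d ≤ˡ e)} → ∀ ρ → ⟦ d ⟧ ρ ≤ ⟦ e ⟧ ρ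
linear d e {p} ρ with q , r ← Equivalence.to (T-∧ {x = proj₁ (coeffs d) ≤ᵇ proj₁ (coeffs e)}) p =
  subst₂ _≤_ (sym (coeffs-sound d ρ)) (sym (coeffs-sound e ρ))
    (+-mono-≤ (≤ᵇ⇒≤ _ _ q) (dot-mono (proj₂ (coeffs d)) (proj₂ (coeffs e)) ρ r))

pattern x₀ = var zero
pattern x₁ = var (suc zero)
pattern x₂ = var (suc (suc zero))
pattern x₃ = var (suc (suc (suc zero)))
pattern x₄ = var (suc (suc (suc (suc zero))))

-- Values of positions

Truth : Bool → Set → Set
Truth true  V = V
Truth false V = ¬ V

module Values {K : ℕ} {L : Set} (prog : L → Code K L) where

  open Semantics prog

  -- V says that the moving player wins; soundness (`val`) needs no bound
  -- on the resources.
  record Val (B A : ℕ) (c : Code K L) (σ : Store K) (V : Set) : Set where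
    field
      acc : ∀ m {t a} → B ≤ t → A ≤ a → Truth m V → Wins t a m c σ
      val : ∀ m t a → Wins t a m c σ → Truth m V

  open Val public

  private variable
    B A B′ A′ : ℕ
    c d : Code K L
    σ τ : Store K
    V V′ : Set

  -- Decided by playing: the game with bounds `B` and `A` is searched, and a failure refutes `V`
  -- because `acc` promises a win within exactly these bounds.
  decide : Val B A c σ V → Dec V
  decide {B} {A} {c} {σ} v with Wins? B A true c σ
  ... | yes w = yes (val v true B A w)
  ... | no ¬w = no (λ x → ¬w (acc v true ≤-refl ≤-refl x))

  v-≤ : B ≤ B′ → Val B A c σ V → Val B′ A c σ V
  v-≤ p v = record { acc = λ m q → acc v m (≤-trans p q) ; val = val v }

  v-≤ᵃ : A ≤ A′ → Val B A c σ V → Val B A′ c σ V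
  v-≤ᵃ p v = record { acc = λ m q r → acc v m q (≤-trans p r) ; val = val v }

  v-map : (V → V′) → (V′ → V) → Val B A c σ V → Val B A c σ V′
  v-map f g v = record
    { acc = λ { true p q x → acc v true p q (g x) ; false p q x → acc v false p q (x ∘ f) }
    ; val = λ { true t a w → f (val v true t a w) ; false t a w → val v false t a w ∘ g } }

  v-push : ∀ {i x} → Val B A c (σ [ i ]≔ (x ∷ lookup σ i)) V → Val (suc B) A (push i x c) σ V
  v-push v = record { acc = λ { m (s≤s p) q x → acc v m p q x }
                    ; val = λ { m (suc t) a w → val v m t a w } }

  v-pop : ∀ {i k} → Val B A (k (head (lookup σ i))) (σ [ i ]≔ drop 1 (lookup σ i)) V → Val (suc B) A (pop i k) σ V
  v-pop v = record { acc = λ { m (s≤s p) q x → acc v m p q x }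
                   ; val = λ { m (suc t) a w → val v m t a w } }

  v-goto : ∀ {l} → Val B A (prog l) σ V → Val (suc B) A (goto l) σ V
  v-goto v = record { acc = λ { m (s≤s p) q x → acc v m p q x }
                    ; val = λ { m (suc t) a w → val v m t a w } }

  v-branch : Val B A c σ V → Val B A d σ V′ → Val (suc B) A (branch c d) σ (V ⊎ V′)
  v-branch v v′ = record
    { acc = λ { true (s≤s p) q (inj₁ x) → inj₁ (acc v true p q x)
              ; true (s≤s p) q (inj₂ x) → inj₂ (acc v′ true p q x)
              ; false (s≤s p) q x → acc v false p q (x ∘ inj₁) , acc v′ false p q (x ∘ inj₂) }
    ; val = λ { true (suc t) a (inj₁ w) → inj₁ (val v true t a w)
              ; true (suc t) a (inj₂ w) → inj₂ (val v′ true t a w)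
              ; false (suc t) a (w , w′) → λ { (inj₁ x) → val v false t a w x ; (inj₂ x) → val v′ false t a w′ x } } }

  -- If the universal player flips, what is known is `¬ ¬ V` and what the continuation asks for is
  -- `V`; `decide` bridges the gap. Here determinacy within the bounds enters.
  v-flip : Val B A c σ V → Val (suc B) (suc A) (flip c) σ (¬ V)
  v-flip v = record
    { acc = λ { true (s≤s p) (s≤s q) x → acc v false p q x
              ; false (s≤s p) (s≤s q) x → acc v true p q (decidable-stable (decide v) x) }
    ; val = λ { true (suc t) (suc a) w → val v false t a w
              ; false (suc t) (suc a) w → λ x → x (val v true t a w) } }

  v-win : Val 1 0 win σ ⊤
  v-win = record { acc = λ { true (s≤s _) _ _ → tt ; false (s≤s _) _ x → ⊥-elim (x tt) }
                 ; val = λ { true (suc t) a _ → tt ; false (suc t) a () } }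

  v-lose : Val 1 0 lose σ ⊥
  v-lose = record { acc = λ { false (s≤s _) _ _ → tt }
                  ; val = λ { true (suc t) a () ; false (suc t) a _ () } }

  v-store : σ ≡ τ → Val B A c σ V → Val B A c τ V
  v-store refl v = v

  v-code : c ≡ d → Val B A c σ V → Val B A d σ V
  v-code refl v = v

  v-pop-at : ∀ {i k xs} → lookup σ i ≡ xs → Val B A (k (head xs)) (σ [ i ]≔ drop 1 xs) V → Val (suc B) A (pop i k) σ V
  v-pop-at refl v = v-pop v

  -- Two steps per symbol, the `goto` and the `pop`. In `v-move` a `push` is added, hence the factor
  -- 3 there, and the word arrives reversed on the other stack.
  v-skip : ∀ l {i k} → prog l ≡ pop i k → ∀ {w} → All (λ x → k (just x) ≡ goto l) w → ∀ {σ r} →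
           lookup σ i ≡ w ++ r → Val B A (goto l) (σ [ i ]≔ r) V → Val (2 * length w + B) A (goto l) σ V
  v-skip l {i} e [] {σ} refl v = v-store ([]≔-lookup σ i) v
  v-skip {B} l {i} {k} e {x ∷ w} (px ∷ pw) {σ} {r} eq v =
    v-≤ (≤-reflexive (cong (_+ B) (sym (*-suc 2 (length w)))))
      (v-goto (v-code (sym e) (v-pop-at eq (v-code (sym px)
        (v-skip l e pw (lookup∘update i σ (w ++ r))
          (v-store (sym ([]≔-idempotent σ i)) v))))))

  v-move : ∀ l {i j k} → prog l ≡ pop i k → i ≢ j → ∀ {w} → All (λ x → k (just x) ≡ push j x (goto l)) w →
           ∀ {σ r} → lookup σ i ≡ w ++ r → Val B A (goto l) (σ [ i ]≔ r [ j ]≔ (w ʳ++ lookup σ j)) V →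
           Val (3 * length w + B) A (goto l) σ V
  v-move l {i} {j} e ne [] {σ} {r} refl v = v-store
    (trans (cong (_[ j ]≔ lookup σ j) ([]≔-lookup σ i)) ([]≔-lookup σ j)) v
  v-move {B} l {i} {j} e ne {x ∷ w} (px ∷ pw) {σ} {r} eq v =
    v-≤ (≤-reflexive (cong (_+ B) (sym (*-suc 3 (length w)))))
      (v-goto (v-code (sym e) (v-pop-at eq (v-code (sym px) (v-push
        (v-move l e ne pw at-i (v-store same v)))))))
    where
    σ₁ = σ [ i ]≔ (w ++ r)
    σ₂ = σ₁ [ j ]≔ (x ∷ lookup σ₁ j)
    at-i : lookup σ₂ i ≡ w ++ r
    at-i = trans (lookup∘update′ ne σ₁ (x ∷ lookup σ₁ j)) (lookup∘update i σ (w ++ r))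
    σ₁-j : lookup σ₁ j ≡ lookup σ j
    σ₁-j = lookup∘update′ (ne ∘ sym) σ (w ++ r)
    same : σ [ i ]≔ r [ j ]≔ ((x ∷ w) ʳ++ lookup σ j) ≡ σ₂ [ i ]≔ r [ j ]≔ (w ʳ++ lookup σ₂ j)
    same = sym (begin
      σ₂ [ i ]≔ r [ j ]≔ (w ʳ++ lookup σ₂ j)
        ≡⟨ cong (λ z → σ₂ [ i ]≔ r [ j ]≔ (w ʳ++ z)) (trans (lookup∘update j σ₁ _) (cong (x ∷_) σ₁-j)) ⟩
      σ₂ [ i ]≔ r [ j ]≔ (w ʳ++ (x ∷ lookup σ j))
        ≡⟨ cong (_[ j ]≔ _) ([]≔-commutes σ₁ j i (ne ∘ sym)) ⟩
      σ₁ [ i ]≔ r [ j ]≔ (x ∷ lookup σ₁ j) [ j ]≔ (w ʳ++ (x ∷ lookup σ j))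
        ≡⟨ []≔-idempotent (σ₁ [ i ]≔ r) j ⟩
      σ₁ [ i ]≔ r [ j ]≔ (w ʳ++ (x ∷ lookup σ j))
        ≡⟨ cong (_[ j ]≔ _) ([]≔-idempotent σ i) ⟩
      σ [ i ]≔ r [ j ]≔ (w ʳ++ (x ∷ lookup σ j)) ∎)
      where open ≡-Reasoning

-- Stacks: the formula, the team, a buffer for rewriting the team, a unary
-- counter, a buffer for the formula (and the expectations of the parser),
-- and up to three selected assignments.
pattern fm  = zero
pattern tm  = suc zero
pattern bf  = suc (suc zero)
pattern ct  = suc (suc (suc zero))
pattern gm  = suc (suc (suc (suc zero)))
pattern sel j = suc (suc (suc (suc (suc j))))
pattern s₁  = sel zero
pattern s₂  = sel (suc zero)
pattern s₃  = sel (suc (suc zero))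

-- Labels and program

data Grab : Set where
  indep₁ indep₂ indep₃ incl₁ incl₂ : Grab

data Label : Set where
  load choose name letter eval scan side clear split index toSecond nth skipTwo
    formula digits close : Label
  unload                : Label
  pick keep discard     : Bool → Label
  items count uncount   : Bool → Label
  member equal        : Fin 8 → Label
  grab select copy done : Grab → Label
  skipOne differ        : Fin 8 → Fin 8 → Label

labelss : List (List Label)
labelss = (load ∷ choose ∷ name ∷ letter ∷ eval ∷ scan ∷ side ∷ clear ∷ split ∷ [])
        ∷ (index ∷ toSecond ∷ nth ∷ skipTwo ∷ formula ∷ digits ∷ close ∷ unload ∷ [])
        ∷ map pick bools ∷ map keep bools ∷ map items bools ∷ map count bools ∷ map uncount bools
        ∷ map member stacks ∷ map equal stacks
        ∷ map grab grabs ∷ map select grabs ∷ map copy grabs ∷ map done grabs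
        ∷ cartesianProductWith skipOne stacks stacks ∷ cartesianProductWith differ stacks stacks
        ∷ map discard bools ∷ []
  where
  bools : List Bool
  bools = Enum.elems enumBool
  stacks : List (Fin 8)
  stacks = Enum.elems (enumFin 8)
  grabs : List Grab
  grabs = indep₁ ∷ indep₂ ∷ indep₃ ∷ incl₁ ∷ incl₂ ∷ []

enumLabel : Enum Label
enumLabel = record { elems = concat labelss ; complete = all }
  where
  row : ∀ {l} i → l ∈ List.lookup labelss i → l ∈ concat labelss
  row i p = ∈-concat⁺′ {xss = labelss} p (∈-lookup {xs = labelss} i)
  grabs : ∀ {g : Grab} → g ∈ (indep₁ ∷ indep₂ ∷ indep₃ ∷ incl₁ ∷ incl₂ ∷ [])
  grabs {indep₁} = here refl
  grabs {indep₂} = there (here refl)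
  grabs {indep₃} = there (there (here refl))
  grabs {incl₁}  = there (there (there (here refl)))
  grabs {incl₂}  = there (there (there (there (here refl))))
  bools : ∀ b → b ∈ Enum.elems enumBool
  bools = Enum.complete enumBool
  stacks : ∀ i → i ∈ Enum.elems (enumFin 8)
  stacks = Enum.complete (enumFin 8)
  all : ∀ l → l ∈ concat labelss
  all load     = row (# 0) (∈-lookup (# 0))
  all choose   = row (# 0) (∈-lookup (# 1))
  all name     = row (# 0) (∈-lookup (# 2))
  all letter   = row (# 0) (∈-lookup (# 3))
  all eval     = row (# 0) (∈-lookup (# 4))
  all scan     = row (# 0) (∈-lookup (# 5))
  all side     = row (# 0) (∈-lookup (# 6))
  all clear    = row (# 0) (∈-lookup (# 7))
  all split    = row (# 0) (∈-lookup (# 8))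
  all index    = row (# 1) (∈-lookup (# 0))
  all toSecond = row (# 1) (∈-lookup (# 1))
  all nth      = row (# 1) (∈-lookup (# 2))
  all skipTwo  = row (# 1) (∈-lookup (# 3))
  all formula  = row (# 1) (∈-lookup (# 4))
  all digits   = row (# 1) (∈-lookup (# 5))
  all close    = row (# 1) (∈-lookup (# 6))
  all unload   = row (# 1) (∈-lookup (# 7))
  all (pick b)    = row (# 2) (∈-map⁺ pick (bools b))
  all (keep b)    = row (# 3) (∈-map⁺ keep (bools b))
  all (items b)   = row (# 4) (∈-map⁺ items (bools b))
  all (count b)   = row (# 5) (∈-map⁺ count (bools b))
  all (uncount b) = row (# 6) (∈-map⁺ uncount (bools b))
  all (member i)  = row (# 7) (∈-map⁺ member (stacks i))
  all (equal i) = row (# 8) (∈-map⁺ equal (stacks i))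
  all (grab g)    = row (# 9) (∈-map⁺ grab grabs)
  all (select g)  = row (# 10) (∈-map⁺ select grabs)
  all (copy g)    = row (# 11) (∈-map⁺ copy grabs)
  all (done g)    = row (# 12) (∈-map⁺ done grabs)
  all (skipOne i j) = row (# 13) (∈-cartesianProductWith⁺ skipOne (stacks i) (stacks j))
  all (differ i j)  = row (# 14) (∈-cartesianProductWith⁺ differ (stacks i) (stacks j))
  all (discard b)   = row (# 15) (∈-map⁺ discard (bools b))

Prog : Set
Prog = Code 8 Label

-- The mover claims that the name on top of fm is listed on stack i.

data Letter : Set where
  one two mark other : Letter

-- All that a comparison of names asks of a symbol. An empty stack counts as `other`, so the end of
-- the word may also end a name.
classify : Maybe Sym → Letter
classify (just sD1)  = one
classify (just sD2)  = two
classify (just sVar) = mark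
classify _           = other

memberL equalL : Fin 8 → Letter → Prog
equalOn : Fin 8 → Letter → Letter → Prog

memberL i mark  = branch (goto (equal i)) (goto (member i))
memberL i one   = goto (member i)
memberL i two   = goto (member i)
memberL i other = lose

equalOn i one one = goto (equal i)
equalOn i one _   = lose
equalOn i two two = goto (equal i)
equalOn i two _   = lose
equalOn i _   one = lose
equalOn i _   two = lose
equalOn i _   _   = win

equalL i l = pop i (λ x → equalOn i l (classify x))

memberK equalK : Fin 8 → Maybe Sym → Prog
memberK i x = memberL i (classify x)
equalK i x = equalL i (classify x)

-- The team is written from its bottom end.

guess : Prog
guess = push tm sRp (goto name)

nameC letterC : Prog
nameC   = branch (goto letter) (push tm sLp (branch (goto choose) (goto eval)))
letterC = branch (push tm sD1 (goto letter)) (branch (push tm sD2 (goto letter)) (push tm sVar (goto name)))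

loadK : Maybe Sym → Prog
loadK nothing  = flip (branch (flip (goto formula)) (flip (goto choose)))
loadK (just x) = push fm x (goto load)

pickK : Bool → Maybe Sym → Prog
pickK b nothing      = lose
pickK true  (just sLp) = branch (flip (goto (member tm))) (goto (pick true))
pickK false (just sLp) = branch (goto (member tm)) (goto (pick false))
pickK b (just _)     = goto (pick b)

-- Atoms of every sort are universal conditions on the team, so after the `flip` the opponent
-- searches for a counterexample. At `sLp` the connective is still unknown; `scan` finds it and sets
-- the left operand aside on the way.
evalK : Maybe Sym → Prog
evalK (just sVar)   = flip (goto (pick true))
evalK (just sNeg)   = pop fm (λ _ → flip (goto (pick false)))
evalK (just sLp)    = goto scan
evalK (just sTilde) = flip (goto eval)
evalK (just sIndep) = flip (goto (grab indep₁))
evalK (just sIncl)  = flip (goto (grab incl₁))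
evalK _             = lose

-- Moves the left operand to gm, stopping at the main connective.

scanAnd scanOr : Maybe Sym → Prog
scanAnd nothing  = flip (goto side)
scanAnd (just _) = push ct sLp (push gm sAnd (goto scan))
scanOr nothing  = goto split
scanOr (just _) = push ct sLp (push gm sOr (goto scan))

-- `ct` holds one symbol per open parenthesis, so a connective met with `ct` empty is the main one;
-- any other puts the popped symbol back. The parentheses of variable lists are counted along, which
-- is harmless since they are balanced.
scanK : Maybe Sym → Prog
scanK nothing     = lose
scanK (just sLp)  = push ct sLp (push gm sLp (goto scan))
scanK (just sRp)  = pop ct (λ _ → push gm sRp (goto scan))
scanK (just sAnd) = pop ct scanAnd
scanK (just sOr)  = pop ct scanOr
scanK (just x)    = push gm x (goto scan)

takeLeft takeRight : Prog
takeLeft  = push fm sAnd (goto unload)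
takeRight = goto clear

unloadK clearK : Maybe Sym → Prog
unloadK nothing  = flip (goto eval)
unloadK (just x) = push fm x (goto unload)
clearK nothing  = flip (goto eval)
clearK (just _) = goto clear

-- A disjunction: the end marker of each assignment is replaced by sRp
-- (both parts), sAnd (left part) or sOr (right part).

splitK : Maybe Sym → Prog
splitK nothing    = flip (branch (goto (keep true)) (goto (keep false)))
splitK (just sRp) = branch (push bf sRp (goto split)) (branch (push bf sAnd (goto split)) (push bf sOr (goto split)))
splitK (just x)   = push bf x (goto split)

keepS : Maybe Sym → Bool → Prog
keepS nothing     true  = takeLeft
keepS nothing     false = takeRight
keepS (just sAnd) true  = push tm sRp (goto (keep true))
keepS (just sAnd) false = goto (discard false)
keepS (just sOr)  true  = goto (discard true)
keepS (just sOr)  false = push tm sRp (goto (keep false))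
keepS (just x)    b     = push tm x (goto (keep b))

keepK : Bool → Maybe Sym → Prog
keepK b x = keepS x b

discardK : Bool → Maybe Sym → Prog
discardK b nothing    = lose
discardK b (just sLp) = goto (keep b)
discardK b (just _)   = goto (discard b)

-- The mover selects an assignment of the team and copies it.

slot : Grab → Fin 3
slot indep₁ = zero
slot indep₂ = suc zero
slot indep₃ = suc (suc zero)
slot incl₁  = zero
slot incl₂  = suc (suc zero)

-- The quantifiers of the atoms. For independence the opponent selects `s` and `t`; the claimant
-- replies that they differ on the condition or selects `u`; the opponent then chooses the
-- requirement on `u` that fails. For inclusion the opponent selects `s`, the claimant `t`, the
-- opponent a position. As the encoding lists `qs`, `ps`, `rs` in this order, a list is reached by
-- skipping those before it.
next : Grab → Prog
next indep₁ = goto (grab indep₂)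
next indep₂ = flip (branch (goto (skipOne s₁ s₂)) (goto (grab indep₃)))
next indep₃ = flip (branch (goto (differ s₁ s₃)) (branch (goto (skipOne s₁ s₃)) (goto skipTwo)))
next incl₁  = flip (goto (grab incl₂))
next incl₂  = flip (goto index)

grabK selectK copyK doneK : Grab → Maybe Sym → Prog
grabK g nothing  = goto (select g)
grabK g (just x) = push bf x (goto (grab g))
selectK g nothing    = lose
selectK g (just sRp) = push tm sRp (branch (goto (copy g)) (goto (select g)))
selectK g (just x)   = push tm x (goto (select g))
copyK g nothing    = lose
copyK g (just sLp) = push tm sLp (goto (done g))
copyK g (just x)   = push tm x (push (sel (slot g)) x (goto (copy g)))
doneK g nothing  = next g
doneK g (just x) = push tm x (goto (done g))

skipOneK : Fin 8 → Fin 8 → Maybe Sym → Prog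
skipOneK i j nothing    = lose
skipOneK i j (just sRp) = goto (differ i j)
skipOneK i j (just _)   = goto (skipOne i j)

skipTwoK : Maybe Sym → Prog
skipTwoK nothing    = lose
skipTwoK (just sRp) = goto (skipOne s₃ s₂)
skipTwoK (just _)   = goto skipTwo

-- Conjunctions of claims: the opponent chooses the one to be verified.
both : Prog → Prog → Prog
both c d = flip (branch (flip c) (flip d))

differK : Fin 8 → Fin 8 → Maybe Sym → Prog
differK i j (just sVar) =
  branch (branch (both (goto (member i)) (flip (goto (member j))))
                 (both (flip (goto (member i))) (goto (member j))))
         (goto (differ i j))
differK i j nothing    = lose
differK i j (just sRp) = lose
differK i j (just _)   = goto (differ i j)

-- ct counts the names that precede the selected one.
indexK : Maybe Sym → Prog
indexK (just sVar) =
  branch (branch (both (goto (member s₁)) (flip (goto toSecond)))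
                 (both (flip (goto (member s₁))) (goto toSecond)))
         (push ct sVar (goto index))
indexK nothing    = lose
indexK (just sRp) = lose
indexK (just _)   = goto index

toSecondK nthK nthC : Maybe Sym → Prog
toSecondK nothing    = lose
toSecondK (just sRp) = goto nth
toSecondK (just _)   = goto toSecond
nthC nothing  = goto (member s₃)
nthC (just _) = goto nth
nthK (just sVar) = pop ct nthC
nthK nothing     = lose
nthK (just sRp)  = lose
nthK (just _)    = goto nth

-- The parser; gm holds what is still expected: sAnd a connective, sRp a
-- closing parenthesis, sLp a list.

_≟ˢ_ : (x y : Sym) → Dec (x ≡ y)
x ≟ˢ y with Enum.enc enumSym x Fin.≟ Enum.enc enumSym y
... | yes e = yes (trans (sym (Enum.dec∘enc enumSym x)) (trans (cong (Enum.dec enumSym) e) (Enum.dec∘enc enumSym y)))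
... | no ne = no (ne ∘ cong (Enum.enc enumSym))

on_then_else_ : Sym → Prog → Prog → Maybe Sym → Prog
(on y then c else d) nothing  = d
(on y then c else d) (just x) = if does (x ≟ˢ y) then c else d

expect : Maybe Sym → Maybe Sym → Prog
expect nothing     nothing  = win
expect nothing     (just _) = lose
expect (just sAnd) x =
  (on sAnd then push gm sRp (goto formula) else (on sOr then push gm sRp (goto formula) else lose) x) x
expect (just sRp)  x = (on sRp then goto close else lose) x
expect (just sLp)  x = (on sLp then goto (items false) else lose) x
expect (just _)    x = lose

closeK : Maybe Sym → Prog
closeK x = pop gm (λ e → expect e x)

formulaK : Maybe Sym → Prog
formulaK (just sVar)   = goto digits
formulaK (just sNeg)   = pop fm (on sVar then goto digits else lose)
formulaK (just sLp)    = push gm sAnd (goto formula)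
formulaK (just sTilde) = goto formula
formulaK (just sIndep) = push gm sLp (push gm sLp (push gm sLp (goto close)))
formulaK (just sIncl)  = pop fm (on sLp then goto (count false) else lose)
formulaK _             = lose

digitsL : Letter → Maybe Sym → Prog
digitsL one _ = goto digits
digitsL two _ = goto digits
digitsL _   x = closeK x

digitsK : Maybe Sym → Prog
digitsK x = digitsL (classify x) x

-- The Boolean records that a name has begun, so that digits may follow.
listK : (again onName onEnd : Prog) → Bool → Maybe Sym → Prog
listK c n e b     (just sVar) = n
listK c n e b     (just sRp)  = e
listK c n e true  (just sD1)  = c
listK c n e true  (just sD2)  = c
listK c n e b     _           = lose

uncountV uncountR : Maybe Sym → Prog
uncountV nothing  = lose
uncountV (just _) = goto (uncount true)
uncountR nothing  = goto close
uncountR (just _) = lose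

itemsK countK uncountK : Bool → Maybe Sym → Prog
itemsK   = listK (goto (items true)) (goto (items true)) (goto close)
countK   = listK (goto (count true)) (push ct sVar (goto (count true)))
                 (pop fm (on sLp then goto (uncount false) else lose))
uncountK = listK (goto (uncount true)) (pop ct uncountV) (pop ct uncountR)

prog : Label → Prog
prog load          = pop gm loadK
prog choose        = guess
prog name          = nameC
prog letter        = letterC
prog eval          = pop fm evalK
prog scan          = pop fm scanK
prog side          = branch takeLeft takeRight
prog clear         = pop gm clearK
prog split         = pop tm splitK
prog index         = pop fm indexK
prog toSecond      = pop fm toSecondK
prog nth           = pop fm nthK
prog skipTwo       = pop fm skipTwoK
prog formula       = pop fm formulaK
prog digits        = pop fm digitsK
prog close         = pop fm closeK
prog unload        = pop gm unloadK
prog (pick b)      = pop tm (pickK b)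
prog (keep b)      = pop bf (keepK b)
prog (discard b)   = pop bf (discardK b)
prog (items b)     = pop fm (itemsK b)
prog (count b)     = pop fm (countK b)
prog (uncount b)   = pop fm (uncountK b)
prog (member i)    = pop i (memberK i)
prog (equal i)     = pop fm (equalK i)
prog (grab g)      = pop tm (grabK g)
prog (select g)    = pop bf (selectK g)
prog (copy g)      = pop bf (copyK g)
prog (done g)      = pop bf (doneK g)
prog (skipOne i j) = pop fm (skipOneK i j)
prog (differ i j)  = pop fm (differK i j)

open Values prog

-- Values of the evaluation game

-- An assignment is stored as the list of the names of its true variables,
-- so that every sequence of names denotes one.
Block : Set
Block = List ℕᵇ

names block : Block → List Sym
names = concatMap (λ b → sVar ∷ encBin b)
block s = sLp ∷ names s ++ sRp ∷ []

team : List Block → List Sym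
team = concatMap block

private variable
  n a : ℕ
  c d e : Prog
  σ : Store 8
  V W : Set
  f m r g : List Sym
  v : Vec (List Sym) 3
  s t u : Block
  α β γ : Assignment
  x : Sym

all-encBin : ∀ {P : Sym → Set} → P sD1 → P sD2 → ∀ b → All P (encBin b)
all-encBin p q zeroᵇ    = []
all-encBin p q 2[1+ b ] = q ∷ all-encBin p q b
all-encBin p q 1+[2 b ] = p ∷ all-encBin p q b

all-names : ∀ {P : Sym → Set} → P sVar → P sD1 → P sD2 → ∀ s → All P (names s)
all-names r p q []      = []
all-names r p q (b ∷ s) = r ∷ All.++⁺ (all-encBin p q b) (all-names r p q s)

all-encVars : ∀ {P : Sym → Set} → P sVar → P sD1 → P sD2 → ∀ xs → All P (concatMap encVar xs)
all-encVars r p q []       = []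
all-encVars r p q (x ∷ xs) = r ∷ All.++⁺ (all-encBin p q (toBin x)) (all-encVars r p q xs)

all-team : ∀ {P : Sym → Set} → P sVar → P sD1 → P sD2 → P sLp → P sRp → ∀ X → All P (team X)
all-team r p q l e []      = []
all-team r p q l e (s ∷ X) = l ∷ All.++⁺ (All.++⁺ (all-names r p q s) (e ∷ [])) (all-team r p q l e X)

data Ends : Letter → Set where
  mark  : Ends mark
  other : Ends other

-- A name is also ended by the start of another name (`Stop`), a list of names is not (`End`).
Stop End : List Sym → Set
Stop r = Ends (classify (head r))
End r  = classify (head r) ≡ other

end⇒stop : ∀ r → End r → Stop r
end⇒stop r p = subst Ends (sym p) other

∣_∣ᵇ : ℕᵇ → ℕ
∣ b ∣ᵇ = length (encBin b)

∥_∥ : Block → ℕ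
∥ [] ∥    = 0
∥ b ∷ s ∥ = suc (∣ b ∣ᵇ + ∥ s ∥)

length-names : ∀ s → length (names s) ≡ ∥ s ∥
length-names []      = refl
length-names (b ∷ s) = cong suc (trans (List.length-++ (encBin b)) (cong (∣ b ∣ᵇ +_) (length-names s)))

names-∷ : ∀ b s r → names (b ∷ s) ++ r ≡ sVar ∷ encBin b ++ (names s ++ r)
names-∷ b s r = cong (sVar ∷_) (List.++-assoc (encBin b) (names s) r)

module _ {i : Fin 8} (i≢fm : i ≢ fm) where

  ends-win : ∀ {l l′} → Ends l → Ends l′ → equalOn i l l′ ≡ win
  ends-win mark  mark  = refl
  ends-win mark  other = refl
  ends-win other mark  = refl
  ends-win other other = refl

  equal-step : ∀ {T V w w′ σ} → lookup σ fm ≡ w → lookup σ i ≡ w′ →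
               Val T 0 (equalOn i (classify (head w)) (classify (head w′))) (σ [ fm ]≔ drop 1 w [ i ]≔ drop 1 w′) V →
               Val (3 + T) 0 (goto (equal i)) σ V
  equal-step {w = w} {σ = σ} e e′ v = v-goto (v-pop-at e (v-pop-at (trans (lookup∘update′ i≢fm σ _) e′) v))

  equal-lose : ∀ {V w w′ σ} n → lookup σ fm ≡ w → lookup σ i ≡ w′ →
               equalOn i (classify (head w)) (classify (head w′)) ≡ lose → ¬ V →
               Val (n + 4) 0 (goto (equal i)) σ V
  equal-lose n e e′ l ¬v = v-≤ (m≤n+m 4 n) (equal-step e e′ (v-map ⊥-elim ¬v (v-code (sym l) v-lose)))

  equal-val : ∀ b b′ {r r′ σ} → Stop r → Stop r′ → lookup σ fm ≡ encBin b ++ r → lookup σ i ≡ encBin b′ ++ r′ →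
              Val (3 * ∣ b ∣ᵇ + 4) 0 (goto (equal i)) σ (b ≡ b′)
  equal-val zeroᵇ zeroᵇ p p′ e e′ =
    equal-step e e′ (v-map (λ _ → refl) (λ _ → tt) (v-code (sym (ends-win p p′)) v-win))
  equal-val zeroᵇ 2[1+ b′ ] p p′ e e′ = equal-lose 0 e e′ (on p) (λ ())
    where
    on : ∀ {l} → Ends l → equalOn i l two ≡ lose
    on mark  = refl
    on other = refl
  equal-val zeroᵇ 1+[2 b′ ] p p′ e e′ = equal-lose 0 e e′ (on p) (λ ())
    where
    on : ∀ {l} → Ends l → equalOn i l one ≡ lose
    on mark  = refl
    on other = refl
  equal-val b@(2[1+ _ ]) zeroᵇ p p′ e e′ = equal-lose (3 * ∣ b ∣ᵇ) e e′ (on p′) (λ ())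
    where
    on : ∀ {l} → Ends l → equalOn i two l ≡ lose
    on mark  = refl
    on other = refl
  equal-val b@(1+[2 _ ]) zeroᵇ p p′ e e′ = equal-lose (3 * ∣ b ∣ᵇ) e e′ (on p′) (λ ())
    where
    on : ∀ {l} → Ends l → equalOn i one l ≡ lose
    on mark  = refl
    on other = refl
  equal-val b@(2[1+ _ ]) 1+[2 _ ] p p′ e e′ = equal-lose (3 * ∣ b ∣ᵇ) e e′ refl (λ ())
  equal-val b@(1+[2 _ ]) 2[1+ _ ] p p′ e e′ = equal-lose (3 * ∣ b ∣ᵇ) e e′ refl (λ ())
  equal-val 2[1+ b ] 2[1+ b′ ] {r} {r′} {σ} p p′ e e′ =
    v-≤ (linear (con 3 ⊕ (3 ⊛ x₀ ⊕ con 4)) (3 ⊛ (con 1 ⊕ x₀) ⊕ con 4) (∣ b ∣ᵇ ∷ []))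
      (v-map (cong 2[1+_]) (λ { refl → refl })
        (equal-step e e′ (equal-val b b′ p p′
          (trans (lookup∘update′ (i≢fm ∘ sym) (σ [ fm ]≔ _) _) (lookup∘update fm σ _)) (lookup∘update i (σ [ fm ]≔ _) _))))
  equal-val 1+[2 b ] 1+[2 b′ ] {r} {r′} {σ} p p′ e e′ =
    v-≤ (linear (con 3 ⊕ (3 ⊛ x₀ ⊕ con 4)) (3 ⊛ (con 1 ⊕ x₀) ⊕ con 4) (∣ b ∣ᵇ ∷ []))
      (v-map (cong 1+[2_]) (λ { refl → refl })
        (equal-step e e′ (equal-val b b′ p p′
          (trans (lookup∘update′ (i≢fm ∘ sym) (σ [ fm ]≔ _) _) (lookup∘update fm σ _)) (lookup∘update i (σ [ fm ]≔ _) _))))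

  stop-names : ∀ s {r} → End r → Stop (names s ++ r)
  stop-names []      p = end⇒stop _ p
  stop-names (b ∷ s) p = mark

  -- The mover commits herself to one listed name before comparing, so the comparison is paid for
  -- once and the cost is additive in the two lengths.
  member-val : ∀ b s {r r′ σ} → Stop r → End r′ → lookup σ fm ≡ encBin b ++ r → lookup σ i ≡ names s ++ r′ →
               Val (3 * ∣ b ∣ᵇ + 3 * ∥ s ∥ + 7) 0 (goto (member i)) σ (b ∈ s)
  member-val b [] {r′ = r′} p p′ e e′ =
    v-≤ (m≤n⇒m≤o+n (3 * ∣ b ∣ᵇ + 0) (s≤s (s≤s (s≤s z≤n))))
      (v-map ⊥-elim (λ ()) (v-goto (v-pop-at e′ (v-code (cong (memberL i) (sym p′)) v-lose))))
  member-val b (b′ ∷ s) {r} {r′} {σ} p p′ e e′ =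
    v-map (λ { (inj₁ x) → here x ; (inj₂ x) → there x }) (λ { (here x) → inj₁ x ; (there x) → inj₂ x })
      (v-≤ (linear (con 3 ⊕ (2 ⊛ x₁ ⊕ (3 ⊛ x₀ ⊕ 3 ⊛ x₂ ⊕ con 7))) (3 ⊛ x₀ ⊕ 3 ⊛ (con 1 ⊕ (x₁ ⊕ x₂)) ⊕ con 7)
             (∣ b ∣ᵇ ∷ ∣ b′ ∣ᵇ ∷ ∥ s ∥ ∷ []))
        (v-goto (v-pop-at e″ (v-branch
          (v-≤ (linear (3 ⊛ x₀ ⊕ con 4) (2 ⊛ x₁ ⊕ (3 ⊛ x₀ ⊕ 3 ⊛ x₂ ⊕ con 7)) (∣ b ∣ᵇ ∷ ∣ b′ ∣ᵇ ∷ ∥ s ∥ ∷ []))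
               (equal-val b b′ p (stop-names s p′) fm₁ (lookup∘update i σ _)))
          (v-skip (member i) refl (all-encBin refl refl b′) (lookup∘update i σ _)
            (member-val b s p p′ (trans (lookup∘update′ (i≢fm ∘ sym) σ₁ _) fm₁) (lookup∘update i σ₁ _)))))))
    where
    e″ = trans e′ (names-∷ b′ s r′)
    σ₁ = σ [ i ]≔ (encBin b′ ++ (names s ++ r′))
    fm₁ : lookup σ₁ fm ≡ encBin b ++ r
    fm₁ = trans (lookup∘update′ (i≢fm ∘ sym) σ _) e

-- Differences between two assignments

Xor : Set → Set → Set
Xor V W = (V × ¬ W) ⊎ (¬ V × W)

not-or : Dec V → Dec W → ¬ (¬ V ⊎ ¬ W) → V × W
not-or p q f = decidable-stable p (f ∘ inj₁) , decidable-stable q (f ∘ inj₂)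

or-not : V × W → ¬ (¬ V ⊎ ¬ W)
or-not (x , y) (inj₁ f) = f x
or-not (x , y) (inj₂ f) = f y

both-val : Val n a c σ V → Val n a d σ W → Val (3 + n) (2 + a) (both c d) σ (V × W)
both-val v w = v-map (not-or (decide v) (decide w)) or-not (v-flip (v-branch (v-flip v) (v-flip w)))

wait : Val n a c σ V → Val (suc n) (suc a) c σ V
wait v = v-≤ (n≤1+n _) (v-≤ᵃ (n≤1+n _) v)

xor-val : Val n a c σ V → Val n a d σ W →
          Val (5 + n) (3 + a) (branch (both c (flip d)) (both (flip c) d)) σ (Xor V W)
xor-val v w = v-branch (both-val (wait v) (v-flip w)) (both-val (v-flip v) (wait w))

encVars : List ℕ → List Sym
encVars = concatMap encVar

∥_∥ᵛ : List ℕ → ℕ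
∥ xs ∥ᵛ = ∥ map toBin xs ∥

encVars-∷ : ∀ x xs r → encVars (x ∷ xs) ++ r ≡ sVar ∷ encBin (toBin x) ++ (encVars xs ++ r)
encVars-∷ x xs r = cong (sVar ∷_) (List.++-assoc (encBin (toBin x)) (encVars xs) r)

length-encVars : ∀ xs → length (encVars xs) ≡ ∥ xs ∥ᵛ
length-encVars []       = refl
length-encVars (x ∷ xs) =
  cong suc (trans (List.length-++ (encBin (toBin x))) (cong (∣ toBin x ∣ᵇ +_) (length-encVars xs)))

stop-encVars : ∀ xs {r} → Stop (encVars xs ++ sRp ∷ r)
stop-encVars []       = other
stop-encVars (x ∷ xs) = mark

Differ : Block → Block → List ℕ → Set
Differ s t = Any (λ x → Xor (toBin x ∈ s) (toBin x ∈ t))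

module _ {i j : Fin 8} (i≢fm : i ≢ fm) (j≢fm : j ≢ fm) {s t : Block} {N : ℕ}
         (s≤N : 3 * ∥ s ∥ + 7 ≤ N) (t≤N : 3 * ∥ t ∥ + 7 ≤ N) where

  member-bound : ∀ b u → 3 * ∥ u ∥ + 7 ≤ N → 3 * ∣ b ∣ᵇ + 3 * ∥ u ∥ + 7 ≤ 3 * ∣ b ∣ᵇ + N
  member-bound b u p = ≤-trans (≤-reflexive (+-assoc (3 * ∣ b ∣ᵇ) _ 7)) (+-monoʳ-≤ (3 * ∣ b ∣ᵇ) p)

  differ-val : ∀ xs {σ r r₁ r₂} → End r₁ → End r₂ → lookup σ i ≡ names s ++ r₁ → lookup σ j ≡ names t ++ r₂ →
               lookup σ fm ≡ encVars xs ++ sRp ∷ r →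
               Val (3 * ∥ xs ∥ᵛ + (N + 8)) 3 (goto (differ i j)) σ (Differ s t xs)
  differ-val [] p₁ p₂ e₁ e₂ e =
    v-≤ (≤-trans (s≤s (s≤s (s≤s z≤n))) (m≤n+m 8 N)) (v-≤ᵃ z≤n (v-map ⊥-elim (λ ()) (v-goto (v-pop-at e v-lose))))
  differ-val (x ∷ xs) {σ} {r} {r₁} {r₂} p₁ p₂ e₁ e₂ e =
    v-map Any.fromSum Any.toSum
      (v-≤ (linear (con 3 ⊕ (3 ⊛ x₀ ⊕ (3 ⊛ x₁ ⊕ (x₂ ⊕ con 8)))) (3 ⊛ (con 1 ⊕ (x₀ ⊕ x₁)) ⊕ (x₂ ⊕ con 8))
             (∣ toBin x ∣ᵇ ∷ ∥ xs ∥ᵛ ∷ N ∷ []))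
        (v-goto (v-pop-at (trans e (encVars-∷ x xs _)) (v-branch
          (v-≤ (linear (con 5 ⊕ (3 ⊛ x₀ ⊕ x₂)) (3 ⊛ x₀ ⊕ (3 ⊛ x₁ ⊕ (x₂ ⊕ con 8)))
                 (∣ toBin x ∣ᵇ ∷ ∥ xs ∥ᵛ ∷ N ∷ []))
            (xor-val (v-≤ (member-bound b s s≤N) (member-val i≢fm b s (stop-encVars xs) p₁ (lookup∘update fm σ _) (trans (lookup∘update′ i≢fm σ _) e₁)))
                     (v-≤ (member-bound b t t≤N) (member-val j≢fm b t (stop-encVars xs) p₂ (lookup∘update fm σ _) (trans (lookup∘update′ j≢fm σ _) e₂)))))
          (v-≤ (linear (2 ⊛ x₀ ⊕ (3 ⊛ x₁ ⊕ (x₂ ⊕ con 8))) (3 ⊛ x₀ ⊕ (3 ⊛ x₁ ⊕ (x₂ ⊕ con 8)))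
                 (∣ toBin x ∣ᵇ ∷ ∥ xs ∥ᵛ ∷ N ∷ []))
            (v-skip (differ i j) refl (all-encBin refl refl b) (lookup∘update fm σ _)
            (differ-val xs p₁ p₂ (trans (lookup∘update′ i≢fm σ₁ _) (trans (lookup∘update′ i≢fm σ _) e₁))
              (trans (lookup∘update′ j≢fm σ₁ _) (trans (lookup∘update′ j≢fm σ _) e₂)) (lookup∘update fm σ₁ _))))))))
    where
    b = toBin x
    σ₁ = σ [ fm ]≔ (encBin b ++ (encVars xs ++ sRp ∷ r))

-- Stores that hold a team, and the selection of assignments

S : List Sym → List Sym → List Sym → List Sym → List Sym → Vec (List Sym) 3 → Store 8
S f t b c g v = f ∷ t ∷ b ∷ c ∷ g ∷ v

∥_∥ᵗ : List Block → ℕ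
∥ [] ∥ᵗ    = 0
∥ s ∷ X ∥ᵗ = 2 + ∥ s ∥ + ∥ X ∥ᵗ

length-block : ∀ s → length (block s) ≡ 2 + ∥ s ∥
length-block s = cong suc (trans (List.length-++ (names s)) (trans (+-comm _ 1) (cong suc (length-names s))))

length-team : ∀ X → length (team X) ≡ ∥ X ∥ᵗ
length-team []      = refl
length-team (s ∷ X) = trans (List.length-++ (block s)) (cong₂ _+_ (length-block s) (length-team X))

∈-size : ∀ {s X} → s ∈ X → ∥ s ∥ ≤ ∥ X ∥ᵗ
∈-size {s} {X = _ ∷ X} (here refl) = ≤-trans (m≤m+n ∥ s ∥ ∥ X ∥ᵗ) (m≤n+m _ 2)
∈-size {X = s ∷ X} (there p) = ≤-trans (∈-size p) (m≤n+m ∥ X ∥ᵗ (2 + ∥ s ∥))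

team-∷ : ∀ s X → team (s ∷ X) ≡ sLp ∷ names s ++ sRp ∷ team X
team-∷ s X = cong (sLp ∷_) (List.++-assoc (names s) (sRp ∷ []) (team X))

Violates : Bool → ℕᵇ → Block → Set
Violates true  b s = ¬ b ∈ s
Violates false b s = b ∈ s

pick-val : ∀ p b X {r} → Stop r → ∀ {v} →
           Val (3 * ∣ b ∣ᵇ + 3 * ∥ X ∥ᵗ + 10) 1 (goto (pick p)) (S (encBin b ++ r) (team X) [] [] [] v)
             (Any (Violates p b) X)
pick-val true b [] q = v-≤ (m≤n⇒m≤o+n (3 * ∣ b ∣ᵇ + 0) (s≤s (s≤s (s≤s z≤n))))
  (v-≤ᵃ z≤n (v-map ⊥-elim (λ ()) (v-goto (v-pop v-lose))))
pick-val false b [] q = v-≤ (m≤n⇒m≤o+n (3 * ∣ b ∣ᵇ + 0) (s≤s (s≤s (s≤s z≤n))))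
  (v-≤ᵃ z≤n (v-map ⊥-elim (λ ()) (v-goto (v-pop v-lose))))
pick-val p b (s ∷ X) {r} q {v} =
  v-map Any.fromSum Any.toSum
    (v-≤ (linear (con 2 ⊕ (con 1 ⊕ (3 ⊛ x₀ ⊕ (3 ⊛ x₁ ⊕ con 3 ⊕ 3 ⊛ x₂) ⊕ con 10))) (3 ⊛ x₀ ⊕ 3 ⊛ (con 2 ⊕ x₁ ⊕ x₂) ⊕ con 10) vars₃)
      (v-goto (v-pop-at {i = tm} (team-∷ s X) (choice p))))
  where
  vars₃ = ∣ b ∣ᵇ ∷ ∥ s ∥ ∷ ∥ X ∥ᵗ ∷ []
  N = 3 * ∣ b ∣ᵇ + (3 * ∥ s ∥ + 3 + 3 * ∥ X ∥ᵗ) + 10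
  σ₁ = S (encBin b ++ r) (names s ++ sRp ∷ team X) [] [] [] v
  mem : Val (3 * ∣ b ∣ᵇ + 3 * ∥ s ∥ + 7) 0 (goto (member tm)) σ₁ (b ∈ s)
  mem = member-val (λ ()) b s q refl refl refl
  Skipped : Bool → Sym → Set
  Skipped p x = pickK p (just x) ≡ goto (pick p)
  skips : ∀ p → Skipped p sVar → Skipped p sD1 → Skipped p sD2 → Skipped p sRp →
          Val N 1 (goto (pick p)) σ₁ (Any (Violates p b) X)
  skips p e₁ e₂ e₃ e₄ = v-≤ (≤-trans (≤-reflexive (cong (λ z → 2 * z + _) (trans (List.length-++ (names s)) (cong (_+ 1) (length-names s)))))
      (linear (2 ⊛ (x₁ ⊕ con 1) ⊕ (3 ⊛ x₀ ⊕ 3 ⊛ x₂ ⊕ con 10)) (3 ⊛ x₀ ⊕ (3 ⊛ x₁ ⊕ con 3 ⊕ 3 ⊛ x₂) ⊕ con 10) vars₃))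
    (v-skip (pick p) {i = tm} refl {w = names s ++ sRp ∷ []}
      (All.++⁺ (all-names e₁ e₂ e₃ s) (e₄ ∷ []))
      (sym (List.++-assoc (names s) (sRp ∷ []) (team X))) (pick-val p b X q))
  choice : ∀ p → Val (suc N) 1 (pickK p (just sLp)) σ₁ (Violates p b s ⊎ Any (Violates p b) X)
  choice true  = v-branch
    (v-≤ (linear (con 1 ⊕ (3 ⊛ x₀ ⊕ 3 ⊛ x₁ ⊕ con 7)) (3 ⊛ x₀ ⊕ (3 ⊛ x₁ ⊕ con 3 ⊕ 3 ⊛ x₂) ⊕ con 10) vars₃) (v-flip mem))
    (skips true refl refl refl refl)
  choice false = v-branch
    (v-≤ (linear (3 ⊛ x₀ ⊕ 3 ⊛ x₁ ⊕ con 7) (3 ⊛ x₀ ⊕ (3 ⊛ x₁ ⊕ con 3 ⊕ 3 ⊛ x₂) ⊕ con 10) vars₃) (v-≤ᵃ z≤n mem))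
    (skips false refl refl refl refl)

-- The team as it lies in the buffer: moving a word to another stack reverses it, blocks included,
-- so a block now begins with `sRp`, and the decision about it can be taken before its names are
-- read.
rteam : List Block → List Sym
rteam []      = []
rteam (s ∷ X) = block s ʳ++ rteam X

rteam-∷ : ∀ s X → rteam (s ∷ X) ≡ sRp ∷ reverse (names s) ++ sLp ∷ rteam X
rteam-∷ s X = trans (List.++-ʳ++ (names s) {sRp ∷ []}) (cong (sRp ∷_) (List.ʳ++-defn (names s)))

team-ʳ++ : ∀ X Y → team X ʳ++ rteam Y ≡ rteam (X ʳ++ Y)
team-ʳ++ []      Y = refl
team-ʳ++ (s ∷ X) Y = trans (List.++-ʳ++ (block s) {team X}) (team-ʳ++ X (s ∷ Y))

rteam-ʳ++ : ∀ Y Z → rteam Y ʳ++ team Z ≡ team (Y ʳ++ Z)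
rteam-ʳ++ []      Z = refl
rteam-ʳ++ (s ∷ Y) Z = trans (List.ʳ++-ʳ++ (block s) {rteam Y}) (rteam-ʳ++ Y (s ∷ Z))

length-rteam : ∀ X → length (rteam X) ≡ ∥ X ∥ᵗ
length-rteam []      = refl
length-rteam (s ∷ X) = trans (List.length-ʳ++ (block s)) (cong₂ _+_ (length-block s) (length-rteam X))

all-ʳ++ : ∀ {P : Sym → Set} {xs ys} → All P xs → All P ys → All P (xs ʳ++ ys)
all-ʳ++ []       q = q
all-ʳ++ (p ∷ ps) q = all-ʳ++ ps (p ∷ q)

all-rteam : ∀ {P : Sym → Set} → P sVar → P sD1 → P sD2 → P sLp → P sRp → ∀ X → All P (rteam X)
all-rteam r p q l e []      = []
all-rteam r p q l e (s ∷ X) = all-ʳ++ (l ∷ All.++⁺ (all-names r p q s) (e ∷ [])) (all-rteam r p q l e X)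

rnames : Block → List Sym
rnames s = reverse (names s)

all-rnames : ∀ {P : Sym → Set} → P sVar → P sD1 → P sD2 → ∀ s → All P (rnames s)
all-rnames r p q s = all-ʳ++ (all-names r p q s) []

length-rnames : ∀ s → length (rnames s) ≡ ∥ s ∥
length-rnames s = trans (List.length-reverse (names s)) (length-names s)

rnames-ʳ++ : ∀ s ys → rnames s ʳ++ ys ≡ names s ++ ys
rnames-ʳ++ s ys = List.ʳ++-ʳ++ (names s) {[]}

module _ (g : Grab) {f : List Sym} where

  done-val : ∀ Y Z {v} → Val n a (next g) (S f (team (Y ʳ++ Z)) [] [] [] v) V →
             Val (3 * ∥ Y ∥ᵗ + (2 + n)) a (goto (done g)) (S f (team Z) (rteam Y) [] [] v) V
  done-val {n = n} Y Z val rewrite sym (length-rteam Y) =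
    v-move (done g) {i = bf} refl (λ ()) {w = rteam Y} (all-rteam refl refl refl refl refl Y)
      (sym (List.++-identityʳ (rteam Y)))
      (v-goto (v-pop (v-store (cong (λ z → S f z [] [] [] _) (sym (rteam-ʳ++ Y Z))) val)))

  Copied : Sym → Set
  Copied x = copyK g (just x) ≡ push tm x (push (sel (slot g)) x (goto (copy g)))

  copy-val : ∀ {w} → All Copied w → ∀ {t b v} →
             Val n a (goto (done g)) (S f (sLp ∷ (w ʳ++ t)) b [] [] (v [ slot g ]≔ (w ʳ++ lookup v (slot g)))) V →
             Val (4 * length w + (3 + n)) a (goto (copy g)) (S f t (w ++ sLp ∷ b) [] [] v) V
  copy-val [] {t} {b} {v} val = v-goto (v-pop {i = bf} (v-push {i = tm}
    (v-store (cong (S f (sLp ∷ t) b [] []) ([]≔-lookup v (slot g))) val)))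
  copy-val {n = n} {w = x ∷ w} (p ∷ ps) {t} {b} {v} val =
    v-≤ (≤-reflexive (cong (_+ (3 + n)) (sym (*-suc 4 (length w)))))
      (v-goto (v-pop {i = bf} (v-code (sym p) (v-push {i = tm} (v-push {i = sel (slot g)}
        (copy-val ps (v-store (cong (S f _ b [] []) (sym same)) val)))))))
    where
    v₁ = v [ slot g ]≔ (x ∷ lookup v (slot g))
    same : v₁ [ slot g ]≔ (w ʳ++ lookup v₁ (slot g)) ≡ v [ slot g ]≔ (w ʳ++ (x ∷ lookup v (slot g)))
    same = trans ([]≔-idempotent v (slot g)) (cong (λ z → v [ slot g ]≔ (w ʳ++ z)) (lookup∘update (slot g) v _))

  -- `Y` is still in the buffer, `Z` is already back. A chosen block is copied on its way back and
  -- `done` returns what is left, so the full team is restored in its old order and the next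
  -- selection finds it intact.
  select-val : ∀ {P : Block → Set} Y Z {v} → lookup v (slot g) ≡ [] →
               (∀ {s} → s ∈ Y → Val n a (next g) (S f (team (Y ʳ++ Z)) [] [] [] (v [ slot g ]≔ names s)) (P s)) →
               Val (4 * ∥ Y ∥ᵗ + (5 + n)) a (goto (select g)) (S f (team Z) (rteam Y) [] [] v) (Any P Y)
  select-val {n = n} [] Z e h = v-≤ (s≤s (s≤s (s≤s z≤n))) (v-≤ᵃ z≤n (v-map ⊥-elim (λ ()) (v-goto (v-pop {i = bf} v-lose))))
  select-val {n = n} (s ∷ Y) Z {v} e h =
    v-map Any.fromSum Any.toSum
      (v-≤ (linear (con 4 ⊕ (4 ⊛ x₀ ⊕ 4 ⊛ x₁ ⊕ con 8 ⊕ x₂)) (4 ⊛ (con 2 ⊕ x₀ ⊕ x₁) ⊕ (con 5 ⊕ x₂)) vars₃)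
        (v-goto (v-pop-at {i = bf} (rteam-∷ s Y) (v-push {i = tm} (v-branch
          (v-≤ (≤-trans (≤-reflexive (cong (λ z → 4 * z + (3 + (3 * ∥ Y ∥ᵗ + (2 + n)))) (length-rnames s)))
                        (linear (4 ⊛ x₀ ⊕ (con 3 ⊕ (3 ⊛ x₁ ⊕ (con 2 ⊕ x₂)))) (4 ⊛ x₀ ⊕ 4 ⊛ x₁ ⊕ con 8 ⊕ x₂) vars₃))
            (copy-val (all-rnames refl refl refl s)
              (v-store (cong₂ (λ y z → S f y (rteam Y) [] [] (v [ slot g ]≔ z)) restored copied)
                (done-val Y (s ∷ Z) (h (here refl))))))
          (v-≤ (≤-trans (≤-reflexive (cong (λ z → 3 * z + (4 * ∥ Y ∥ᵗ + (5 + n))) len))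
                        (linear (3 ⊛ (x₀ ⊕ con 1) ⊕ (4 ⊛ x₁ ⊕ (con 5 ⊕ x₂))) (4 ⊛ x₀ ⊕ 4 ⊛ x₁ ⊕ con 8 ⊕ x₂) vars₃))
            (v-move (select g) {i = bf} refl (λ ()) {w = rnames s ++ sLp ∷ []}
              (All.++⁺ (all-rnames refl refl refl s) (refl ∷ []))
              (sym (List.++-assoc (rnames s) (sLp ∷ []) (rteam Y)))
              (v-store (cong (λ y → S f y (rteam Y) [] [] v)
                  (trans restored (sym (List.++-ʳ++ (rnames s) {sLp ∷ []}))))
                (select-val Y (s ∷ Z) e (h ∘ there))))))))))
    where
    vars₃ = ∥ s ∥ ∷ ∥ Y ∥ᵗ ∷ n ∷ []
    len : length (rnames s ++ sLp ∷ []) ≡ ∥ s ∥ + 1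
    len = trans (List.length-++ (rnames s)) (cong (_+ 1) (length-rnames s))
    restored : team (s ∷ Z) ≡ sLp ∷ (rnames s ʳ++ (sRp ∷ team Z))
    restored = trans (team-∷ s Z) (cong (sLp ∷_) (sym (rnames-ʳ++ s (sRp ∷ team Z))))
    copied : names s ≡ rnames s ʳ++ lookup v (slot g)
    copied = sym (trans (rnames-ʳ++ s _) (trans (cong (names s ++_) e) (List.++-identityʳ (names s))))

  grab-val : ∀ {P : Block → Set} X {v} → lookup v (slot g) ≡ [] →
             (∀ {s} → s ∈ X → Val n a (next g) (S f (team X) [] [] [] (v [ slot g ]≔ names s)) (P s)) →
             Val (7 * ∥ X ∥ᵗ + (8 + n)) a (goto (grab g)) (S f (team X) [] [] [] v) (Any P X)
  grab-val {n = n} X {v} e h =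
    v-map Any.reverse⁻ Any.reverse⁺
      (v-≤ bound
        (v-move (grab g) {i = tm} refl (λ ()) {w = team X} (all-team refl refl refl refl refl X)
          (sym (List.++-identityʳ (team X)))
          (v-goto (v-pop {i = tm} (v-≤ (n≤1+n _)
            (v-store (cong (λ z → S f [] z [] [] v) (sym (team-ʳ++ X [])))
              (select-val (reverse X) [] e
                (λ p → v-store (cong (λ z → S f (team z) [] [] [] _) (sym twice)) (h (Any.reverse⁻ p))))))))))
    where
    twice : reverse X ʳ++ [] ≡ X
    twice = List.reverse-involutive X
    size-ʳ++ : ∀ X Y → ∥ X ʳ++ Y ∥ᵗ ≡ ∥ X ∥ᵗ + ∥ Y ∥ᵗ
    size-ʳ++ []      Y = refl
    size-ʳ++ (s ∷ X) Y = trans (size-ʳ++ X (s ∷ Y))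
      (solve 3 (λ x s y → x :+ (s :+ y) := s :+ x :+ y) refl ∥ X ∥ᵗ (2 + ∥ s ∥) ∥ Y ∥ᵗ)
      where open +-*-Solver
    -- Three steps per symbol into the buffer and at most four back, since a copied symbol is pushed
    -- twice.
    bound : 3 * length (team X) + (2 + (1 + (4 * ∥ reverse X ∥ᵗ + (5 + n)))) ≤ 7 * ∥ X ∥ᵗ + (8 + n)
    bound rewrite length-team X | trans (size-ʳ++ X []) (+-identityʳ ∥ X ∥ᵗ) =
      linear (3 ⊛ x₀ ⊕ (con 2 ⊕ (con 1 ⊕ (4 ⊛ x₀ ⊕ (con 5 ⊕ x₁))))) (7 ⊛ x₀ ⊕ (con 8 ⊕ x₁)) (∥ X ∥ᵗ ∷ n ∷ [])

encList-++ : ∀ xs r → encList xs ++ r ≡ sLp ∷ encVars xs ++ sRp ∷ r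
encList-++ xs r = cong (sLp ∷_) (List.++-assoc (encVars xs) (sRp ∷ []) r)

differ-list : ∀ {i j N} → 3 * ∥ s ∥ + 7 ≤ N → 3 * ∥ t ∥ + 7 ≤ N → lookup v i ≡ names s → lookup v j ≡ names t →
              ∀ xs {r} → Val (3 * ∥ xs ∥ᵛ + (N + 10)) 3 (goto (differ (sel i) (sel j)))
                             (S (encList xs ++ r) m [] [] [] v) (Differ s t xs)
differ-list {s = s} {t} {v = v} {i = i} {j} {N} p q e e′ xs {r} =
  v-≤ (linear (con 2 ⊕ (3 ⊛ x₀ ⊕ (x₁ ⊕ con 8))) (3 ⊛ x₀ ⊕ (x₁ ⊕ con 10)) (∥ xs ∥ᵛ ∷ N ∷ []))
    (v-skip (differ (sel i) (sel j)) {i = fm} refl {w = sLp ∷ []} (refl ∷ []) refl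
      (differ-val (λ ()) (λ ()) p q xs refl refl
        (trans e (sym (List.++-identityʳ (names s)))) (trans e′ (sym (List.++-identityʳ (names t))))
        (List.++-assoc (encVars xs) (sRp ∷ []) r)))

skip-list : ∀ l {k c xs r} → prog l ≡ pop fm k → All (λ x → k (just x) ≡ goto l) (sLp ∷ sVar ∷ sD1 ∷ sD2 ∷ []) →
            k (just sRp) ≡ c → Val n a c (S r m [] [] [] v) V →
            Val (2 * ∥ xs ∥ᵛ + (4 + n)) a (goto l) (S (encList xs ++ r) m [] [] [] v) V
skip-list {n = n} l {xs = xs} {r} e (e₁ ∷ e₂ ∷ e₃ ∷ e₄ ∷ []) e₅ val =
  v-≤ (≤-trans (≤-reflexive (cong (λ z → 2 * suc z + (2 + n)) (length-encVars xs)))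
               (linear (2 ⊛ (con 1 ⊕ x₀) ⊕ (con 2 ⊕ x₁)) (2 ⊛ x₀ ⊕ (con 4 ⊕ x₁)) (∥ xs ∥ᵛ ∷ n ∷ [])))
    (v-skip l e {w = sLp ∷ encVars xs} (e₁ ∷ all-encVars e₂ e₃ e₄ xs) (encList-++ xs r)
      (v-goto (v-code (sym e) (v-pop {i = fm} (v-code (sym e₅) val)))))

skipOne-list : ∀ i j {ys r} → Val n a (goto (differ i j)) (S r m [] [] [] v) V →
               Val (2 * ∥ ys ∥ᵛ + (4 + n)) a (goto (skipOne i j)) (S (encList ys ++ r) m [] [] [] v) V
skipOne-list i j {ys} = skip-list (skipOne i j) {xs = ys} refl (refl ∷ refl ∷ refl ∷ refl ∷ []) refl

skipTwo-list : ∀ {ys r} → Val n a (goto (skipOne s₃ s₂)) (S r m [] [] [] v) V →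
               Val (2 * ∥ ys ∥ᵛ + (4 + n)) a (goto skipTwo) (S (encList ys ++ r) m [] [] [] v) V
skipTwo-list {ys = ys} = skip-list skipTwo {xs = ys} refl (refl ∷ refl ∷ refl ∷ refl ∷ []) refl

-- Independence and inclusion atoms

pattern none₃ = [] ∷ [] ∷ [] ∷ []

-- That the pair `s`, `t` violates the independence atom, in the form in which the game yields it,
-- with one negation per `flip`: they agree on `ps`, yet no member of `X` is a suitable `u`.
Dependence : (X : List Block) (ps qs rs : List ℕ) → Block → Block → Set
Dependence X ps qs rs s t =
  ¬ (Differ s t ps ⊎ Any (λ u → ¬ (Differ s u qs ⊎ (Differ s u ps ⊎ Differ u t rs))) X)

module _ (X : List Block) (ps qs rs : List ℕ) where

  private
    L : ℕ
    L = ∥ qs ∥ᵛ + ∥ ps ∥ᵛ + ∥ rs ∥ᵛ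

    ρ : Vec ℕ 4
    ρ = ∥ qs ∥ᵛ ∷ ∥ ps ∥ᵛ ∷ ∥ rs ∥ᵛ ∷ ∥ X ∥ᵗ ∷ []

    size≤ : s ∈ X → 3 * ∥ s ∥ + 7 ≤ 3 * ∥ X ∥ᵗ + 7
    size≤ p = +-monoˡ-≤ 7 (*-monoʳ-≤ 3 (∈-size p))

    bound : Lin 4
    bound = 5 ⊛ (x₀ ⊕ x₁ ⊕ x₂) ⊕ (3 ⊛ x₃ ⊕ con 25)

  indep-val : ∀ {r} → Val (24 * ∥ X ∥ᵗ + (5 * L + 60)) 5 (goto (grab indep₁))
                          (S (encList qs ++ (encList ps ++ (encList rs ++ r))) (team X) [] [] [] none₃)
                          (Any (λ s → Any (Dependence X ps qs rs s) X) X)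
  indep-val {r} =
    v-≤ (linear (7 ⊛ x₃ ⊕ (con 8 ⊕ (7 ⊛ x₃ ⊕ (con 8 ⊕ (con 2 ⊕ (7 ⊛ x₃ ⊕ (con 8 ⊕ (con 2 ⊕ (con 1 ⊕ bound)))))))))
                (24 ⊛ x₃ ⊕ (5 ⊛ (x₀ ⊕ x₁ ⊕ x₂) ⊕ con 60)) ρ)
      (grab-val indep₁ X refl λ p₁ →
       grab-val indep₂ X refl λ p₂ → v-flip (v-branch
         (v-≤ (linear (2 ⊛ x₀ ⊕ (con 4 ⊕ (3 ⊛ x₁ ⊕ (3 ⊛ x₃ ⊕ con 7 ⊕ con 10)))) (7 ⊛ x₃ ⊕ (con 8 ⊕ (con 2 ⊕ (con 1 ⊕ bound)))) ρ)
           (v-≤ᵃ (s≤s (s≤s (s≤s z≤n)))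
             (skipOne-list s₁ s₂ {qs} (differ-list (size≤ p₁) (size≤ p₂) refl refl ps))))
         (grab-val indep₃ X refl λ p₃ → v-flip (v-branch
           (v-≤ (linear (3 ⊛ x₀ ⊕ (3 ⊛ x₃ ⊕ con 7 ⊕ con 10)) (con 1 ⊕ bound) ρ)
             (differ-list (size≤ p₁) (size≤ p₃) refl refl qs))
           (v-branch
             (v-≤ (linear (2 ⊛ x₀ ⊕ (con 4 ⊕ (3 ⊛ x₁ ⊕ (3 ⊛ x₃ ⊕ con 7 ⊕ con 10)))) bound ρ)
               (skipOne-list s₁ s₃ {qs} (differ-list (size≤ p₁) (size≤ p₃) refl refl ps)))
             (v-≤ (linear (2 ⊛ x₀ ⊕ (con 4 ⊕ (2 ⊛ x₁ ⊕ (con 4 ⊕ (3 ⊛ x₂ ⊕ (3 ⊛ x₃ ⊕ con 7 ⊕ con 10)))))) bound ρ)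
               (skipTwo-list {ys = qs} (skipOne-list s₃ s₂ {ps}
                 (differ-list (size≤ p₃) (size≤ p₂) refl refl rs)))))))))

DifferAt : Block → Block → ∀ {k} → Vec ℕ k → Vec ℕ k → Set
DifferAt s t []       []       = ⊥
DifferAt s t (p ∷ ps) (q ∷ qs) = Xor (toBin p ∈ s) (toBin q ∈ t) ⊎ DifferAt s t ps qs

sizeᵛ : ∀ {k} → Vec ℕ k → ℕ
sizeᵛ qs = ∥ Vec.toList qs ∥ᵛ

size-++ : ∀ xs ys → ∥ xs ++ ys ∥ᵛ ≡ ∥ xs ∥ᵛ + ∥ ys ∥ᵛ
size-++ []       ys = refl
size-++ (x ∷ xs) ys = cong suc (trans (cong (∣ toBin x ∣ᵇ +_) (size-++ xs ys)) (sym (+-assoc ∣ toBin x ∣ᵇ _ _)))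

nth-val : ∀ qs q qs′ {r} → lookup v (suc (suc zero)) ≡ names t →
          Val (3 * ∥ qs ∥ᵛ + (3 + (3 * ∣ toBin q ∣ᵇ + 3 * ∥ t ∥ + 7))) 0 (goto nth)
              (S (encVars qs ++ encVars (q ∷ qs′) ++ sRp ∷ r) m [] (List.replicate (length qs) sVar) [] v) (toBin q ∈ t)
nth-val {v = v} {t = t} [] q qs′ {r} e =
  v-goto (v-pop {i = fm} (v-pop {i = ct}
    (member-val {i = s₃} (λ ()) (toBin q) t (stop-encVars qs′) refl
      (List.++-assoc (encBin (toBin q)) (encVars qs′) (sRp ∷ r)) (trans e (sym (List.++-identityʳ (names t)))))))
nth-val {v = v} {t = t} {m = m} (x ∷ qs) q qs′ {r} e =
  v-≤ (linear (con 3 ⊕ (2 ⊛ x₀ ⊕ (3 ⊛ x₁ ⊕ x₂))) (3 ⊛ (con 1 ⊕ (x₀ ⊕ x₁)) ⊕ x₂)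
         (∣ toBin x ∣ᵇ ∷ ∥ qs ∥ᵛ ∷ (3 + (3 * ∣ toBin q ∣ᵇ + 3 * ∥ t ∥ + 7)) ∷ []))
    (v-goto (v-pop-at {i = fm} (encVars-∷ x qs _) (v-pop {i = ct}
      (v-skip nth {i = fm} refl (all-encBin refl refl (toBin x)) refl (nth-val qs q qs′ e)))))

toSecond-val : ∀ {w qs q qs′ r} → All (λ x → toSecondK (just x) ≡ goto toSecond) w →
               lookup v (suc (suc zero)) ≡ names t →
               Val (2 * length w + (4 + (3 * ∥ qs ++ q ∷ qs′ ∥ᵛ + 3 * ∥ t ∥ + 10))) 0 (goto toSecond)
                   (S (w ++ sRp ∷ encList (qs ++ q ∷ qs′) ++ r) m [] (List.replicate (length qs) sVar) [] v) (toBin q ∈ t)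
toSecond-val {v = v} {t = t} {m = m} {w = w} {qs} {q} {qs′} {r} p e =
  v-≤ (+-monoʳ-≤ (2 * length w) (+-monoʳ-≤ 4 (bound qs)))
    (v-skip toSecond {i = fm} refl p refl (v-goto (v-pop {i = fm}
      (v-skip nth {i = fm} refl {w = sLp ∷ []} (refl ∷ []) refl
        (v-store (cong (λ z → S z m [] _ [] v) listed) (nth-val qs q qs′ e))))))
  where
  listed : encVars qs ++ encVars (q ∷ qs′) ++ sRp ∷ r ≡ (encVars (qs ++ q ∷ qs′) ++ sRp ∷ []) ++ r
  listed = trans (sym (List.++-assoc (encVars qs) (encVars (q ∷ qs′)) (sRp ∷ r)))
    (trans (cong (_++ sRp ∷ r) (sym (List.concatMap-++ encVar qs (q ∷ qs′))))
           (sym (List.++-assoc (encVars (qs ++ q ∷ qs′)) (sRp ∷ []) r)))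
  bound : ∀ qs → 3 * ∥ qs ∥ᵛ + (3 + (3 * ∣ toBin q ∣ᵇ + 3 * ∥ t ∥ + 7)) ≤ 3 * ∥ qs ++ q ∷ qs′ ∥ᵛ + 3 * ∥ t ∥ + 10
  bound qs rewrite size-++ qs (q ∷ qs′) =
    linear (3 ⊛ x₃ ⊕ (con 3 ⊕ (3 ⊛ x₀ ⊕ 3 ⊛ x₁ ⊕ con 7))) (3 ⊛ (x₃ ⊕ (con 1 ⊕ (x₀ ⊕ x₂))) ⊕ 3 ⊛ x₁ ⊕ con 10)
      (∣ toBin q ∣ᵇ ∷ ∥ t ∥ ∷ ∥ qs′ ∥ᵛ ∷ ∥ qs ∥ᵛ ∷ [])

-- `qs` is the part of the second list whose positions have been passed in the first; the game knows
-- only its length, in unary on `ct`. As `ps` and `qs′` have equal length, a position chosen in the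
-- first list exists in the second.
index-val : ∀ {k} (ps : Vec ℕ k) qs (qs′ : Vec ℕ k) {r n} →
            lookup v zero ≡ names s → lookup v (suc (suc zero)) ≡ names t → n ≡ length qs →
            let Q = ∥ qs ++ Vec.toList qs′ ∥ᵛ in
            Val (4 * ∥ Vec.toList ps ∥ᵛ + (3 * Q + 3 * ∥ s ∥ + 3 * ∥ t ∥ + 20)) 3 (goto index)
                (S (encVars (Vec.toList ps) ++ sRp ∷ encList (qs ++ Vec.toList qs′) ++ r) m [] (List.replicate n sVar) [] v)
                (DifferAt s t ps qs′)
index-val [] qs [] e e′ en =
  v-≤ (≤-trans (s≤s (s≤s (s≤s z≤n))) (m≤n+m 20 _)) (v-≤ᵃ z≤n (v-map ⊥-elim (λ ()) (v-goto (v-pop {i = fm} v-lose))))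
index-val {v = v} {s = s} {t = t} {m = m} (p ∷ ps) qs (q ∷ qs′) {r} e e′ refl =
  v-≤ (linear (con 3 ⊕ (4 ⊛ x₀ ⊕ 4 ⊛ x₁ ⊕ con 1 ⊕ (3 ⊛ x₂ ⊕ 3 ⊛ x₃ ⊕ 3 ⊛ x₄ ⊕ con 20)))
              (4 ⊛ (con 1 ⊕ (x₀ ⊕ x₁)) ⊕ (3 ⊛ x₂ ⊕ 3 ⊛ x₃ ⊕ 3 ⊛ x₄ ⊕ con 20)) ρ)
    (v-goto (v-pop-at {i = fm} (encVars-∷ p (Vec.toList ps) _) (v-branch
      (v-≤ (linear (con 5 ⊕ (3 ⊛ x₀ ⊕ 2 ⊛ x₁ ⊕ (3 ⊛ x₂ ⊕ 3 ⊛ x₃ ⊕ 3 ⊛ x₄ ⊕ con 15)))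
                   (4 ⊛ x₀ ⊕ 4 ⊛ x₁ ⊕ con 1 ⊕ (3 ⊛ x₂ ⊕ 3 ⊛ x₃ ⊕ 3 ⊛ x₄ ⊕ con 20)) ρ)
        (xor-val
          (v-≤ (linear (3 ⊛ x₀ ⊕ 3 ⊛ x₃ ⊕ con 7) (3 ⊛ x₀ ⊕ 2 ⊛ x₁ ⊕ (3 ⊛ x₂ ⊕ 3 ⊛ x₃ ⊕ 3 ⊛ x₄ ⊕ con 15)) ρ)
            (member-val {i = s₁} (λ ()) (toBin p) s (stop-encVars (Vec.toList ps)) refl refl (trans e (sym (List.++-identityʳ (names s))))))
          (v-≤ (≤-trans (≤-reflexive (cong (λ z → 2 * z + _) len))
                 (linear (2 ⊛ (x₀ ⊕ x₁) ⊕ (con 4 ⊕ (3 ⊛ x₂ ⊕ 3 ⊛ x₄ ⊕ con 10))) (3 ⊛ x₀ ⊕ 2 ⊛ x₁ ⊕ (3 ⊛ x₂ ⊕ 3 ⊛ x₃ ⊕ 3 ⊛ x₄ ⊕ con 15)) ρ))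
            (v-store (cong (λ z → S z m [] _ [] v) (List.++-assoc (encBin (toBin p)) (encVars (Vec.toList ps)) _))
              (toSecond-val {w = encBin (toBin p) ++ encVars (Vec.toList ps)} {qs = qs}
                (All.++⁺ (all-encBin refl refl (toBin p)) (all-encVars refl refl refl (Vec.toList ps))) e′)))))
      (v-≤ (linear (con 1 ⊕ (2 ⊛ x₀ ⊕ (4 ⊛ x₁ ⊕ (3 ⊛ x₂ ⊕ 3 ⊛ x₃ ⊕ 3 ⊛ x₄ ⊕ con 20))))
                   (4 ⊛ x₀ ⊕ 4 ⊛ x₁ ⊕ con 1 ⊕ (3 ⊛ x₂ ⊕ 3 ⊛ x₃ ⊕ 3 ⊛ x₄ ⊕ con 20)) ρ)
        (v-push {i = ct} (v-skip index {i = fm} refl (all-encBin refl refl (toBin p)) refl later))))))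
  where
  Q = ∥ qs ++ q ∷ Vec.toList qs′ ∥ᵛ
  ρ = ∣ toBin p ∣ᵇ ∷ ∥ Vec.toList ps ∥ᵛ ∷ Q ∷ ∥ s ∥ ∷ ∥ t ∥ ∷ []
  len : length (encBin (toBin p) ++ encVars (Vec.toList ps)) ≡ ∣ toBin p ∣ᵇ + ∥ Vec.toList ps ∥ᵛ
  len = trans (List.length-++ (encBin (toBin p))) (cong (∣ toBin p ∣ᵇ +_) (length-encVars (Vec.toList ps)))
  assoc : (qs ++ q ∷ []) ++ Vec.toList qs′ ≡ qs ++ q ∷ Vec.toList qs′
  assoc = List.++-assoc qs (q ∷ []) (Vec.toList qs′)
  later : Val (4 * ∥ Vec.toList ps ∥ᵛ + (3 * Q + 3 * ∥ s ∥ + 3 * ∥ t ∥ + 20)) 3 (goto index)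
    (S (encVars (Vec.toList ps) ++ sRp ∷ encList (qs ++ q ∷ Vec.toList qs′) ++ r) m [] (sVar ∷ List.replicate (length qs) sVar) [] v)
    (DifferAt s t ps qs′)
  later = subst (λ z → Val (4 * ∥ Vec.toList ps ∥ᵛ + (3 * ∥ z ∥ᵛ + 3 * ∥ s ∥ + 3 * ∥ t ∥ + 20)) 3 (goto index)
                         (S (encVars (Vec.toList ps) ++ sRp ∷ encList z ++ r) m [] _ [] v) (DifferAt s t ps qs′))
                assoc (index-val ps (qs ++ q ∷ []) qs′ {n = suc (length qs)} e e′
                        (sym (trans (List.length-++ qs) (+-comm (length qs) 1))))

incl-val : ∀ X {k} (ps qs : Vec ℕ k) {r} →
           Val (20 * ∥ X ∥ᵗ + (4 * sizeᵛ ps + 3 * sizeᵛ qs + 50)) 5 (goto (grab incl₁))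
               (S (encList (Vec.toList ps) ++ (encList (Vec.toList qs) ++ r)) (team X) [] [] [] none₃)
               (Any (λ s → ¬ Any (λ t → ¬ DifferAt s t ps qs) X) X)
incl-val X ps qs {r} =
  v-≤ (linear (7 ⊛ x₀ ⊕ (con 8 ⊕ (con 1 ⊕ (7 ⊛ x₀ ⊕ (con 8 ⊕ (con 1 ⊕ (con 2 ⊕ (4 ⊛ x₁ ⊕ (3 ⊛ x₂ ⊕ 3 ⊛ x₀ ⊕ 3 ⊛ x₀ ⊕ con 20)))))))))
              (20 ⊛ x₀ ⊕ (4 ⊛ x₁ ⊕ 3 ⊛ x₂ ⊕ con 50)) (∥ X ∥ᵗ ∷ sizeᵛ ps ∷ sizeᵛ qs ∷ []))
    (grab-val incl₁ X refl λ p₁ → v-flip (grab-val incl₂ X refl λ {t} p₂ → v-flip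
      (v-skip index {i = fm} refl {w = sLp ∷ []} (refl ∷ []) refl
        (v-≤ (+-monoʳ-≤ (4 * sizeᵛ ps) (+-monoˡ-≤ 20 (+-mono-≤ (+-monoʳ-≤ (3 * sizeᵛ qs) (*-monoʳ-≤ 3 (∈-size p₁))) (*-monoʳ-≤ 3 (∈-size p₂)))))
          (v-store (cong (λ z → S z (team X) [] [] [] _) (sym (List.++-assoc (encVars (Vec.toList ps)) (sRp ∷ []) (encList (Vec.toList qs) ++ r))))
            (index-val ps [] qs {n = 0} refl refl refl))))))

-- Scan k w: the scan moves w to gm, provided that the counter contains k on top.
record Scan (k w : List Sym) : Set₁ where
  constructor scans
  field
    run : ∀ {n a V c g r t v} → Val n a (goto scan) (S r t [] (k ++ c) (w ʳ++ g) v) V →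
          Val (5 * length w + n) a (goto scan) (S (w ++ r) t [] (k ++ c) g v) V

open Scan

scan-lift : ∀ {k w} → Scan [] w → Scan k w
scan-lift p = scans (run p)

scan-++ : ∀ {k} w w′ → Scan k w → Scan k w′ → Scan k (w ++ w′)
scan-++ w w′ p q = scans λ {n} {c = c} {g} {r} {t} {v} val →
  v-≤ (≤-reflexive (trans (sym (+-assoc (5 * length w) _ n))
         (cong (_+ n) (trans (sym (*-distribˡ-+ 5 (length w) (length w′))) (cong (5 *_) (sym (List.length-++ w)))))))
    (v-store (cong (λ z → S z t [] _ g v) (sym (List.++-assoc w w′ r)))
      (run p (run q (v-store (cong (λ z → S r t [] _ z v) (List.++-ʳ++ w {w′})) val))))

scan-plain : ∀ {w} → All (λ x → scanK (just x) ≡ push gm x (goto scan)) w → Scan [] w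
scan-plain {w} p = scans λ {n} val →
  v-≤ (linear (3 ⊛ x₀ ⊕ x₁) (5 ⊛ x₀ ⊕ x₁) (length w ∷ n ∷ []))
    (v-move scan {i = fm} refl (λ ()) p refl val)

-- A connective is passed only while a parenthesis is open; with an empty counter the scan would
-- stop at it.
scan-and : Scan (sLp ∷ []) (sAnd ∷ [])
scan-and = scans λ val → v-goto (v-pop {i = fm} (v-pop {i = ct} (v-push {i = ct} (v-push {i = gm} val))))

scan-or : Scan (sLp ∷ []) (sOr ∷ [])
scan-or = scans λ val → v-goto (v-pop {i = fm} (v-pop {i = ct} (v-push {i = ct} (v-push {i = gm} val))))

scan-paren : ∀ w → Scan (sLp ∷ []) w → Scan [] (sLp ∷ w ++ sRp ∷ [])
scan-paren w p = scans λ {n} {c = c} {g} {r} {t} {v} val →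
  v-≤ (≤-trans (linear (con 4 ⊕ (5 ⊛ x₀ ⊕ (con 4 ⊕ x₁))) (5 ⊛ (con 1 ⊕ (x₀ ⊕ con 1)) ⊕ x₁) (length w ∷ n ∷ []))
               (≤-reflexive (cong (λ z → 5 * suc z + n) (sym (List.length-++ w)))))
    (v-goto (v-pop {i = fm} (v-push {i = ct} (v-push {i = gm}
      (v-store (cong (λ z → S z t [] (sLp ∷ c) (sLp ∷ g) v) (sym (List.++-assoc w (sRp ∷ []) r)))
        (run p (v-goto (v-pop {i = fm} (v-pop {i = ct} (v-push {i = gm}
          (v-store (cong (λ z → S r t [] c z v) (List.++-ʳ++ w {sRp ∷ []})) val)))))))))))

scan-list : ∀ xs → Scan [] (encList xs)
scan-list xs = scan-paren (encVars xs) (scan-lift (scan-plain (all-encVars refl refl refl xs)))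

scan-encode : ∀ φ → Scan [] (encode φ)
scan-encode (atom p) = scan-plain (refl ∷ all-encBin refl refl (toBin p))
scan-encode (natom p) = scan-plain (refl ∷ refl ∷ all-encBin refl refl (toBin p))
scan-encode (φ ∧ᶠ ψ) = subst (λ z → Scan [] (sLp ∷ z)) (List.++-assoc (encode φ) (sAnd ∷ encode ψ) (sRp ∷ []))
  (scan-paren (encode φ ++ sAnd ∷ encode ψ)
    (scan-++ (encode φ) (sAnd ∷ encode ψ) (scan-lift (scan-encode φ))
      (scan-++ (sAnd ∷ []) (encode ψ) scan-and (scan-lift (scan-encode ψ)))))
scan-encode (φ ∨ᶠ ψ) = subst (λ z → Scan [] (sLp ∷ z)) (List.++-assoc (encode φ) (sOr ∷ encode ψ) (sRp ∷ []))
  (scan-paren (encode φ ++ sOr ∷ encode ψ)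
    (scan-++ (encode φ) (sOr ∷ encode ψ) (scan-lift (scan-encode φ))
      (scan-++ (sOr ∷ []) (encode ψ) scan-or (scan-lift (scan-encode ψ)))))
scan-encode (indep ps qs rs) =
  scan-++ (sIndep ∷ []) _ (scan-plain (refl ∷ [])) (scan-++ (encList qs) _ (scan-list qs)
    (scan-++ (encList ps) _ (scan-list ps) (scan-list rs)))
scan-encode (incl ps qs) =
  scan-++ (sIncl ∷ []) _ (scan-plain (refl ∷ [])) (scan-++ (encList (Vec.toList ps)) _ (scan-list (Vec.toList ps)) (scan-list (Vec.toList qs)))
scan-encode (∼ φ) = scan-++ (sTilde ∷ []) (encode φ) (scan-plain (refl ∷ [])) (scan-encode φ)

-- Conjunction and disjunction

-- The left operand returns with `sAnd` behind it, for a disjunction too: the symbol merely has to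
-- end a last name, and the value of the operand does not depend on what lies below it.
left-val : ∀ w → Val n a (goto eval) (S (w ++ sAnd ∷ r) m [] [] [] v) V →
           Val (3 * length w + (4 + n)) (suc a) takeLeft (S r m [] [] (reverse w) v) (¬ V)
left-val {n = n} {r = r} {m = m} {v = v} w val =
  v-≤ (≤-trans (≤-reflexive (cong (λ z → 1 + (3 * z + (3 + n))) (List.length-reverse w)))
        (linear (con 1 ⊕ (3 ⊛ x₀ ⊕ (con 3 ⊕ x₁))) (3 ⊛ x₀ ⊕ (con 4 ⊕ x₁)) (length w ∷ n ∷ [])))
    (v-push {i = fm} (v-move unload {i = gm} refl (λ ()) {w = reverse w} (All.universal (λ _ → refl) _)
      (sym (List.++-identityʳ (reverse w)))
      (v-goto (v-pop {i = gm} (v-flip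
        (v-store (cong (λ z → S z m [] [] [] v) (sym (List.ʳ++-ʳ++ w {[]}))) val))))))

right-val : ∀ w → Val n a (goto eval) (S r m [] [] [] v) V →
            Val (3 * length w + (4 + n)) (suc a) takeRight (S r m [] [] (reverse w) v) (¬ V)
right-val {n = n} w val =
  v-≤ (≤-trans (≤-reflexive (cong (λ z → 2 * z + (3 + n)) (List.length-reverse w)))
        (linear (2 ⊛ x₀ ⊕ (con 3 ⊕ x₁)) (3 ⊛ x₀ ⊕ (con 4 ⊕ x₁)) (length w ∷ n ∷ [])))
    (v-skip clear {i = gm} refl {w = reverse w} (All.universal (λ _ → refl) _)
      (sym (List.++-identityʳ (reverse w))) (v-goto (v-pop {i = gm} (v-flip val))))

binary-++ : ∀ φ ψ x r → (encode φ ++ x ∷ encode ψ ++ sRp ∷ []) ++ r ≡ encode φ ++ x ∷ encode ψ ++ sRp ∷ r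
binary-++ φ ψ x r = trans (List.++-assoc (encode φ) (x ∷ encode ψ ++ sRp ∷ []) r)
  (cong (λ z → encode φ ++ x ∷ z) (List.++-assoc (encode ψ) (sRp ∷ []) r))

and-val : ∀ φ ψ → Val n a (goto eval) (S (encode φ ++ sAnd ∷ encode ψ ++ sRp ∷ r) m [] [] [] v) V →
          Val n a (goto eval) (S (encode ψ ++ sRp ∷ r) m [] [] [] v) W →
          Val (8 * length (encode φ) + (12 + n)) (2 + a) (goto eval) (S (encode (φ ∧ᶠ ψ) ++ r) m [] [] [] v) (V × W)
and-val {n = n} {r = r} {m = m} {v = v} φ ψ x y =
  v-map (not-or (decide x) (decide y)) or-not
    (v-≤ (linear (con 2 ⊕ (5 ⊛ x₀ ⊕ (con 6 ⊕ (3 ⊛ x₀ ⊕ (con 4 ⊕ x₁))))) (8 ⊛ x₀ ⊕ (con 12 ⊕ x₁)) (length (encode φ) ∷ n ∷ []))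
      (v-goto (v-pop {i = fm} (v-store (cong (λ z → S z m [] [] [] v) (sym (binary-++ φ ψ sAnd r)))
        (run (scan-encode φ) (v-goto (v-pop {i = fm} (v-pop {i = ct} (v-flip (v-goto (v-branch
          (left-val (encode φ) x) (right-val (encode φ) y))))))))))))

data Tag : Set where
  inBoth inLeft inRight : Tag

tagSym : Tag → Sym
tagSym inBoth  = sRp
tagSym inLeft  = sAnd
tagSym inRight = sOr

Tagged : Set
Tagged = List (Tag × Block)

blocks : Tagged → List Block
blocks = map proj₂

tagged : Tagged → List Sym
tagged []            = []
tagged ((t , s) ∷ P) = tagSym t ∷ rnames s ++ sLp ∷ tagged P

-- The value of split, where P has already been tagged and Q is the value of the final position.
Split : (Tagged → Set) → List Block → Tagged → Set
Split Q []      P = Q P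
Split Q (s ∷ X) P =
  Split Q X ((inBoth , s) ∷ P) ⊎ (Split Q X ((inLeft , s) ∷ P) ⊎ Split Q X ((inRight , s) ∷ P))

-- Tagging preserves the total size `M` of team and buffer, so the exponentially many outcomes share
-- one time bound for the rest of the play.
split-val : ∀ {Q : Tagged → Set} M →
            (∀ P → ∥ blocks P ∥ᵗ ≡ M → Val n a (splitK nothing) (S f [] (tagged P) [] g v) (Q P)) →
            ∀ X P → ∥ X ∥ᵗ + ∥ blocks P ∥ᵗ ≡ M →
            Val (4 * ∥ X ∥ᵗ + (2 + n)) a (goto split) (S f (team X) (tagged P) [] g v) (Split Q X P)
split-val M h [] P e = v-goto (v-pop {i = tm} (h P e))
split-val {n = n} {a = a} {f = f} {g = g} {v = v} {Q} M h (s ∷ X) P e =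
  v-≤ (≤-trans (≤-reflexive (cong (λ z → 3 * suc z + (2 + N)) (length-names s)))
               (linear (3 ⊛ (con 1 ⊕ x₀) ⊕ (con 2 ⊕ (con 3 ⊕ (4 ⊛ x₁ ⊕ (con 2 ⊕ x₂))))) (4 ⊛ (con 2 ⊕ x₀ ⊕ x₁) ⊕ (con 2 ⊕ x₂))
                 (∥ s ∥ ∷ ∥ X ∥ᵗ ∷ n ∷ [])))
    (v-move split {i = tm} refl (λ ()) {w = sLp ∷ names s} (refl ∷ all-names refl refl refl s) (team-∷ s X)
      (v-goto (v-pop {i = tm} (v-branch
        (v-≤ (n≤1+n _) (v-push {i = bf} (rest inBoth)))
        (v-branch (v-push {i = bf} (rest inLeft)) (v-push {i = bf} (rest inRight)))))))
  where
  N = 3 + (4 * ∥ X ∥ᵗ + (2 + n))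
  rest : ∀ t → Val (4 * ∥ X ∥ᵗ + (2 + n)) a (goto split)
                   (S f (team X) (tagSym t ∷ (names s ʳ++ (sLp ∷ tagged P))) [] g v) (Split Q X ((t , s) ∷ P))
  rest t = v-store (cong (λ z → S f (team X) (tagSym t ∷ z) [] g v) (sym (List.ʳ++-defn (names s))))
    (split-val M h X ((t , s) ∷ P) (trans (shift ∥ X ∥ᵗ (2 + ∥ s ∥) ∥ blocks P ∥ᵗ) e))
    where
    shift : ∀ x y z → x + (y + z) ≡ y + x + z
    shift x y z = trans (sym (+-assoc x y z)) (cong (_+ z) (+-comm x y))

kept : Bool → Tag → Bool
kept true  inRight = false
kept false inLeft  = false
kept _     _       = true

part : Bool → Tagged → List Block → List Block
part b []            X = X
part b ((t , s) ∷ P) X = part b P (if kept b t then s ∷ X else X)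

take : Bool → Prog
take true  = takeLeft
take false = takeRight

keep-val : ∀ b P X → Val n a (take b) (S f (team (part b P X)) [] [] g v) V →
           Val (4 * ∥ blocks P ∥ᵗ + (2 + n)) a (goto (keep b)) (S f (team X) (tagged P) [] g v) V
keep-val true  [] X val = v-goto (v-pop {i = bf} val)
keep-val false [] X val = v-goto (v-pop {i = bf} val)
keep-val {n = n} {a = a} {f = f} {g = g} {v = v} {V = V} b ((t , s) ∷ P) X val = v-≤ (linear
    (con 3 ⊕ (3 ⊛ x₀ ⊕ con 3 ⊕ (4 ⊛ x₁ ⊕ (con 2 ⊕ x₂)))) (4 ⊛ (con 2 ⊕ x₀ ⊕ x₁) ⊕ (con 2 ⊕ x₂)) ρ)
  (v-goto (step b t val))
  where
  ρ = ∥ s ∥ ∷ ∥ blocks P ∥ᵗ ∷ n ∷ []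
  N = 4 * ∥ blocks P ∥ᵗ + (2 + n)
  restored : sLp ∷ (rnames s ʳ++ (sRp ∷ team X)) ≡ team (s ∷ X)
  restored = sym (trans (team-∷ s X) (cong (sLp ∷_) (sym (rnames-ʳ++ s (sRp ∷ team X)))))
  keeping : ∀ b → Val n a (take b) (S f (team (part b P (s ∷ X))) [] [] g v) V →
            Val (3 * ∥ s ∥ + 3 + N) a (goto (keep b)) (S f (sRp ∷ team X) (rnames s ++ sLp ∷ tagged P) [] g v) V
  keeping b val = v-≤ (≤-trans (≤-reflexive (cong (λ z → 3 * z + N) (trans (List.length-++ (rnames s)) (cong (_+ 1) (length-rnames s)))))
                               (linear (3 ⊛ (x₀ ⊕ con 1) ⊕ x₁) (3 ⊛ x₀ ⊕ con 3 ⊕ x₁) (∥ s ∥ ∷ N ∷ [])))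
    (v-move (keep b) {i = bf} refl (λ ()) {w = rnames s ++ sLp ∷ []}
      (All.++⁺ (all-rnames refl refl refl s) (refl ∷ [])) (sym (List.++-assoc (rnames s) (sLp ∷ []) (tagged P)))
      (v-store (cong (λ z → S f z (tagged P) [] g v) (sym (trans (List.++-ʳ++ (rnames s) {sLp ∷ []}) restored)))
        (keep-val b P (s ∷ X) val)))
  dropping : ∀ b → Val n a (take b) (S f (team (part b P X)) [] [] g v) V →
             Val (3 * ∥ s ∥ + 3 + N) a (goto (discard b)) (S f (team X) (rnames s ++ sLp ∷ tagged P) [] g v) V
  dropping b val = v-≤ (≤-trans (≤-reflexive (cong (λ z → 2 * z + (2 + N)) (length-rnames s)))
                                (linear (2 ⊛ x₀ ⊕ (con 2 ⊕ x₁)) (3 ⊛ x₀ ⊕ con 3 ⊕ x₁) (∥ s ∥ ∷ N ∷ [])))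
    (v-skip (discard b) {i = bf} refl (all-rnames refl refl refl s) refl
      (v-goto (v-pop {i = bf} (keep-val b P X val))))
  step : ∀ b t → Val n a (take b) (S f (team (part b P (if kept b t then s ∷ X else X))) [] [] g v) V →
         Val (2 + (3 * ∥ s ∥ + 3 + N)) a (prog (keep b)) (S f (team X) (tagged ((t , s) ∷ P)) [] g v) V
  step true  inBoth  val = v-pop {i = bf} (v-push {i = tm} (keeping true val))
  step false inBoth  val = v-pop {i = bf} (v-push {i = tm} (keeping false val))
  step true  inLeft  val = v-pop {i = bf} (v-push {i = tm} (keeping true val))
  step false inLeft  val = v-pop {i = bf} (v-≤ (n≤1+n _) (dropping false val))
  step true  inRight val = v-pop {i = bf} (v-≤ (n≤1+n _) (dropping true val))
  step false inRight val = v-pop {i = bf} (v-push {i = tm} (keeping false val))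

Halves : (Vˡ Vʳ : List Block → Set) → Tagged → Set
Halves Vˡ Vʳ P = Vˡ (part true P []) × Vʳ (part false P [])

size-part : ∀ b P X → ∥ part b P X ∥ᵗ ≤ ∥ blocks P ∥ᵗ + ∥ X ∥ᵗ
size-part b []            X = ≤-refl
size-part b ((t , s) ∷ P) X with kept b t
... | true  = ≤-trans (size-part b P (s ∷ X))
  (linear (x₀ ⊕ (con 2 ⊕ x₁ ⊕ x₂)) (con 2 ⊕ x₁ ⊕ x₀ ⊕ x₂) (∥ blocks P ∥ᵗ ∷ ∥ s ∥ ∷ ∥ X ∥ᵗ ∷ []))
... | false = ≤-trans (size-part b P X) (+-monoˡ-≤ ∥ X ∥ᵗ (m≤n+m ∥ blocks P ∥ᵗ (2 + ∥ s ∥)))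

or-val : ∀ φ ψ {Vˡ Vʳ : List Block → Set} {r} X →
         (∀ Y → ∥ Y ∥ᵗ ≤ ∥ X ∥ᵗ → Val n a (goto eval) (S (encode φ ++ sAnd ∷ encode ψ ++ sRp ∷ r) (team Y) [] [] [] v) (Vˡ Y)) →
         (∀ Y → ∥ Y ∥ᵗ ≤ ∥ X ∥ᵗ → Val n a (goto eval) (S (encode ψ ++ sRp ∷ r) (team Y) [] [] [] v) (Vʳ Y)) →
         Val (8 * length (encode φ) + (8 * ∥ X ∥ᵗ + (18 + n))) (2 + a) (goto eval)
             (S (encode (φ ∨ᶠ ψ) ++ r) (team X) [] [] [] v) (Split (Halves Vˡ Vʳ) X [])
or-val {n = n} {a = a} {v = v} φ ψ {Vˡ} {Vʳ} {r} X x y =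
  v-≤ (linear (con 2 ⊕ (5 ⊛ x₀ ⊕ (con 3 ⊕ (4 ⊛ x₁ ⊕ (con 2 ⊕ (con 3 ⊕ (4 ⊛ x₁ ⊕ (con 2 ⊕ (3 ⊛ x₀ ⊕ (con 4 ⊕ x₂)))))))))) (8 ⊛ x₀ ⊕ (8 ⊛ x₁ ⊕ (con 18 ⊕ x₂)))
         (length (encode φ) ∷ ∥ X ∥ᵗ ∷ n ∷ []))
    (v-goto (v-pop {i = fm} (v-store (cong (λ z → S z (team X) [] [] [] v) (sym (binary-++ φ ψ sOr r)))
      (run (scan-encode φ) (v-goto (v-pop {i = fm} (v-pop {i = ct}
        (split-val ∥ X ∥ᵗ final X [] (+-identityʳ ∥ X ∥ᵗ)))))))))
  where
  N = 3 * length (encode φ) + (4 + n)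
  final : ∀ P → ∥ blocks P ∥ᵗ ≡ ∥ X ∥ᵗ →
          Val (3 + (4 * ∥ X ∥ᵗ + (2 + N))) (2 + a) (splitK nothing)
              (S (encode ψ ++ sRp ∷ r) [] (tagged P) [] (reverse (encode φ)) v) (Halves Vˡ Vʳ P)
  final P e = v-map (not-or (decide xˡ) (decide yʳ)) or-not
    (v-≤ (≤-trans (≤-reflexive (cong (λ z → 2 + (4 * z + (2 + N))) e)) (n≤1+n _))
      (v-flip (v-branch (keep-val true P [] (left-val (encode φ) xˡ))
                        (keep-val false P [] (right-val (encode φ) yʳ)))))
    where
    small : ∀ b → ∥ part b P [] ∥ᵗ ≤ ∥ X ∥ᵗ
    small b = ≤-trans (size-part b P []) (≤-reflexive (trans (+-identityʳ _) e))
    xˡ = x (part true P []) (small true)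
    yʳ = y (part false P []) (small false)

-- Team semantics

≐-refl : ∀ xs → α [ xs ]≐ α [ xs ]
≐-refl []       = tt
≐-refl (x ∷ xs) = refl , ≐-refl xs

≐-sym : ∀ xs ys → α [ xs ]≐ β [ ys ] → β [ ys ]≐ α [ xs ]
≐-sym []       []       _       = tt
≐-sym (x ∷ xs) (y ∷ ys) (e , p) = sym e , ≐-sym xs ys p

≐-trans : ∀ xs ys zs → α [ xs ]≐ β [ ys ] → β [ ys ]≐ γ [ zs ] → α [ xs ]≐ γ [ zs ]
≐-trans []       []       []       _       _        = tt
≐-trans (x ∷ xs) (y ∷ ys) (z ∷ zs) (e , p) (e′ , q) = trans e e′ , ≐-trans xs ys zs p q

≐? : ∀ s xs t ys → Dec (s [ xs ]≐ t [ ys ])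
≐? s []       t []       = yes tt
≐? s []       t (_ ∷ _)  = no λ ()
≐? s (_ ∷ _)  t []       = no λ ()
≐? s (x ∷ xs) t (y ∷ ys) = (s x Bool.≟ t y) ×-dec ≐? s xs t ys

≐-at : ∀ {x} xs → x ∈ xs → α [ xs ]≐ β [ xs ] → α x ≡ β x
≐-at (_ ∷ xs) (here refl) (e , _) = e
≐-at (_ ∷ xs) (there i)   (_ , p) = ≐-at xs i p

≐-pointwise : ∀ xs → (∀ {x} → x ∈ xs → α x ≡ β x) → α [ xs ]≐ β [ xs ]
≐-pointwise []       h = tt
≐-pointwise (x ∷ xs) h = h (here refl) , ≐-pointwise xs (h ∘ there)

_⊑_ : List ℕ → List ℕ → Set
xs ⊑ ys = ∀ {x} → x ∈ xs → x ∈ ys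

≐-⊑ : ∀ {xs ys} → xs ⊑ ys → α [ ys ]≐ β [ ys ] → α [ xs ]≐ β [ xs ]
≐-⊑ {xs = xs} {ys} i p = ≐-pointwise xs (λ x∈ → ≐-at ys (i x∈) p)

∈[]? : ∀ s D (X : Team) → Dec (s ∈[ D ] X)
∈[]? s D X = Any.any? (λ t → ≐? s D t D) X

∈⇒∈[] : ∀ {D} {X : Team} → α ∈ X → α ∈[ D ] X
∈⇒∈[] {D = D} = Any.map λ { refl → ≐-refl D }

⊆-lookup : ∀ {D} {X Y : Team} → Y ⊆[ D ] X → α ∈ Y → ∃[ β ] β ∈ X × α [ D ]≐ β [ D ]
⊆-lookup p i = find (All.lookup p i)

-- Locality and invariance: φ depends only on the values on E ⊇ vars φ.
local : ∀ φ {E D D′ X X′} → vars φ ⊑ E → E ⊑ D → E ⊑ D′ → X ⊆[ E ] X′ → X′ ⊆[ E ] X →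
        X ⊨[ D ] φ → X′ ⊨[ D′ ] φ
local (atom p) {E} i _ _ _ X′⊆X h = All.tabulate λ s∈ →
  let t , t∈ , e = ⊆-lookup X′⊆X s∈ in trans (≐-at E (i (here refl)) e) (All.lookup h t∈)
local (natom p) {E} i _ _ _ X′⊆X h = All.tabulate λ s∈ →
  let t , t∈ , e = ⊆-lookup X′⊆X s∈ in trans (≐-at E (i (here refl)) e) (All.lookup h t∈)
local (φ ∧ᶠ ψ) i j j′ p q (h , k) =
  local φ (i ∘ ∈-++⁺ˡ) j j′ p q h , local ψ (i ∘ ∈-++⁺ʳ (vars φ)) j j′ p q k
local (φ ∨ᶠ ψ) {E} {D} {D′} {X} {X′} i j j′ X⊆X′ X′⊆X (Y , Z , Y⊆X , Z⊆X , cover , h , k) =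
  restrict Y , restrict Z , inside Y , inside Z , cover′ ,
  local φ (i ∘ ∈-++⁺ˡ) j j′ (to Y⊆X) (from Y) h ,
  local ψ (i ∘ ∈-++⁺ʳ (vars φ)) j j′ (to Z⊆X) (from Z) k
  where
  -- `X` and `X′` are only known to correspond on `E`, so the counterpart of `Y` consists of the
  -- members of `X′` that agree on `E` with some member of `Y`.
  restrict : Team → Team
  restrict Y = List.filter (λ s → ∈[]? s E Y) X′
  inside : ∀ Y → restrict Y ⊆[ D′ ] X′
  inside Y = All.tabulate λ s∈ → ∈⇒∈[] (proj₁ (∈-filter⁻ (λ s → ∈[]? s E Y) {xs = X′} s∈))
  from : ∀ Y → restrict Y ⊆[ E ] Y
  from Y = All.tabulate λ s∈ → proj₂ (∈-filter⁻ (λ s → ∈[]? s E Y) {xs = X′} s∈)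
  to : ∀ {Y} → Y ⊆[ D ] X → Y ⊆[ E ] restrict Y
  to {Y} Y⊆X = All.tabulate λ {y} y∈ →
    let x , x∈ , e = ⊆-lookup Y⊆X y∈
        x′ , x′∈ , e′ = ⊆-lookup X⊆X′ x∈
        y≐x′ = ≐-trans E E E (≐-⊑ j e) e′
    in witness (∈-filter⁺ (λ s → ∈[]? s E Y) x′∈ (witness y∈ (≐-sym E E y≐x′))) y≐x′
  cover′ : ∀ {s} → s ∈ X′ → s ∈[ D′ ] restrict Y ⊎ s ∈[ D′ ] restrict Z
  cover′ {s} s∈ with x , x∈ , e ← ⊆-lookup X′⊆X s∈ = Sum.map (into Y) (into Z) (cover x∈)
    where
    into : ∀ Y → x ∈[ D ] Y → s ∈[ D′ ] restrict Y
    into Y m = ∈⇒∈[] (∈-filter⁺ (λ s → ∈[]? s E Y) s∈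
      (Any.map (λ e′ → ≐-trans E E E e (≐-⊑ j e′)) m))
local (indep ps qs rs) {E} i _ _ X⊆X′ X′⊆X h {s} {t} s∈ t∈ e =
  let s₀ , s₀∈ , es = ⊆-lookup X′⊆X s∈
      t₀ , t₀∈ , et = ⊆-lookup X′⊆X t∈
      u₀ , u₀∈ , e₁ , e₂ = h s₀∈ t₀∈ (≐-trans ps ps ps (≐-sym ps ps (≐-⊑ ip es)) (≐-trans ps ps ps e (≐-⊑ ip et)))
      u , u∈ , eu = ⊆-lookup X⊆X′ u₀∈
  in u , u∈ ,
     ≐-trans pq pq pq (≐-sym pq pq (≐-⊑ ipq eu)) (≐-trans pq pq pq e₁ (≐-sym pq pq (≐-⊑ ipq es))) ,
     ≐-trans rs rs rs (≐-sym rs rs (≐-⊑ ir eu)) (≐-trans rs rs rs e₂ (≐-sym rs rs (≐-⊑ ir et)))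
  where
  pq = ps ++ qs
  ip : ps ⊑ E
  ip = i ∘ ∈-++⁺ˡ
  ipq : pq ⊑ E
  ipq m with ∈-++⁻ ps m
  ... | inj₁ m′ = i (∈-++⁺ˡ m′)
  ... | inj₂ m′ = i (∈-++⁺ʳ ps (∈-++⁺ˡ m′))
  ir : rs ⊑ E
  ir = i ∘ ∈-++⁺ʳ ps ∘ ∈-++⁺ʳ qs
local (incl ps qs) {E} i _ _ X⊆X′ X′⊆X h {s} s∈ =
  let s₀ , s₀∈ , es = ⊆-lookup X′⊆X s∈
      t₀ , t₀∈ , e = h s₀∈
      t , t∈ , et = ⊆-lookup X⊆X′ t₀∈
  in t , t∈ , ≐-trans p p q (≐-⊑ (i ∘ ∈-++⁺ˡ) es) (≐-trans p q q e (≐-⊑ (i ∘ ∈-++⁺ʳ p) et))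
  where
  p = Vec.toList ps
  q = Vec.toList qs
-- The hypotheses are symmetric in the two teams and their domains, so the induction hypothesis also
-- leads from `X′` back to `X`.
local (∼ φ) i j j′ p q h k = h (local φ i j′ j q p k)

-- Values of the game and truth in the team

asg : Block → Assignment
asg s x = does (toBin x ∈? s)

asg-true : ∀ b x → toBin x ∈ b → asg b x ≡ true
asg-true b x = dec-true (toBin x ∈? b)

asg-false : ∀ b x → ¬ toBin x ∈ b → asg b x ≡ false
asg-false b x = dec-false (toBin x ∈? b)

xor⇒≢ : ∀ {b c x y} → Xor (toBin x ∈ b) (toBin y ∈ c) → asg b x ≢ asg c y
xor⇒≢ {b} {c} {x} {y} (inj₁ (p , q)) e with () ← trans (sym (asg-true b x p)) (trans e (asg-false c y q))
xor⇒≢ {b} {c} {x} {y} (inj₂ (p , q)) e with () ← trans (sym (asg-false b x p)) (trans e (asg-true c y q))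

¬xor⇒≡ : ∀ {b c x y} → ¬ Xor (toBin x ∈ b) (toBin y ∈ c) → asg b x ≡ asg c y
¬xor⇒≡ {b} {c} {x} {y} h with toBin x ∈? b | toBin y ∈? c
... | yes p | yes q = refl
... | yes p | no q  = contradiction (inj₁ (p , q)) h
... | no p  | yes q = contradiction (inj₂ (p , q)) h
... | no p  | no q  = refl

differ⇒ : ∀ {b c} xs → Differ b c xs → ¬ asg b [ xs ]≐ asg c [ xs ]
differ⇒ {b} {c} (x ∷ xs) (here p)  (e , _) = xor⇒≢ {b} {c} {x} {x} p e
differ⇒ (x ∷ xs) (there p) (_ , q) = differ⇒ xs p q

¬differ⇒ : ∀ {b c} xs → ¬ Differ b c xs → asg b [ xs ]≐ asg c [ xs ]
¬differ⇒ []       h = tt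
¬differ⇒ {b} {c} (x ∷ xs) h = ¬xor⇒≡ {b} {c} {x} {x} (h ∘ here) , ¬differ⇒ xs (h ∘ there)

differAt⇒ : ∀ {b c k} (ps qs : Vec ℕ k) → DifferAt b c ps qs → ¬ asg b [ Vec.toList ps ]≐ asg c [ Vec.toList qs ]
differAt⇒ [] [] ()
differAt⇒ {b} {c} (p ∷ ps) (q ∷ qs) (inj₁ x) (e , _) = xor⇒≢ {b} {c} {p} {q} x e
differAt⇒ (p ∷ ps) (q ∷ qs) (inj₂ x) (_ , e) = differAt⇒ ps qs x e

¬differAt⇒ : ∀ {b c k} (ps qs : Vec ℕ k) → ¬ DifferAt b c ps qs → asg b [ Vec.toList ps ]≐ asg c [ Vec.toList qs ]
¬differAt⇒ []       []       h = tt
¬differAt⇒ {b} {c} (p ∷ ps) (q ∷ qs) h = ¬xor⇒≡ {b} {c} {p} {q} (h ∘ inj₁) , ¬differAt⇒ ps qs (h ∘ inj₂)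

≐-++⁺ : ∀ xs {ys} → α [ xs ]≐ β [ xs ] → α [ ys ]≐ β [ ys ] → α [ xs ++ ys ]≐ β [ xs ++ ys ]
≐-++⁺ []       p       q = q
≐-++⁺ (x ∷ xs) (e , p) q = e , ≐-++⁺ xs p q

≐-++⁻ : ∀ xs {ys} → α [ xs ++ ys ]≐ β [ xs ++ ys ] → α [ xs ]≐ β [ xs ] × α [ ys ]≐ β [ ys ]
≐-++⁻ []       p       = tt , p
≐-++⁻ (x ∷ xs) (e , p) = let q , r = ≐-++⁻ xs p in (e , q) , r

⟪_⟫ : List Block → Team
⟪_⟫ = map asg

indep-sem : ∀ {D} X ps qs rs → (⟪ X ⟫ ⊨[ D ] indep ps qs rs → ¬ Any (λ b → Any (Dependence X ps qs rs b) X) X) ×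
                               (¬ Any (λ b → Any (Dependence X ps qs rs b) X) X → ⟪ X ⟫ ⊨[ D ] indep ps qs rs)
indep-sem {D} X ps qs rs = to , from
  where
  to : ⟪ X ⟫ ⊨[ D ] indep ps qs rs → ¬ Any (λ b → Any (Dependence X ps qs rs b) X) X
  to h a with b , b∈ , a′ ← find a with c , c∈ , dep ← find a′ =
    dep (inj₂ (agree (h (∈-map⁺ asg b∈) (∈-map⁺ asg c∈) (¬differ⇒ ps (dep ∘ inj₁)))))
    where
    agree : (∃[ u ] u ∈ ⟪ X ⟫ × (u [ ps ++ qs ]≐ asg b [ ps ++ qs ]) × (u [ rs ]≐ asg c [ rs ])) →
            Any (λ d → ¬ (Differ b d qs ⊎ (Differ b d ps ⊎ Differ d c rs))) X
    agree (u , u∈ , e , e′) with d , d∈ , refl ← ∈-map⁻ asg u∈ = witness d∈ λ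
      { (inj₁ x) → differ⇒ qs x (≐-sym qs qs (proj₂ (≐-++⁻ ps e)))
      ; (inj₂ (inj₁ x)) → differ⇒ ps x (≐-sym ps ps (proj₁ (≐-++⁻ ps e)))
      ; (inj₂ (inj₂ x)) → differ⇒ rs x e′ }
  from : ¬ Any (λ b → Any (Dependence X ps qs rs b) X) X → ⟪ X ⟫ ⊨[ D ] indep ps qs rs
  from h s∈ t∈ e with b , b∈ , refl ← ∈-map⁻ asg s∈ with c , c∈ , refl ← ∈-map⁻ asg t∈
    with Any.any? (λ d → ≐? (asg d) (ps ++ qs) (asg b) (ps ++ qs) ×-dec ≐? (asg d) rs (asg c) rs) X
  ... | yes p = let d , d∈ , q = find p in asg d , ∈-map⁺ asg d∈ , q
  ... | no ¬p = contradiction (witness b∈ (witness c∈ λ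
      { (inj₁ x) → differ⇒ ps x e
      ; (inj₂ x) → let d , d∈ , f = find x in ¬p (witness d∈
          ( ≐-sym (ps ++ qs) (ps ++ qs) (≐-++⁺ ps (¬differ⇒ ps (f ∘ inj₂ ∘ inj₁)) (¬differ⇒ qs (f ∘ inj₁)))
          , ¬differ⇒ rs (f ∘ inj₂ ∘ inj₂))) })) h

incl-sem : ∀ {D} X {k} (ps qs : Vec ℕ k) →
           (⟪ X ⟫ ⊨[ D ] incl ps qs → ¬ Any (λ b → ¬ Any (λ c → ¬ DifferAt b c ps qs) X) X) ×
           (¬ Any (λ b → ¬ Any (λ c → ¬ DifferAt b c ps qs) X) X → ⟪ X ⟫ ⊨[ D ] incl ps qs)
incl-sem {D} X ps qs = to , from
  where
  to : ⟪ X ⟫ ⊨[ D ] incl ps qs → ¬ Any (λ b → ¬ Any (λ c → ¬ DifferAt b c ps qs) X) X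
  to h a with b , b∈ , f ← find a with t , t∈ , e ← h (∈-map⁺ asg b∈) with c , c∈ , refl ← ∈-map⁻ asg t∈ =
    f (witness c∈ (λ x → differAt⇒ ps qs x e))
  from : ¬ Any (λ b → ¬ Any (λ c → ¬ DifferAt b c ps qs) X) X → ⟪ X ⟫ ⊨[ D ] incl ps qs
  from h s∈ with b , b∈ , refl ← ∈-map⁻ asg s∈
    with Any.any? (λ c → ≐? (asg b) (Vec.toList ps) (asg c) (Vec.toList qs)) X
  ... | yes p = let c , c∈ , q = find p in asg c , ∈-map⁺ asg c∈ , q
  ... | no ¬p = contradiction (witness b∈ λ x → let c , c∈ , f = find x in ¬p (witness c∈ (¬differAt⇒ ps qs f))) h

atom-sem : ∀ {D} X p → (⟪ X ⟫ ⊨[ D ] atom p → ¬ Any (Violates true (toBin p)) X) ×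
                       (¬ Any (Violates true (toBin p)) X → ⟪ X ⟫ ⊨[ D ] atom p)
atom-sem X p =
  (λ h a → let b , b∈ , f = find a in f (to (All.lookup h (∈-map⁺ asg b∈)))) ,
  (λ h → All.map⁺ (All.tabulate λ {b} b∈ → asg-true b p (decidable-stable (toBin p ∈? b) (λ f → h (witness b∈ f)))))
  where
  to : ∀ {b} → asg b p ≡ true → toBin p ∈ b
  to {b} e with toBin p ∈? b
  ... | yes q = q
  to {b} () | no _

natom-sem : ∀ {D} X p → (⟪ X ⟫ ⊨[ D ] natom p → ¬ Any (Violates false (toBin p)) X) ×
                        (¬ Any (Violates false (toBin p)) X → ⟪ X ⟫ ⊨[ D ] natom p)
natom-sem X p =
  (λ h a → let b , b∈ , q = find a in case trans (sym (asg-true b p q)) (All.lookup h (∈-map⁺ asg b∈)) of λ ()) ,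
  (λ h → All.map⁺ (All.tabulate λ {b} b∈ → asg-false b p (λ q → h (witness b∈ q))))

part-∈⁺ : ∀ b P X {s} → s ∈ X ⊎ (∃[ t ] (t , s) ∈ P × kept b t ≡ true) → s ∈ part b P X
part-∈⁺ b []            X (inj₁ p) = p
part-∈⁺ b ((t , s) ∷ P) X (inj₁ p) with kept b t
... | true  = part-∈⁺ b P (s ∷ X) (inj₁ (there p))
... | false = part-∈⁺ b P X (inj₁ p)
part-∈⁺ b ((t , s) ∷ P) X (inj₂ (_ , here refl , e)) rewrite e = part-∈⁺ b P (s ∷ X) (inj₁ (here refl))
part-∈⁺ b ((t , s) ∷ P) X (inj₂ (t′ , there p , e)) with kept b t
... | true  = part-∈⁺ b P (s ∷ X) (inj₂ (t′ , p , e))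
... | false = part-∈⁺ b P X (inj₂ (t′ , p , e))

part-∈⁻ : ∀ b P X {s} → s ∈ part b P X → s ∈ X ⊎ (∃[ t ] (t , s) ∈ P × kept b t ≡ true)
part-∈⁻ b []            X p = inj₁ p
part-∈⁻ b ((t , s) ∷ P) X p with kept b t in e
... | true with part-∈⁻ b P (s ∷ X) p
...   | inj₁ (here refl) = inj₂ (t , here refl , e)
...   | inj₁ (there q)   = inj₁ q
...   | inj₂ (t′ , q , f) = inj₂ (t′ , there q , f)
part-∈⁻ b ((t , s) ∷ P) X p | false with part-∈⁻ b P X p
...   | inj₁ q = inj₁ q
...   | inj₂ (t′ , q , f) = inj₂ (t′ , there q , f)

split⇒ : ∀ {Q} X P → Split Q X P →
         ∃[ P′ ] Q P′ × (∀ {s} → s ∈ blocks P′ → s ∈ X ⊎ s ∈ blocks P) × (∀ {s} → s ∈ X ⊎ s ∈ blocks P → s ∈ blocks P′)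
split⇒ []      P q = P , q , inj₂ , λ { (inj₂ p) → p }
split⇒ {Q} (s ∷ X) P q = from (choice q)
  where
  choice : Split Q (s ∷ X) P → ∃[ t ] Split Q X ((t , s) ∷ P)
  choice (inj₁ q)        = inBoth , q
  choice (inj₂ (inj₁ q)) = inLeft , q
  choice (inj₂ (inj₂ q)) = inRight , q
  from : (∃[ t ] Split Q X ((t , s) ∷ P)) → _
  from (t , q) with P′ , x , f , g ← split⇒ X ((t , s) ∷ P) q = P′ , x , (λ {s′} → old {s′}) , (λ {s′} → new {s′})
    where
    old : ∀ {s′} → s′ ∈ blocks P′ → s′ ∈ s ∷ X ⊎ s′ ∈ blocks P
    old p with f p
    ... | inj₁ p         = inj₁ (there p)
    ... | inj₂ (here e)  = inj₁ (here e)
    ... | inj₂ (there p) = inj₂ p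
    new : ∀ {s′} → s′ ∈ s ∷ X ⊎ s′ ∈ blocks P → s′ ∈ blocks P′
    new (inj₁ (here e))  = g (inj₂ (here e))
    new (inj₁ (there p)) = g (inj₁ p)
    new (inj₂ p)         = g (inj₂ (there p))

⇒split : ∀ {Q} (h : Block → Tag) X P → Q (map (λ s → h s , s) X ʳ++ P) → Split Q X P
⇒split h []      P q = q
⇒split h (s ∷ X) P q with h s | ⇒split h X ((h s , s) ∷ P) q
... | inBoth  | x = inj₁ x
... | inLeft  | x = inj₂ (inj₁ x)
... | inRight | x = inj₂ (inj₂ x)

⟪⟫-⊆ : ∀ {D Y X} → (∀ {s} → s ∈ Y → s ∈ X) → ⟪ Y ⟫ ⊆[ D ] ⟪ X ⟫
⟪⟫-⊆ f = All.map⁺ (All.tabulate λ p → ∈⇒∈[] (∈-map⁺ asg (f p)))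

-- The semantics splits into arbitrary teams, up to agreement on `D`, while the game splits the list
-- of blocks. Tagging each block by its membership in the two parts gives parts that agree with them
-- on `D`, and `local` carries truth over.
or-sem : ∀ φ ψ {D} X → vars (φ ∨ᶠ ψ) ⊑ D →
         let Q = Halves (λ Y → ⟪ Y ⟫ ⊨[ D ] φ) (λ Y → ⟪ Y ⟫ ⊨[ D ] ψ) in
         (Split Q X [] → ⟪ X ⟫ ⊨[ D ] (φ ∨ᶠ ψ)) × (⟪ X ⟫ ⊨[ D ] (φ ∨ᶠ ψ) → Split Q X [])
or-sem φ ψ {D} X i = to , from
  where
  Q : Tagged → Set
  Q = Halves (λ Y → ⟪ Y ⟫ ⊨[ D ] φ) (λ Y → ⟪ Y ⟫ ⊨[ D ] ψ)
  to : Split Q X [] → ⟪ X ⟫ ⊨[ D ] (φ ∨ᶠ ψ)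
  to q with P , (h , k) , f , g ← split⇒ {Q} X [] q =
    ⟪ part true P [] ⟫ , ⟪ part false P [] ⟫ , ⟪⟫-⊆ (inside true) , ⟪⟫-⊆ (inside false) , cover , h , k
    where
    inside : ∀ b {s} → s ∈ part b P [] → s ∈ X
    inside b p with part-∈⁻ b P [] p
    ... | inj₂ (t , q , _) with f (∈-map⁺ proj₂ q)
    ...   | inj₁ r = r
    cover : ∀ {s} → s ∈ ⟪ X ⟫ → s ∈[ D ] ⟪ part true P [] ⟫ ⊎ s ∈[ D ] ⟪ part false P [] ⟫
    cover s∈ with b , b∈ , refl ← ∈-map⁻ asg s∈ with (t , _) , p , refl ← ∈-map⁻ proj₂ (g (inj₁ b∈)) = cases t p
      where
      cases : ∀ t {b} → (t , b) ∈ P → asg b ∈[ D ] ⟪ part true P [] ⟫ ⊎ asg b ∈[ D ] ⟪ part false P [] ⟫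
      cases inBoth  p = inj₁ (∈⇒∈[] (∈-map⁺ asg (part-∈⁺ true P [] (inj₂ (inBoth , p , refl)))))
      cases inLeft  p = inj₁ (∈⇒∈[] (∈-map⁺ asg (part-∈⁺ true P [] (inj₂ (inLeft , p , refl)))))
      cases inRight p = inj₂ (∈⇒∈[] (∈-map⁺ asg (part-∈⁺ false P [] (inj₂ (inRight , p , refl)))))
  from : ⟪ X ⟫ ⊨[ D ] (φ ∨ᶠ ψ) → Split Q X []
  from (Y , Z , Y⊆X , Z⊆X , cover , h , k) = ⇒split {Q} tag X []
    ( local φ (i ∘ ∈-++⁺ˡ) id id (to-part true Y Y⊆X left-kept) (from-part true Y left-only) h
    , local ψ (i ∘ ∈-++⁺ʳ (vars φ)) id id (to-part false Z Z⊆X right-kept) (from-part false Z right-only) k)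
    where
    tag : Block → Tag
    tag b with ∈[]? (asg b) D Y | ∈[]? (asg b) D Z
    ... | yes _ | yes _ = inBoth
    ... | yes _ | no _  = inLeft
    -- This includes a block in neither part; for members of `X` that is excluded by `cover`, which
    -- `right-only` invokes.
    ... | no _  | _     = inRight
    P : Tagged
    P = map (λ s → tag s , s) X ʳ++ []
    P-∈⁺ : ∀ {s} → s ∈ X → (tag s , s) ∈ P
    P-∈⁺ p = Any.reverse⁺ (∈-map⁺ (λ s → tag s , s) p)
    P-∈⁻ : ∀ {t s} → (t , s) ∈ P → s ∈ X × t ≡ tag s
    P-∈⁻ p with s , q , refl ← ∈-map⁻ (λ s → tag s , s) (Any.reverse⁻ p) = q , refl
    left-kept : ∀ {b} → asg b ∈[ D ] Y → kept true (tag b) ≡ true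
    left-kept {b} p with ∈[]? (asg b) D Y | ∈[]? (asg b) D Z
    ... | yes _ | yes _ = refl
    ... | yes _ | no _  = refl
    ... | no ¬p | _     = contradiction p ¬p
    left-only : ∀ {b} → b ∈ X → kept true (tag b) ≡ true → asg b ∈[ D ] Y
    left-only {b} _ e with ∈[]? (asg b) D Y | ∈[]? (asg b) D Z
    ... | yes p | _ = p
    left-only _ () | no _ | _
    right-kept : ∀ {b} → asg b ∈[ D ] Z → kept false (tag b) ≡ true
    right-kept {b} p with ∈[]? (asg b) D Y | ∈[]? (asg b) D Z
    ... | yes _ | yes _ = refl
    ... | yes _ | no ¬p = contradiction p ¬p
    ... | no _  | _     = refl
    right-only : ∀ {b} → b ∈ X → kept false (tag b) ≡ true → asg b ∈[ D ] Z
    right-only {b} b∈ e with ∈[]? (asg b) D Y | ∈[]? (asg b) D Z | cover (∈-map⁺ asg b∈)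
    ... | yes _ | yes p | _ = p
    right-only b∈ () | yes _ | no _ | _
    ... | no _  | yes p | _ = p
    ... | no ¬p | no _  | inj₁ p = contradiction p ¬p
    ... | no _  | no _  | inj₂ p = p
    to-part : ∀ b Y → Y ⊆[ D ] ⟪ X ⟫ → (∀ {s} → asg s ∈[ D ] Y → kept b (tag s) ≡ true) → Y ⊆[ D ] ⟪ part b P [] ⟫
    to-part b Y Y⊆X f = All.tabulate λ {y} y∈ →
      let x , x∈ , e = ⊆-lookup Y⊆X y∈ in into x∈ y∈ e
      where
      into : ∀ {x y} → x ∈ ⟪ X ⟫ → y ∈ Y → y [ D ]≐ x [ D ] → y ∈[ D ] ⟪ part b P [] ⟫
      into x∈ y∈ e with s , s∈ , refl ← ∈-map⁻ asg x∈ =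
        witness (∈-map⁺ asg (part-∈⁺ b P [] (inj₂ (tag s , P-∈⁺ s∈ , f (witness y∈ (≐-sym D D e)))))) e
    from-part : ∀ b Y → (∀ {s} → s ∈ X → kept b (tag s) ≡ true → asg s ∈[ D ] Y) → ⟪ part b P [] ⟫ ⊆[ D ] Y
    from-part b Y f = All.map⁺ (All.tabulate λ p → out (part-∈⁻ b P [] p))
      where
      out : ∀ {s} → s ∈ [] ⊎ (∃[ t ] (t , s) ∈ P × kept b t ≡ true) → asg s ∈[ D ] Y
      out (inj₂ (t , p , e)) with q , refl ← P-∈⁻ p = f q e

-- Cost of the evaluation game

nodes : Fm → ℕ
nodes (φ ∧ᶠ ψ) = 1 + (nodes φ + nodes ψ)
nodes (φ ∨ᶠ ψ) = 1 + (nodes φ + nodes ψ)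
nodes (∼ φ)    = 1 + nodes φ
nodes _        = 1

length-encList : ∀ xs → length (encList xs) ≡ 2 + ∥ xs ∥ᵛ
length-encList xs = cong suc (trans (List.length-++ (encVars xs)) (trans (+-comm _ 1) (cong suc (length-encVars xs))))

length-indep : ∀ ps qs rs → length (encode (indep ps qs rs)) ≡ 1 + ((2 + ∥ qs ∥ᵛ) + ((2 + ∥ ps ∥ᵛ) + (2 + ∥ rs ∥ᵛ)))
length-indep ps qs rs = cong suc (trans (List.length-++ (encList qs)) (cong₂ _+_ (length-encList qs)
  (trans (List.length-++ (encList ps)) (cong₂ _+_ (length-encList ps) (length-encList rs)))))

length-incl : ∀ {k} (ps qs : Vec ℕ k) → length (encode (incl ps qs)) ≡ 1 + ((2 + sizeᵛ ps) + (2 + sizeᵛ qs))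
length-incl ps qs = cong suc (trans (List.length-++ (encList (Vec.toList ps)))
  (cong₂ _+_ (length-encList (Vec.toList ps)) (length-encList (Vec.toList qs))))

length-binary : ∀ φ ψ x → length (sLp ∷ encode φ ++ x ∷ encode ψ ++ sRp ∷ []) ≡ 3 + (length (encode φ) + length (encode ψ))
length-binary φ ψ x = trans (cong suc (trans (List.length-++ (encode φ))
    (cong (λ z → length (encode φ) + suc z) (trans (List.length-++ (encode ψ)) (+-comm _ 1)))))
  (≤-antisym (linear (con 1 ⊕ (x₀ ⊕ (con 2 ⊕ x₁))) (con 3 ⊕ (x₀ ⊕ x₁)) ρ)
             (linear (con 3 ⊕ (x₀ ⊕ x₁)) (con 1 ⊕ (x₀ ⊕ (con 2 ⊕ x₁))) ρ))
  where
  ρ = length (encode φ) ∷ length (encode ψ) ∷ []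

module _ (M : ℕ) where

  -- A generous allowance for the work at one node, with `M` bounding the length of formula and team
  -- together. The largest coefficient to be covered is the 24 of `indep-val`.
  cost : ℕ
  cost = 70 * M

  within : ∀ {n m} → m ≤ M → n ≤ 70 * m → n ≤ 1 * cost
  within q p = ≤-trans p (≤-trans (*-monoʳ-≤ 70 q) (≤-reflexive (sym (+-identityʳ cost))))

  fitˡ : ∀ φ ψ X → 3 + (length (encode φ) + length (encode ψ)) + ∥ X ∥ᵗ + 1 ≤ M → length (encode φ) + ∥ X ∥ᵗ + 1 ≤ M
  fitˡ φ ψ X = ≤-trans (linear (x₀ ⊕ x₂ ⊕ con 1) (con 3 ⊕ (x₀ ⊕ x₁) ⊕ x₂ ⊕ con 1) (length (encode φ) ∷ length (encode ψ) ∷ ∥ X ∥ᵗ ∷ []))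

  fitʳ : ∀ φ ψ X → 3 + (length (encode φ) + length (encode ψ)) + ∥ X ∥ᵗ + 1 ≤ M → length (encode ψ) + ∥ X ∥ᵗ + 1 ≤ M
  fitʳ φ ψ X = ≤-trans (linear (x₁ ⊕ x₂ ⊕ con 1) (con 3 ⊕ (x₀ ⊕ x₁) ⊕ x₂ ⊕ con 1) (length (encode φ) ∷ length (encode ψ) ∷ ∥ X ∥ᵗ ∷ []))

  -- `M` stays a valid bound throughout, because operands are shorter and the parts of a team are
  -- not larger. The 6 changes of mover are those of an independence atom: the `flip` on entering it
  -- and the five of `indep-val`.
  eval-val : ∀ φ {D} → vars φ ⊑ D → ∀ X {r} → Stop r → length (encode φ) + ∥ X ∥ᵗ + 1 ≤ M →
             Val (nodes φ * cost) (nodes φ * 6) (goto eval) (S (encode φ ++ r) (team X) [] [] [] none₃) (⟪ X ⟫ ⊨[ D ] φ)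
  eval-val (atom p) {D} i X q b =
    v-map (proj₂ (atom-sem {D} X p)) (proj₁ (atom-sem {D} X p)) (v-≤ᵃ (s≤s (s≤s z≤n)) (v-≤
      (within b (linear (con 3 ⊕ (3 ⊛ x₀ ⊕ 3 ⊛ x₁ ⊕ con 10)) (70 ⊛ (con 1 ⊕ x₀ ⊕ x₁ ⊕ con 1)) (∣ toBin p ∣ᵇ ∷ ∥ X ∥ᵗ ∷ [])))
      (v-goto (v-pop {i = fm} (v-flip (pick-val true (toBin p) X q))))))
  eval-val (natom p) {D} i X q b =
    v-map (proj₂ (natom-sem {D} X p)) (proj₁ (natom-sem {D} X p)) (v-≤ᵃ (s≤s (s≤s z≤n)) (v-≤
      (within b (linear (con 4 ⊕ (3 ⊛ x₀ ⊕ 3 ⊛ x₁ ⊕ con 10)) (70 ⊛ (con 2 ⊕ x₀ ⊕ x₁ ⊕ con 1)) (∣ toBin p ∣ᵇ ∷ ∥ X ∥ᵗ ∷ [])))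
      (v-goto (v-pop {i = fm} (v-pop {i = fm} (v-flip (pick-val false (toBin p) X q)))))))
  eval-val (φ ∧ᶠ ψ) {D} i X {r} q b =
    v-≤ᵃ (+-monoˡ-≤ ((nodes φ + nodes ψ) * 6) (s≤s (s≤s z≤n))) (v-≤ (step b′)
      (and-val φ ψ
        (v-≤ (*-monoˡ-≤ cost (m≤m+n (nodes φ) (nodes ψ))) (v-≤ᵃ (*-monoˡ-≤ 6 (m≤m+n (nodes φ) (nodes ψ)))
          (eval-val φ (i ∘ ∈-++⁺ˡ) X other (fitˡ φ ψ X b′))))
        (v-≤ (*-monoˡ-≤ cost (m≤n+m (nodes ψ) (nodes φ))) (v-≤ᵃ (*-monoˡ-≤ 6 (m≤n+m (nodes ψ) (nodes φ)))
          (eval-val ψ (i ∘ ∈-++⁺ʳ (vars φ)) X other (fitʳ φ ψ X b′))))))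
    where
    b′ = subst (λ z → z + ∥ X ∥ᵗ + 1 ≤ M) (length-binary φ ψ sAnd) b
    step : 3 + (length (encode φ) + length (encode ψ)) + ∥ X ∥ᵗ + 1 ≤ M →
           8 * length (encode φ) + (12 + (nodes φ + nodes ψ) * cost) ≤ cost + (nodes φ + nodes ψ) * cost
    step p = ≤-trans (≤-reflexive (sym (+-assoc (8 * length (encode φ)) 12 _))) (+-monoˡ-≤ ((nodes φ + nodes ψ) * cost)
      (≤-trans (linear (8 ⊛ x₀ ⊕ con 12) (70 ⊛ (con 3 ⊕ (x₀ ⊕ x₁) ⊕ x₂ ⊕ con 1)) (length (encode φ) ∷ length (encode ψ) ∷ ∥ X ∥ᵗ ∷ []))
               (*-monoʳ-≤ 70 p)))
  eval-val (φ ∨ᶠ ψ) {D} i X {r} q b =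
    v-map (proj₁ (or-sem φ ψ X i)) (proj₂ (or-sem φ ψ X i))
    (v-≤ᵃ (+-monoˡ-≤ ((nodes φ + nodes ψ) * 6) (s≤s (s≤s z≤n))) (v-≤ (step b′)
      (or-val φ ψ X
        (λ Y l → v-≤ (*-monoˡ-≤ cost (m≤m+n (nodes φ) (nodes ψ))) (v-≤ᵃ (*-monoˡ-≤ 6 (m≤m+n (nodes φ) (nodes ψ)))
          (eval-val φ (i ∘ ∈-++⁺ˡ) Y other (≤-trans (+-monoˡ-≤ 1 (+-monoʳ-≤ (length (encode φ)) l)) (fitˡ φ ψ X b′)))))
        (λ Y l → v-≤ (*-monoˡ-≤ cost (m≤n+m (nodes ψ) (nodes φ))) (v-≤ᵃ (*-monoˡ-≤ 6 (m≤n+m (nodes ψ) (nodes φ)))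
          (eval-val ψ (i ∘ ∈-++⁺ʳ (vars φ)) Y other (≤-trans (+-monoˡ-≤ 1 (+-monoʳ-≤ (length (encode ψ)) l)) (fitʳ φ ψ X b′))))))))
    where
    b′ = subst (λ z → z + ∥ X ∥ᵗ + 1 ≤ M) (length-binary φ ψ sOr) b
    step : 3 + (length (encode φ) + length (encode ψ)) + ∥ X ∥ᵗ + 1 ≤ M →
           8 * length (encode φ) + (8 * ∥ X ∥ᵗ + (18 + (nodes φ + nodes ψ) * cost)) ≤ cost + (nodes φ + nodes ψ) * cost
    step p = ≤-trans (≤-reflexive (trans (cong (8 * length (encode φ) +_) (sym (+-assoc (8 * ∥ X ∥ᵗ) 18 _)))
        (sym (+-assoc (8 * length (encode φ)) (8 * ∥ X ∥ᵗ + 18) _)))) (+-monoˡ-≤ ((nodes φ + nodes ψ) * cost)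
      (≤-trans (linear (8 ⊛ x₀ ⊕ (8 ⊛ x₂ ⊕ con 18)) (70 ⊛ (con 3 ⊕ (x₀ ⊕ x₁) ⊕ x₂ ⊕ con 1)) (length (encode φ) ∷ length (encode ψ) ∷ ∥ X ∥ᵗ ∷ []))
               (*-monoʳ-≤ 70 p)))
  eval-val (indep ps qs rs) {D} i X {r} q b =
    v-map (proj₂ (indep-sem {D} X ps qs rs)) (proj₁ (indep-sem {D} X ps qs rs)) (v-≤
      (within (subst (λ z → z + ∥ X ∥ᵗ + 1 ≤ M) (length-indep ps qs rs) b) (linear (con 3 ⊕ (24 ⊛ x₀ ⊕ (5 ⊛ (x₁ ⊕ x₂ ⊕ x₃) ⊕ con 60))) (70 ⊛ (con 1 ⊕ ((con 2 ⊕ x₁) ⊕ ((con 2 ⊕ x₂) ⊕ (con 2 ⊕ x₃))) ⊕ x₀ ⊕ con 1))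
               (∥ X ∥ᵗ ∷ ∥ qs ∥ᵛ ∷ ∥ ps ∥ᵛ ∷ ∥ rs ∥ᵛ ∷ [])))
      (v-goto (v-pop {i = fm} (v-flip
        (v-store (cong (λ z → S z (team X) [] [] [] none₃) (sym assoc)) (indep-val X ps qs rs))))))
    where
    assoc : (encList qs ++ encList ps ++ encList rs) ++ r ≡ encList qs ++ (encList ps ++ (encList rs ++ r))
    assoc = trans (List.++-assoc (encList qs) (encList ps ++ encList rs) r) (cong (encList qs ++_) (List.++-assoc (encList ps) (encList rs) r))
  eval-val (incl ps qs) {D} i X {r} q b =
    v-map (proj₂ (incl-sem {D} X ps qs)) (proj₁ (incl-sem {D} X ps qs)) (v-≤
      (within (subst (λ z → z + ∥ X ∥ᵗ + 1 ≤ M) (length-incl ps qs) b) (linear (con 3 ⊕ (20 ⊛ x₀ ⊕ (4 ⊛ x₁ ⊕ 3 ⊛ x₂ ⊕ con 50))) (70 ⊛ (con 1 ⊕ ((con 2 ⊕ x₁) ⊕ (con 2 ⊕ x₂)) ⊕ x₀ ⊕ con 1))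
               (∥ X ∥ᵗ ∷ sizeᵛ ps ∷ sizeᵛ qs ∷ [])))
      (v-goto (v-pop {i = fm} (v-flip
        (v-store (cong (λ z → S z (team X) [] [] [] none₃) (sym (List.++-assoc (encList (Vec.toList ps)) (encList (Vec.toList qs)) r)))
          (incl-val X ps qs))))))
  eval-val (∼ φ) i X q b =
    v-≤ᵃ (+-monoˡ-≤ (nodes φ * 6) (s≤s z≤n)) (v-≤ (+-monoˡ-≤ (nodes φ * cost) three)
      (v-goto (v-pop {i = fm} (v-flip (eval-val φ i X q (≤-trans (n≤1+n _) b))))))
    where
    three : 3 ≤ cost
    three = ≤-trans (linear (con 3) (70 ⊛ (con 1 ⊕ x₀ ⊕ x₁ ⊕ con 1)) (length (encode φ) ∷ ∥ X ∥ᵗ ∷ [])) (*-monoʳ-≤ 70 b)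

-- The parser

-- The words accepted by the expectations g, and those starting with a formula.
Rest : List Sym → List Sym → Set
Rest []         w = w ≡ []
Rest (sAnd ∷ g) w = ∃[ c ] ∃[ ψ ] ∃[ w′ ] (c ≡ sAnd ⊎ c ≡ sOr) × w ≡ c ∷ encode ψ ++ sRp ∷ w′ × Rest g w′
Rest (sRp ∷ g)  w = ∃[ w′ ] w ≡ sRp ∷ w′ × Rest g w′
Rest (sLp ∷ g)  w = ∃[ xs ] ∃[ w′ ] w ≡ encList xs ++ w′ × Rest g w′
Rest (_ ∷ g)    w = ⊥

Form Digits : List Sym → List Sym → Set
Form g w   = ∃[ φ ] ∃[ w′ ] w ≡ encode φ ++ w′ × Rest g w′
Digits g w = ∃[ b ] ∃[ w′ ] w ≡ encBin b ++ w′ × Rest g w′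

-- The remainder of a list, inside (true) or outside (false) a name.
Items : Bool → (ℕ → List Sym → Set) → List Sym → Set
Items b K w = ∃[ β ] ∃[ s ] ∃[ w′ ] (b ≡ false → β ≡ zeroᵇ) × w ≡ encBin β ++ (names s ++ sRp ∷ w′) × K (length s) w′

-- What follows a formula never starts with a digit, so the greedy reading of a name is the only
-- possible one.
rest-¬D1 : ∀ g {w} → ¬ Rest g (sD1 ∷ w)
rest-¬D1 (sAnd ∷ g) (_ , _ , _ , inj₁ () , refl , _)
rest-¬D1 (sAnd ∷ g) (_ , _ , _ , inj₂ () , refl , _)

rest-¬D2 : ∀ g {w} → ¬ Rest g (sD2 ∷ w)
rest-¬D2 (sAnd ∷ g) (_ , _ , _ , inj₁ () , refl , _)
rest-¬D2 (sAnd ∷ g) (_ , _ , _ , inj₂ () , refl , _)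

digits-D1 : ∀ g {w} → Digits g (sD1 ∷ w) → Digits g w
digits-D1 g (zeroᵇ , w′ , refl , r) = contradiction r (rest-¬D1 g)
digits-D1 g (1+[2 b ] , w′ , refl , r) = b , w′ , refl , r

digits-D2 : ∀ g {w} → Digits g (sD2 ∷ w) → Digits g w
digits-D2 g (zeroᵇ , w′ , refl , r) = contradiction r (rest-¬D2 g)
digits-D2 g (2[1+ b ] , w′ , refl , r) = b , w′ , refl , r

digits-other : ∀ {g w} → Stop w → Digits g w → Rest g w
digits-other p (zeroᵇ , w′ , refl , r) = r
digits-other () (1+[2 b ] , w′ , refl , r)
digits-other () (2[1+ b ] , w′ , refl , r)

items-[] : ∀ {b K} → ¬ Items b K []
items-[] (zeroᵇ , [] , _ , _ , () , _)
items-[] (zeroᵇ , _ ∷ _ , _ , _ , () , _)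

items-sRp : ∀ {b K w} → Items b K (sRp ∷ w) → K 0 w
items-sRp (zeroᵇ , [] , _ , _ , refl , k) = k

items-sVar : ∀ {b K w} → Items b K (sVar ∷ w) → Items true (λ k → K (suc k)) w
items-sVar (zeroᵇ , β ∷ s , w′ , _ , refl , k) = β , s , w′ , (λ ()) , List.++-assoc (encBin β) (names s) (sRp ∷ w′) , k

sVar-items : ∀ {b K w} → Items true (λ k → K (suc k)) w → Items b K (sVar ∷ w)
sVar-items (β , s , w′ , _ , refl , k) =
  zeroᵇ , β ∷ s , w′ , (λ _ → refl) , cong (sVar ∷_) (sym (List.++-assoc (encBin β) (names s) (sRp ∷ w′))) , k

items-D1 : ∀ {b K w} → Items b K (sD1 ∷ w) → b ≡ true × Items true K w
items-D1 {true} (1+[2 β ] , s , w′ , _ , refl , k) = refl , β , s , w′ , (λ ()) , refl , k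
items-D1 {false} (1+[2 β ] , s , w′ , e , refl , k) with () ← e refl
items-D1 (zeroᵇ , [] , _ , _ , () , k)
items-D1 (zeroᵇ , _ ∷ _ , _ , _ , () , k)

items-D2 : ∀ {b K w} → Items b K (sD2 ∷ w) → b ≡ true × Items true K w
items-D2 {true} (2[1+ β ] , s , w′ , _ , refl , k) = refl , β , s , w′ , (λ ()) , refl , k
items-D2 {false} (2[1+ β ] , s , w′ , e , refl , k) with () ← e refl
items-D2 (zeroᵇ , [] , _ , _ , () , k)
items-D2 (zeroᵇ , _ ∷ _ , _ , _ , () , k)

D1-items : ∀ {K w} → Items true K w → Items true K (sD1 ∷ w)
D1-items (β , s , w′ , _ , refl , k) = 1+[2 β ] , s , w′ , (λ ()) , refl , k

D2-items : ∀ {K w} → Items true K w → Items true K (sD2 ∷ w)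
D2-items (β , s , w′ , _ , refl , k) = 2[1+ β ] , s , w′ , (λ ()) , refl , k

data ItemSym : Sym → Set where
  sVar : ItemSym sVar
  sD1  : ItemSym sD1
  sD2  : ItemSym sD2
  sRp  : ItemSym sRp

items-first : ∀ {b K x w} → Items b K (x ∷ w) → ItemSym x
items-first (zeroᵇ , [] , _ , _ , refl , _)    = sRp
items-first (zeroᵇ , _ ∷ _ , _ , _ , refl , _) = sVar
items-first (1+[2 _ ] , _ , _ , _ , refl , _)  = sD1
items-first (2[1+ _ ] , _ , _ , _ , refl , _)  = sD2

data FormSym : Sym → Set where
  sVar   : FormSym sVar
  sNeg   : FormSym sNeg
  sLp    : FormSym sLp
  sIndep : FormSym sIndep
  sIncl  : FormSym sIncl
  sTilde : FormSym sTilde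

form-first : ∀ {g x w} → Form g (x ∷ w) → FormSym x
form-first (atom _ , _ , refl , _)      = sVar
form-first (natom _ , _ , refl , _)     = sNeg
form-first (_ ∧ᶠ _ , _ , refl , _)      = sLp
form-first (_ ∨ᶠ _ , _ , refl , _)      = sLp
form-first (indep _ _ _ , _ , refl , _) = sIndep
form-first (incl _ _ , _ , refl , _)    = sIncl
form-first (∼ _ , _ , refl , _)         = sTilde

form-[] : ∀ {g} → ¬ Form g []
form-[] (atom _ , _ , () , _)
form-[] (natom _ , _ , () , _)
form-[] (_ ∧ᶠ _ , _ , () , _)
form-[] (_ ∨ᶠ _ , _ , () , _)
form-[] (indep _ _ _ , _ , () , _)
form-[] (incl _ _ , _ , () , _)
form-[] (∼ _ , _ , () , _)

-- `ℕᵇ` is bijective binary notation with digits 1 and 2, so every word of digits, the empty one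
-- included, is the name of exactly one variable, and the parser has no leading zeros to reject.
encVars-toℕ : ∀ s → encVars (map toℕ s) ≡ names s
encVars-toℕ []      = refl
encVars-toℕ (b ∷ s) rewrite ℕᵇ.fromℕ-toℕ b = cong (λ z → sVar ∷ encBin b ++ z) (encVars-toℕ s)

encVars-toBin : ∀ xs → encVars xs ≡ names (map toBin xs)
encVars-toBin []       = refl
encVars-toBin (x ∷ xs) = cong (λ z → sVar ∷ encBin (toBin x) ++ z) (encVars-toBin xs)

form-sVar : ∀ {g w} → Form g (sVar ∷ w) → Digits g w
form-sVar (atom p , w′ , refl , r) = toBin p , w′ , refl , r

sVar-form : ∀ {g w} → Digits g w → Form g (sVar ∷ w)
sVar-form (b , w′ , refl , r) = atom (toℕ b) , w′ , cong (λ z → sVar ∷ encBin z ++ w′) (sym (ℕᵇ.fromℕ-toℕ b)) , r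

form-sNeg : ∀ {g w} → Form g (sNeg ∷ w) → ∃[ w′ ] w ≡ sVar ∷ w′ × Digits g w′
form-sNeg (natom p , w′ , refl , r) = _ , refl , toBin p , w′ , refl , r

sNeg-form : ∀ {g w} → Digits g w → Form g (sNeg ∷ sVar ∷ w)
sNeg-form (b , w′ , refl , r) = natom (toℕ b) , w′ , cong (λ z → sNeg ∷ sVar ∷ encBin z ++ w′) (sym (ℕᵇ.fromℕ-toℕ b)) , r

form-sTilde : ∀ {g w} → Form g (sTilde ∷ w) → Form g w
form-sTilde (∼ φ , w′ , refl , r) = φ , w′ , refl , r

sTilde-form : ∀ {g w} → Form g w → Form g (sTilde ∷ w)
sTilde-form (φ , w′ , refl , r) = ∼ φ , w′ , refl , r

form-sLp : ∀ {g w} → Form g (sLp ∷ w) → Form (sAnd ∷ g) w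
form-sLp (φ ∧ᶠ ψ , w′ , refl , r) = φ , _ , binary-++ φ ψ sAnd w′ , sAnd , ψ , w′ , inj₁ refl , refl , r
form-sLp (φ ∨ᶠ ψ , w′ , refl , r) = φ , _ , binary-++ φ ψ sOr w′ , sOr , ψ , w′ , inj₂ refl , refl , r

sLp-form : ∀ {g w} → Form (sAnd ∷ g) w → Form g (sLp ∷ w)
sLp-form (φ , _ , refl , _ , ψ , w′ , inj₁ refl , refl , r) = φ ∧ᶠ ψ , w′ , cong (sLp ∷_) (sym (binary-++ φ ψ sAnd w′)) , r
sLp-form (φ , _ , refl , _ , ψ , w′ , inj₂ refl , refl , r) = φ ∨ᶠ ψ , w′ , cong (sLp ∷_) (sym (binary-++ φ ψ sOr w′)) , r

rest-sAnd : ∀ {g x w} → Rest (sAnd ∷ g) (x ∷ w) → (x ≡ sAnd ⊎ x ≡ sOr) × Form (sRp ∷ g) w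
rest-sAnd (_ , ψ , w′ , c , refl , r) = c , ψ , _ , refl , w′ , refl , r

sAnd-rest : ∀ {g x w} → (x ≡ sAnd ⊎ x ≡ sOr) → Form (sRp ∷ g) w → Rest (sAnd ∷ g) (x ∷ w)
sAnd-rest c (ψ , _ , refl , w′ , refl , r) = _ , ψ , w′ , c , refl , r

three-++ : ∀ (u v x y : List Sym) → (u ++ (v ++ x)) ++ y ≡ u ++ (v ++ (x ++ y))
three-++ u v x y = trans (List.++-assoc u (v ++ x) y) (cong (u ++_) (List.++-assoc v x y))

form-sIndep : ∀ {g w} → Form g (sIndep ∷ w) → Rest (sLp ∷ sLp ∷ sLp ∷ g) w
form-sIndep (indep ps qs rs , w′ , refl , r) =
  qs , _ , three-++ (encList qs) (encList ps) (encList rs) w′ , ps , _ , refl , rs , w′ , refl , r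

sIndep-form : ∀ {g w} → Rest (sLp ∷ sLp ∷ sLp ∷ g) w → Form g (sIndep ∷ w)
sIndep-form (qs , _ , refl , ps , _ , refl , rs , w′ , refl , r) =
  indep ps qs rs , w′ , cong (sIndep ∷_) (sym (three-++ (encList qs) (encList ps) (encList rs) w′)) , r

rest-sLp : ∀ {g x w} → Rest (sLp ∷ g) (x ∷ w) → x ≡ sLp × Items false (λ _ → Rest g) w
rest-sLp (xs , w′ , refl , r) = refl , zeroᵇ , map toBin xs , w′ , (λ _ → refl) ,
  trans (List.++-assoc (encVars xs) (sRp ∷ []) w′) (cong (_++ sRp ∷ w′) (encVars-toBin xs)) , r

sLp-rest : ∀ {g w} → Items false (λ _ → Rest g) w → Rest (sLp ∷ g) (sLp ∷ w)
sLp-rest (β , s , w′ , e , refl , r) rewrite e refl = map toℕ s , w′ ,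
  cong (sLp ∷_) (trans (cong (_++ sRp ∷ w′) (sym (encVars-toℕ s))) (sym (List.++-assoc (encVars (map toℕ s)) (sRp ∷ []) w′))) , r

-- After n names: the rest of the first list, then a second one of the same length.
Counting : List Sym → ℕ → ℕ → List Sym → Set
Counting g n k w = ∃[ w′ ] w ≡ sLp ∷ w′ × Items false (λ k′ w″ → k′ ≡ k + n × Rest g w″) w′

form-sIncl : ∀ {g w} → Form g (sIncl ∷ w) → ∃[ w′ ] w ≡ sLp ∷ w′ × Items false (Counting g 0) w′
form-sIncl {g} (incl {k} ps qs , w′ , refl , r) = _ , refl ,
  zeroᵇ , map toBin (Vec.toList ps) , _ , (λ _ → refl) ,
  trans (cong (_++ w′) (List.++-assoc (encVars (Vec.toList ps)) (sRp ∷ []) _))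
    (trans (List.++-assoc (encVars (Vec.toList ps)) (sRp ∷ encList (Vec.toList qs)) w′)
           (cong (_++ sRp ∷ encList (Vec.toList qs) ++ w′) (encVars-toBin (Vec.toList ps)))) ,
  _ , refl , zeroᵇ , map toBin (Vec.toList qs) , w′ , (λ _ → refl) ,
  trans (List.++-assoc (encVars (Vec.toList qs)) (sRp ∷ []) w′) (cong (_++ sRp ∷ w′) (encVars-toBin (Vec.toList qs))) ,
  trans (size qs) (trans (sym (size ps)) (sym (+-identityʳ _))) , r
  where
  size : ∀ (xs : Vec ℕ k) → length (map toBin (Vec.toList xs)) ≡ k
  size xs = trans (List.length-map toBin (Vec.toList xs)) (Vec.length-toList xs)

sIncl-form : ∀ {g w} → Items false (Counting g 0) w → Form g (sIncl ∷ sLp ∷ w)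
sIncl-form {g} (β , s , _ , e , refl , _ , refl , β′ , s′ , w′ , e′ , refl , l , r) rewrite e refl | e′ refl =
  incl (subst (Vec ℕ) eq (Vec.fromList (map toℕ s))) (Vec.fromList (map toℕ s′)) , w′ ,
  cong (λ z → sIncl ∷ sLp ∷ z)
    (trans (cong (names s ++_) (cong (λ z → sRp ∷ sLp ∷ z) (listed s′ w′)))
      (trans (listed s (encList (map toℕ s′) ++ w′))
        (trans (sym (List.++-assoc (encVars (map toℕ s) ++ sRp ∷ []) (encList (map toℕ s′)) w′))
          (cong₂ (λ y z → ((encVars y ++ sRp ∷ []) ++ encList z) ++ w′) (sym (toList-subst eq)) (sym (Vec.toList∘fromList (map toℕ s′))))))) , r
  where
  eq : length (map toℕ s) ≡ length (map toℕ s′)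
  eq = trans (List.length-map toℕ s) (trans (sym (trans l (+-identityʳ (length s)))) (sym (List.length-map toℕ s′)))
  listed : ∀ s w → names s ++ sRp ∷ w ≡ (encVars (map toℕ s) ++ sRp ∷ []) ++ w
  listed s w = trans (cong (_++ sRp ∷ w) (sym (encVars-toℕ s))) (sym (List.++-assoc (encVars (map toℕ s)) (sRp ∷ []) w))
  toList-subst : ∀ {n} (eq : length (map toℕ s) ≡ n) → Vec.toList (subst (Vec ℕ) eq (Vec.fromList (map toℕ s))) ≡ map toℕ s
  toList-subst refl = Vec.toList∘fromList (map toℕ s)

-- Values of the parser

never : ¬ V → Val (suc n) 0 lose σ V
never ¬v = v-≤ (s≤s z≤n) (v-map ⊥-elim ¬v v-lose)

on-val : ∀ {V : Sym → Set} {d : Sym → Prog} y → Val n 0 c σ (V y) → (∀ {x} → x ≢ y → Val n 0 (d x) σ (V x)) →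
         ∀ x → Val n 0 ((on y then c else d x) (just x)) σ (V x)
on-val y v f x with x ≟ˢ y
... | yes refl = v
... | no ne    = f ne

listK-val : ∀ {b K w} → Val (suc n) 0 c σ (Items true K w) → Val (suc n) 0 d σ (Items true (λ k → K (suc k)) w) →
            Val (suc n) 0 e σ (K 0 w) → ∀ x → Val (suc n) 0 (listK c d e b (just x)) σ (Items b K (x ∷ w))
listK-val {b = true} {K} v₁ v₂ v₃ sD1 = v-map (D1-items {K}) (proj₂ ∘ items-D1 {true} {K}) v₁
listK-val {b = true} {K} v₁ v₂ v₃ sD2 = v-map (D2-items {K}) (proj₂ ∘ items-D2 {true} {K}) v₁
listK-val {b = false} {K} v₁ v₂ v₃ sD1 = never (λ i → case proj₁ (items-D1 {false} {K} i) of λ ())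
listK-val {b = false} {K} v₁ v₂ v₃ sD2 = never (λ i → case proj₁ (items-D2 {false} {K} i) of λ ())
listK-val {b = b} {K} v₁ v₂ v₃ sVar = v-map (sVar-items {b} {K}) (items-sVar {b} {K}) v₂
listK-val {b = b} {K} v₁ v₂ v₃ sRp = v-map (λ k → zeroᵇ , [] , _ , (λ _ → refl) , refl , k) (items-sRp {b} {K}) v₃
listK-val {b = b} {K} v₁ v₂ v₃ sNeg = never (λ i → case items-first {b} {K} i of λ ())
listK-val {b = b} {K} v₁ v₂ v₃ sAnd = never (λ i → case items-first {b} {K} i of λ ())
listK-val {b = b} {K} v₁ v₂ v₃ sOr = never (λ i → case items-first {b} {K} i of λ ())
listK-val {b = b} {K} v₁ v₂ v₃ sLp = never (λ i → case items-first {b} {K} i of λ ())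
listK-val {b = b} {K} v₁ v₂ v₃ sIndep = never (λ i → case items-first {b} {K} i of λ ())
listK-val {b = b} {K} v₁ v₂ v₃ sIncl = never (λ i → case items-first {b} {K} i of λ ())
listK-val {b = b} {K} v₁ v₂ v₃ sTilde = never (λ i → case items-first {b} {K} i of λ ())

-- A uniform allowance of eight steps per symbol and eight more for the end of the word. The
-- costliest single symbol for `formula` is `sIndep`, with five steps.
budget : List Sym → ℕ
budget []      = 8
budget (_ ∷ w) = 8 + budget w

1≤budget : ∀ w → ∃[ n ] budget w ≡ suc n
1≤budget []      = 7 , refl
1≤budget (_ ∷ w) = 7 + budget w , refl

-- The parser's stores: input w, expectations g, and n counted names.
P : List Sym → List Sym → ℕ → Store 8
P w g n = S w [] [] (List.replicate n sVar) g none₃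

never-b : ∀ w k → ¬ V → Val (k + budget w) 0 lose σ V
never-b w k ¬v with m , e ← 1≤budget w rewrite e | +-suc k m = never ¬v

charge : ∀ k {_ : T (k ≤ᵇ 8)} w → Val (k + budget w) 0 c σ V → Val (8 + budget w) 0 c σ V
charge k {p} w = v-≤ (+-monoˡ-≤ (budget w) (≤ᵇ⇒≤ k 8 p))

list-val : ∀ l K {b w g k} → prog l ≡ pop fm (listK c d e b) →
           Val (6 + budget w) 0 c (P w g k) (Items true K w) →
           Val (6 + budget w) 0 d (P w g k) (Items true (λ k → K (suc k)) w) →
           Val (6 + budget w) 0 e (P w g k) (K 0 w) →
           ∀ x → Val (8 + budget w) 0 (goto l) (P (x ∷ w) g k) (Items b K (x ∷ w))
list-val l K eq v₁ v₂ v₃ x = v-goto (v-code (sym eq) (v-pop {i = fm} (listK-val {K = K} v₁ v₂ v₃ x)))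

list-[] : ∀ l K {b g k} → prog l ≡ pop fm (listK c d e b) → listK c d e b nothing ≡ lose →
          Val 8 0 (goto l) (P [] g k) (Items b K [])
list-[] l K {b} eq eq′ = v-goto (v-code (sym eq) (v-pop {i = fm} (v-code (sym eq′) (never (items-[] {b} {K})))))

end-val : ∀ g → Val 2 0 (closeK nothing) (P [] g 0) (Rest g [])
end-val [] = v-pop {i = gm} (v-map (λ _ → refl) (λ _ → tt) v-win)
end-val (sVar ∷ g) = v-pop {i = gm} (never λ ())
end-val (sD1 ∷ g) = v-pop {i = gm} (never λ ())
end-val (sD2 ∷ g) = v-pop {i = gm} (never λ ())
end-val (sNeg ∷ g) = v-pop {i = gm} (never λ ())
end-val (sOr ∷ g) = v-pop {i = gm} (never λ ())
end-val (sIndep ∷ g) = v-pop {i = gm} (never λ ())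
end-val (sIncl ∷ g) = v-pop {i = gm} (never λ ())
end-val (sTilde ∷ g) = v-pop {i = gm} (never λ ())
end-val (sAnd ∷ g) = v-pop {i = gm} (never λ { (_ , _ , _ , _ , () , _) })
end-val (sRp ∷ g) = v-pop {i = gm} (never λ { (_ , () , _) })
end-val (sLp ∷ g) = v-pop {i = gm} (never λ { (_ , _ , () , _) })

finish : ∀ {g w x} → Stop (x ∷ w) → Val (2 + budget w) 0 (closeK (just x)) (P w g 0) (Rest g (x ∷ w)) →
         Val (8 + budget w) 0 (goto digits) (P (x ∷ w) g 0) (Digits g (x ∷ w))
finish {g} {w} {x} p v = charge 4 w (v-goto (v-pop {i = fm} (v-code (sym (ends p))
  (v-map (λ r → zeroᵇ , _ , refl , r) (digits-other {g} p) v))))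
  where
  ends : ∀ {l y} → Ends l → digitsL l y ≡ closeK y
  ends mark  = refl
  ends other = refl

Matching : List Sym → ℕ → ℕ → List Sym → Set
Matching g k k′ w = k′ ≡ k × Rest g w

items-map : ∀ {b K K′ w} → (∀ {k w} → K k w → K′ k w) → Items b K w → Items b K′ w
items-map f (β , s , w′ , e , e′ , k) = β , s , w′ , e , e′ , f k

counting⁺ : ∀ g n {k w} → Counting g n (suc k) w → Counting g (suc n) k w
counting⁺ g n {k} (w′ , e , i) = w′ , e , items-map {K = λ k′ w → k′ ≡ suc k + n × Rest g w} {λ k′ w → k′ ≡ k + suc n × Rest g w} (λ { (refl , r) → sym (+-suc k n) , r }) i

counting⁻ : ∀ g n {k w} → Counting g (suc n) k w → Counting g n (suc k) w
counting⁻ g n {k} (w′ , e , i) = w′ , e , items-map {K = λ k′ w → k′ ≡ k + suc n × Rest g w} {λ k′ w → k′ ≡ suc k + n × Rest g w} (λ { (refl , r) → +-suc k n , r }) i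

mutual

  formula-val : ∀ w g → Val (budget w) 0 (goto formula) (P w g 0) (Form g w)
  formula-val [] g = v-goto (v-pop {i = fm} (never (form-[] {g})))
  formula-val (sVar ∷ w) g = charge 2 w (v-goto (v-pop {i = fm} (v-map (sVar-form {g}) (form-sVar {g}) (digits-val w g))))
  formula-val (sNeg ∷ []) g = v-goto (v-pop {i = fm} (v-pop {i = fm} (never λ f → case form-sNeg {g} f of λ ())))
  formula-val (sNeg ∷ x ∷ w) g = charge 3 (x ∷ w) (v-goto (v-pop {i = fm} (v-pop {i = fm}
    (on-val {V = λ x → Form g (sNeg ∷ x ∷ w)} sVar
      (v-≤ (m≤n+m _ 8) (v-map (sNeg-form {g}) (λ f → case form-sNeg {g} f of λ { (_ , refl , d) → d }) (digits-val w g)))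
      (λ ne → never-b w 8 λ f → case form-sNeg {g} f of λ { (_ , refl , _) → ne refl }) x))))
  formula-val (sLp ∷ w) g = charge 3 w (v-goto (v-pop {i = fm} (v-push {i = gm}
    (v-map (sLp-form {g}) (form-sLp {g}) (formula-val w (sAnd ∷ g))))))
  formula-val (sTilde ∷ w) g = charge 2 w (v-goto (v-pop {i = fm} (v-map (sTilde-form {g}) (form-sTilde {g}) (formula-val w g))))
  formula-val (sIndep ∷ w) g = charge 5 w (v-goto (v-pop {i = fm} (v-push {i = gm} (v-push {i = gm} (v-push {i = gm}
    (v-map (sIndep-form {g}) (form-sIndep {g}) (close-val w (sLp ∷ sLp ∷ sLp ∷ g))))))))
  formula-val (sIncl ∷ []) g = v-goto (v-pop {i = fm} (v-pop {i = fm} (never λ f → case form-sIncl {g} f of λ ())))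
  formula-val (sIncl ∷ x ∷ w) g = charge 3 (x ∷ w) (v-goto (v-pop {i = fm} (v-pop {i = fm}
    (on-val {V = λ x → Form g (sIncl ∷ x ∷ w)} sLp
      (v-≤ (m≤n+m _ 8) (v-map (sIncl-form {g}) (λ f → case form-sIncl {g} f of λ { (_ , refl , i) → i }) (count-val false w g 0)))
      (λ ne → never-b w 8 λ f → case form-sIncl {g} f of λ { (_ , refl , _) → ne refl }) x))))
  formula-val (sD1 ∷ w) g = v-goto (v-pop {i = fm} (never λ f → case form-first {g} f of λ ()))
  formula-val (sD2 ∷ w) g = v-goto (v-pop {i = fm} (never λ f → case form-first {g} f of λ ()))
  formula-val (sAnd ∷ w) g = v-goto (v-pop {i = fm} (never λ f → case form-first {g} f of λ ()))
  formula-val (sOr ∷ w) g = v-goto (v-pop {i = fm} (never λ f → case form-first {g} f of λ ()))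
  formula-val (sRp ∷ w) g = v-goto (v-pop {i = fm} (never λ f → case form-first {g} f of λ ()))

  digits-val : ∀ w g → Val (budget w) 0 (goto digits) (P w g 0) (Digits g w)
  digits-val [] g = v-goto (v-pop {i = fm} (v-map (λ r → zeroᵇ , [] , refl , r) (digits-other {g} other)
    (v-≤ (s≤s (s≤s z≤n)) (end-val g))))
  digits-val (sD1 ∷ w) g = charge 2 w (v-goto (v-pop {i = fm} (v-map
    (λ { (b , w′ , refl , r) → 1+[2 b ] , w′ , refl , r }) (digits-D1 g) (digits-val w g))))
  digits-val (sD2 ∷ w) g = charge 2 w (v-goto (v-pop {i = fm} (v-map
    (λ { (b , w′ , refl , r) → 2[1+ b ] , w′ , refl , r }) (digits-D2 g) (digits-val w g))))
  digits-val (sVar ∷ w) g = finish mark (after-val sVar w g)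
  digits-val (sNeg ∷ w) g = finish other (after-val sNeg w g)
  digits-val (sAnd ∷ w) g = finish other (after-val sAnd w g)
  digits-val (sOr ∷ w) g = finish other (after-val sOr w g)
  digits-val (sLp ∷ w) g = finish other (after-val sLp w g)
  digits-val (sRp ∷ w) g = finish other (after-val sRp w g)
  digits-val (sIndep ∷ w) g = finish other (after-val sIndep w g)
  digits-val (sIncl ∷ w) g = finish other (after-val sIncl w g)
  digits-val (sTilde ∷ w) g = finish other (after-val sTilde w g)

  close-val : ∀ w g → Val (budget w) 0 (goto close) (P w g 0) (Rest g w)
  close-val []      g = v-goto (v-pop {i = fm} (v-≤ (s≤s (s≤s z≤n)) (end-val g)))
  close-val (x ∷ w) g = charge 4 w (v-goto (v-pop {i = fm} (after-val x w g)))

  after-val : ∀ x w g → Val (2 + budget w) 0 (closeK (just x)) (P w g 0) (Rest g (x ∷ w))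
  after-val x w [] = v-pop {i = gm} (never λ ())
  after-val x w (sAnd ∷ g) = v-pop {i = gm} (on-val {V = λ x → Rest (sAnd ∷ g) (x ∷ w)} sAnd
    (v-push {i = gm} (v-map (sAnd-rest {g} (inj₁ refl)) (proj₂ ∘ rest-sAnd {g}) (formula-val w (sRp ∷ g))))
    (λ {y} → or-else y) x)
    where
    or-else : ∀ y → y ≢ sAnd → Val (1 + budget w) 0
                ((on sOr then push gm sRp (goto formula) else lose) (just y)) (P w g 0) (Rest (sAnd ∷ g) (y ∷ w))
    or-else y ne with y ≟ˢ sOr
    ... | yes refl = v-push {i = gm} (v-map (sAnd-rest {g} (inj₂ refl)) (proj₂ ∘ rest-sAnd {g}) (formula-val w (sRp ∷ g)))
    ... | no ne′   = never λ r → case proj₁ (rest-sAnd {g} r) of λ { (inj₁ e) → ne e ; (inj₂ e) → ne′ e }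
  after-val x w (sRp ∷ g) = v-pop {i = gm} (on-val {V = λ x → Rest (sRp ∷ g) (x ∷ w)} sRp
    (v-≤ (n≤1+n _) (v-map (λ r → w , refl , r) (λ { (_ , refl , r) → r }) (close-val w g)))
    (λ ne → never λ { (_ , refl , _) → ne refl }) x)
  after-val x w (sLp ∷ g) = v-pop {i = gm} (on-val {V = λ x → Rest (sLp ∷ g) (x ∷ w)} sLp
    (v-≤ (n≤1+n _) (v-map (sLp-rest {g}) (proj₂ ∘ rest-sLp {g}) (items-val false w g)))
    (λ ne → never λ r → ne (proj₁ (rest-sLp {g} r))) x)
  after-val x w (sVar ∷ g) = v-pop {i = gm} (never λ ())
  after-val x w (sD1 ∷ g) = v-pop {i = gm} (never λ ())
  after-val x w (sD2 ∷ g) = v-pop {i = gm} (never λ ())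
  after-val x w (sNeg ∷ g) = v-pop {i = gm} (never λ ())
  after-val x w (sOr ∷ g) = v-pop {i = gm} (never λ ())
  after-val x w (sIndep ∷ g) = v-pop {i = gm} (never λ ())
  after-val x w (sIncl ∷ g) = v-pop {i = gm} (never λ ())
  after-val x w (sTilde ∷ g) = v-pop {i = gm} (never λ ())

  items-val : ∀ b w g → Val (budget w) 0 (goto (items b)) (P w g 0) (Items b (λ _ → Rest g) w)
  items-val true  [] g = list-[] (items true) (λ _ → Rest g) refl refl
  items-val false [] g = list-[] (items false) (λ _ → Rest g) refl refl
  items-val b (x ∷ w) g = list-val (items b) (λ _ → Rest g) refl
    (v-≤ (m≤n+m _ 6) (items-val true w g)) (v-≤ (m≤n+m _ 6) (items-val true w g)) (v-≤ (m≤n+m _ 6) (close-val w g)) x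

  count-val : ∀ b w g k → Val (budget w) 0 (goto (count b)) (P w g k) (Items b (Counting g k) w)
  count-val true  [] g k = list-[] (count true) (Counting g k) refl refl
  count-val false [] g k = list-[] (count false) (Counting g k) refl refl
  count-val b (x ∷ w) g k = list-val (count b) (Counting g k) refl
    (v-≤ (m≤n+m _ 6) (count-val true w g k))
    (v-≤ (m≤n+m _ 5) (v-push {i = ct} (v-map (items-map {K = Counting g (suc k)} {λ k′ → Counting g k (suc k′)} (counting⁻ g k))
      (items-map {K = λ k′ → Counting g k (suc k′)} {Counting g (suc k)} (counting⁺ g k)) (count-val true w g (suc k)))))
    (v-pop {i = fm} (open-val w)) x
    where
    open-val : ∀ w → Val (5 + budget w) 0 ((on sLp then goto (uncount false) else lose) (head w)) (P (drop 1 w) g k) (Counting g k 0 w)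
    open-val [] = never λ ()
    open-val (y ∷ w) = on-val {V = λ y → Counting g k 0 (y ∷ w)} sLp
      (v-≤ (m≤n+m _ 13) (v-map (λ i → w , refl , i) (λ { (_ , refl , i) → i }) (uncount-val false w g k)))
      (λ ne → never λ { (_ , refl , _) → ne refl }) y

  uncount-val : ∀ b w g k → Val (budget w) 0 (goto (uncount b)) (P w g k) (Items b (Matching g k) w)
  uncount-val true  [] g k = list-[] (uncount true) (Matching g k) refl refl
  uncount-val false [] g k = list-[] (uncount false) (Matching g k) refl refl
  uncount-val b (x ∷ w) g k = list-val (uncount b) (Matching g k) refl
    (v-≤ (m≤n+m _ 6) (uncount-val true w g k))
    (v-≤ (m≤n+m _ 5) (v-pop {i = ct} (name-val k)))
    (v-≤ (m≤n+m _ 5) (v-pop {i = ct} (end-list k))) x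
    where
    name-val : ∀ k → Val (budget w) 0 (uncountV (head (List.replicate k sVar))) (S w [] [] (drop 1 (List.replicate k sVar)) g none₃)
                 (Items true (λ k′ → Matching g k (suc k′)) w)
    name-val zero    = never-b w 0 λ { (_ , _ , _ , _ , _ , () , _) }
    name-val (suc k) = v-map (items-map {K = Matching g k} {λ k′ → Matching g (suc k) (suc k′)} λ { (refl , r) → refl , r })
      (items-map {K = λ k′ → Matching g (suc k) (suc k′)} {Matching g k} λ { (refl , r) → refl , r }) (uncount-val true w g k)
    end-list : ∀ k → Val (budget w) 0 (uncountR (head (List.replicate k sVar))) (S w [] [] (drop 1 (List.replicate k sVar)) g none₃)
                 (0 ≡ k × Rest g w)
    end-list zero    = v-map (λ r → refl , r) proj₂ (close-val w g)
    end-list (suc k) = never-b w 0 λ { (() , _) }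

-- Small teams, and resource bounds

subsets : List ℕ → List Block
subsets []       = [] ∷ []
subsets (x ∷ xs) = map (toBin x ∷_) (subsets xs) ++ subsets xs

trues : Assignment → List ℕ → Block
trues s []       = []
trues s (x ∷ xs) = if s x then toBin x ∷ trues s xs else trues s xs

trues-∈ : ∀ s xs → trues s xs ∈ subsets xs
trues-∈ s []       = here refl
trues-∈ s (x ∷ xs) with s x
... | true  = ∈-++⁺ˡ (∈-map⁺ (toBin x ∷_) (trues-∈ s xs))
... | false = ∈-++⁺ʳ (map (toBin x ∷_) (subsets xs)) (trues-∈ s xs)

toBin-injective : ∀ {x y} → toBin x ≡ toBin y → x ≡ y
toBin-injective {x} {y} e = trans (sym (ℕᵇ.toℕ-fromℕ x))
  (trans (cong toℕ e) (ℕᵇ.toℕ-fromℕ y))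

∈-trues⁺ : ∀ s xs {x} → x ∈ xs → s x ≡ true → toBin x ∈ trues s xs
∈-trues⁺ s (x ∷ xs) (here refl) e rewrite e = here refl
∈-trues⁺ s (x ∷ xs) (there p) e with s x
... | true  = there (∈-trues⁺ s xs p e)
... | false = ∈-trues⁺ s xs p e

∈-trues⁻ : ∀ s xs {x} → toBin x ∈ trues s xs → s x ≡ true
∈-trues⁻ s (y ∷ xs) p with s y in e
∈-trues⁻ s (y ∷ xs) (here q)  | true  = trans (cong s (toBin-injective q)) e
∈-trues⁻ s (y ∷ xs) (there p) | true  = ∈-trues⁻ s xs p
∈-trues⁻ s (y ∷ xs) p         | false = ∈-trues⁻ s xs p

asg-trues : ∀ s xs → asg (trues s xs) [ xs ]≐ s [ xs ]
asg-trues s xs = ≐-pointwise xs value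
  where
  value : ∀ {x} → x ∈ xs → asg (trues s xs) x ≡ s x
  value {x} p with s x in e
  ... | true  = asg-true (trues s xs) x (∈-trues⁺ s xs p e)
  ... | false = asg-false (trues s xs) x (λ q → case trans (sym e) (∈-trues⁻ s xs q) of λ ())

size-subsets : ∀ xs → All (λ b → ∥ b ∥ ≤ ∥ xs ∥ᵛ) (subsets xs)
size-subsets []       = z≤n ∷ []
size-subsets (x ∷ xs) = All.++⁺
  (All.map⁺ (All.map (λ p → s≤s (+-monoʳ-≤ ∣ toBin x ∣ᵇ p)) (size-subsets xs)))
  (All.map (λ p → ≤-trans p (m≤n+m _ (suc ∣ toBin x ∣ᵇ))) (size-subsets xs))

length-subsets : ∀ xs → length (subsets xs) ≡ 2 ^ length xs
length-subsets []       = refl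
length-subsets (x ∷ xs) = trans (List.length-++ (map (toBin x ∷_) (subsets xs)))
  (cong₂ _+_ (trans (List.length-map _ (subsets xs)) (length-subsets xs)) (trans (length-subsets xs) (sym (+-identityʳ _))))

size-bound : ∀ {m X} → All (λ b → ∥ b ∥ ≤ m) X → ∥ X ∥ᵗ ≤ length X * (2 + m)
size-bound []       = z≤n
size-bound (p ∷ ps) = +-mono-≤ (s≤s (s≤s p)) (size-bound ps)

length-vars : ∀ φ → length (vars φ) ≤ ∥ vars φ ∥ᵛ
length-vars φ = go (vars φ)
  where
  go : ∀ xs → length xs ≤ ∥ xs ∥ᵛ
  go []       = z≤n
  go (x ∷ xs) = s≤s (≤-trans (go xs) (m≤n+m _ ∣ toBin x ∣ᵇ))

size-vars : ∀ φ → ∥ vars φ ∥ᵛ ≤ length (encode φ)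
size-vars (atom p)  = ≤-reflexive (cong suc (+-identityʳ _))
size-vars (natom p) = ≤-trans (≤-reflexive (cong suc (+-identityʳ _))) (n≤1+n _)
size-vars (φ ∧ᶠ ψ) rewrite size-++ (vars φ) (vars ψ) | length-binary φ ψ sAnd =
  ≤-trans (+-mono-≤ (size-vars φ) (size-vars ψ)) (m≤n+m _ 3)
size-vars (φ ∨ᶠ ψ) rewrite size-++ (vars φ) (vars ψ) | length-binary φ ψ sOr =
  ≤-trans (+-mono-≤ (size-vars φ) (size-vars ψ)) (m≤n+m _ 3)
size-vars (indep ps qs rs) rewrite size-++ ps (qs ++ rs) | size-++ qs rs | length-indep ps qs rs =
  linear (x₀ ⊕ (x₁ ⊕ x₂)) (con 1 ⊕ ((con 2 ⊕ x₁) ⊕ ((con 2 ⊕ x₀) ⊕ (con 2 ⊕ x₂)))) (∥ ps ∥ᵛ ∷ ∥ qs ∥ᵛ ∷ ∥ rs ∥ᵛ ∷ [])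
size-vars (incl ps qs) rewrite size-++ (Vec.toList ps) (Vec.toList qs) | length-incl ps qs =
  linear (x₀ ⊕ x₁) (con 1 ⊕ ((con 2 ⊕ x₀) ⊕ (con 2 ⊕ x₁))) (sizeᵛ ps ∷ sizeᵛ qs ∷ [])
size-vars (∼ φ) = ≤-trans (size-vars φ) (n≤1+n _)

nodes≤length : ∀ φ → nodes φ ≤ length (encode φ)
nodes≤length (atom p)  = s≤s z≤n
nodes≤length (natom p) = s≤s z≤n
nodes≤length (φ ∧ᶠ ψ) rewrite length-binary φ ψ sAnd =
  s≤s (≤-trans (+-mono-≤ (nodes≤length φ) (nodes≤length ψ)) (m≤n+m _ 2))
nodes≤length (φ ∨ᶠ ψ) rewrite length-binary φ ψ sOr =
  s≤s (≤-trans (+-mono-≤ (nodes≤length φ) (nodes≤length ψ)) (m≤n+m _ 2))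
nodes≤length (indep ps qs rs) = s≤s z≤n
nodes≤length (incl ps qs) = s≤s z≤n
nodes≤length (∼ φ) = s≤s (nodes≤length φ)

-- A member of the given team is replaced by the list of those entries of `vars φ` that it makes
-- true, so the candidates are the sublists of `vars φ`. A variable that occurs twice only produces
-- repetitions. `local` then shrinks the domain to `vars φ`.
canonical : ∀ φ → Satisfiable φ → ∃[ X ] ¬ X ≡ [] × ∥ X ∥ᵗ ≤ 2 ^ length (encode φ) * (2 + length (encode φ)) ×
            ⟪ X ⟫ ⊨[ vars φ ] φ
canonical φ (D , vars⊆D , T , T≢[] , h) = X , X≢[] T T≢[] id , size ,
  local φ id (All.lookup vars⊆D) id T⊆X X⊆T h
  where
  E = vars φ
  len = length (encode φ)
  inTeam : ∀ b → Dec (asg b ∈[ E ] T)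
  inTeam b = ∈[]? (asg b) E T
  X = List.filter inTeam (subsets E)
  chosen : ∀ {t} → t ∈ T → trues t E ∈ X
  chosen {t} p = ∈-filter⁺ inTeam (trues-∈ t E) (witness p (asg-trues t E))
  T⊆X : T ⊆[ E ] ⟪ X ⟫
  T⊆X = All.tabulate λ {t} p → witness (∈-map⁺ asg (chosen p)) (≐-sym E E (asg-trues t E))
  X⊆T : ⟪ X ⟫ ⊆[ E ] T
  X⊆T = All.map⁺ (All.tabulate λ p → proj₂ (∈-filter⁻ inTeam {xs = subsets E} p))
  X≢[] : ∀ T′ → ¬ T′ ≡ [] → (∀ {t} → t ∈ T′ → t ∈ T) → ¬ X ≡ []
  X≢[] []       ne f e = ne refl
  X≢[] (t ∷ T′) ne f e with () ← subst (trues t E ∈_) e (chosen (f (here refl)))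
  size : ∥ X ∥ᵗ ≤ 2 ^ len * (2 + len)
  size = ≤-trans (size-bound (All.filter⁺ inTeam (size-subsets E)))
    (*-mono-≤ (≤-trans (List.length-filter inTeam (subsets E)) (≤-trans (≤-reflexive (length-subsets E))
                (^-monoʳ-≤ 2 (≤-trans (length-vars φ) (size-vars φ)))))
              (+-monoʳ-≤ 2 (size-vars φ)))

-- Guessing the team and loading the input

open Semantics prog

G : List Sym → List Sym → Store 8
G w t = S w t [] [] [] none₃

pad : ∀ {n n′ a} c σ → n ≤ n′ → Wins n a true c σ → Wins n′ a true c σ
pad c σ p = Wins-mono true c σ p ≤-refl

-- The guessing loop may go on for ever, so its positions are not described by a `Val`; the two
-- directions are proved apart and for the existential player alone, who is the mover here.
write-digits : ∀ b {w y} → Wins n a true (goto letter) (G w (encBin b ++ y)) →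
               Wins (4 * ∣ b ∣ᵇ + n) a true (goto letter) (G w y)
write-digits zeroᵇ h = h
write-digits {n = n} 2[1+ b ] {w} {y} h = pad (goto letter) (G w y)
  (linear (4 ⊛ x₀ ⊕ (con 4 ⊕ x₁)) (4 ⊛ (con 1 ⊕ x₀) ⊕ x₁) (∣ b ∣ᵇ ∷ n ∷ []))
  (write-digits {n = 4 + n} b (inj₂ (inj₁ h)))
write-digits {n = n} 1+[2 b ] {w} {y} h = pad (goto letter) (G w y)
  (linear (4 ⊛ x₀ ⊕ (con 3 ⊕ x₁)) (4 ⊛ (con 1 ⊕ x₀) ⊕ x₁) (∣ b ∣ᵇ ∷ n ∷ []))
  (write-digits {n = 3 + n} b (inj₁ h))

write-names : ∀ s {w y} → Wins n a true (goto name) (G w (names s ++ y)) →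
              Wins (6 * ∥ s ∥ + n) a true (goto name) (G w y)
write-names [] h = h
write-names {n = n} {a} (b ∷ s) {w} {y} h = pad (goto name) (G w y)
  (linear (6 ⊛ x₁ ⊕ (con 2 ⊕ (4 ⊛ x₀ ⊕ (con 4 ⊕ x₂)))) (6 ⊛ (con 1 ⊕ (x₀ ⊕ x₁)) ⊕ x₂) (∣ b ∣ᵇ ∷ ∥ s ∥ ∷ n ∷ []))
  (write-names {n = 2 + (4 * ∣ b ∣ᵇ + (4 + n))} s (inj₁ (write-digits {n = 4 + n} b (inj₂ (inj₂
    (subst (λ z → Wins n a true (goto name) (G w z)) (names-∷ b s y) h))))))

write-block : ∀ l s X {w} → (l ≡ choose ⊎ l ≡ eval) → Wins n a true (goto l) (G w (team (s ∷ X))) →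
              Wins (6 * ∥ s ∥ + (6 + n)) a true (goto choose) (G w (team X))
write-block {n = n} {a} l s X {w} c h = pad (goto choose) (G w (team X))
  (linear (con 2 ⊕ (6 ⊛ x₀ ⊕ (con 4 ⊕ x₁))) (6 ⊛ x₀ ⊕ (con 6 ⊕ x₁)) (∥ s ∥ ∷ n ∷ []))
  (write-names {n = 4 + n} s {w} {sRp ∷ team X} (inj₂ (last c)))
  where
  h′ : Wins n a true (goto l) (G w (sLp ∷ names s ++ sRp ∷ team X))
  h′ = subst (λ z → Wins n a true (goto l) (G w z)) (team-∷ s X) h
  last : (l ≡ choose ⊎ l ≡ eval) →
         Wins (1 + n) a true (branch (goto choose) (goto eval)) (G w (sLp ∷ names s ++ sRp ∷ team X))
  last (inj₁ refl) = inj₁ h′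
  last (inj₂ refl) = inj₂ h′

write-team : ∀ X {w} → Wins n a true (goto choose) (G w (team X)) → Wins (6 * ∥ X ∥ᵗ + n) a true (goto choose) (G w [])
write-team [] h = h
write-team {n = n} (s ∷ X) {w} h = pad (goto choose) (G w [])
  (linear (6 ⊛ x₁ ⊕ (6 ⊛ x₀ ⊕ (con 6 ⊕ x₂))) (6 ⊛ (con 2 ⊕ x₀ ⊕ x₁) ⊕ x₂) (∥ s ∥ ∷ ∥ X ∥ᵗ ∷ n ∷ []))
  (write-team {n = 6 * ∥ s ∥ + (6 + n)} X (write-block choose s X (inj₁ refl) h))

choose-complete : ∀ X {w} → ¬ X ≡ [] → Wins n a true (goto eval) (G w (team X)) →
                  Wins (6 * ∥ X ∥ᵗ + n) a true (goto choose) (G w [])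
choose-complete [] ne _ = contradiction refl ne
choose-complete {n = n} (s ∷ X) {w} _ h = pad (goto choose) (G w [])
  (linear (6 ⊛ x₁ ⊕ (6 ⊛ x₀ ⊕ (con 6 ⊕ x₂))) (6 ⊛ (con 2 ⊕ x₀ ⊕ x₁) ⊕ x₂) (∥ s ∥ ∷ ∥ X ∥ᵗ ∷ n ∷ []))
  (write-team {n = 6 * ∥ s ∥ + (6 + n)} X (write-block eval s X (inj₂ refl) h))

Chosen : List Sym → Set
Chosen w = ∃[ X ] ¬ X ≡ [] × ∃[ n ] ∃[ a ] Wins n a true (goto eval) (G w (team X))

choose-sound : ∀ n a {w} X → Wins n a true (goto choose) (G w (team X)) → Chosen w
name-sound : ∀ n a {w} s X {y} → y ≡ names s ++ sRp ∷ team X → Wins n a true (goto name) (G w y) → Chosen w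
letter-sound : ∀ n a {w} b s X {y} → y ≡ encBin b ++ (names s ++ sRp ∷ team X) →
               Wins n a true (goto letter) (G w y) → Chosen w

choose-sound (suc (suc n)) a X h = name-sound n a [] X refl h

name-sound (suc (suc n)) a s X e (inj₁ h) = letter-sound n a zeroᵇ s X e h
name-sound (suc (suc (suc (suc n)))) a {w} s X refl (inj₂ (inj₁ h)) =
  choose-sound n a (s ∷ X) (subst (λ z → Wins n a true (goto choose) (G w z)) (sym (team-∷ s X)) h)
name-sound (suc (suc (suc (suc n)))) a {w} s X refl (inj₂ (inj₂ h)) =
  s ∷ X , (λ ()) , n , a , subst (λ z → Wins n a true (goto eval) (G w z)) (sym (team-∷ s X)) h

letter-sound (suc (suc (suc n))) a b s X e (inj₁ h) = letter-sound n a 1+[2 b ] s X (cong (sD1 ∷_) e) h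
letter-sound (suc (suc (suc (suc n)))) a b s X e (inj₂ (inj₁ h)) = letter-sound n a 2[1+ b ] s X (cong (sD2 ∷_) e) h
letter-sound (suc (suc (suc (suc n)))) a b s X e (inj₂ (inj₂ h)) =
  name-sound n a (b ∷ s) X (trans (cong (sVar ∷_) e) (sym (names-∷ b s _))) h

load-complete : ∀ u f → Wins n a true (loadK nothing) (G (u ʳ++ f) []) →
                Wins (3 * length u + (2 + n)) a true (goto load) (S f [] [] [] u none₃)
load-complete [] f h = h
load-complete {n = n} (x ∷ u) f h = pad (goto load) (S f [] [] [] (x ∷ u) none₃)
  (≤-reflexive (cong (_+ (2 + n)) (sym (*-suc 3 (length u))))) (load-complete u (x ∷ f) h)

load-sound : ∀ n a u f → Wins n a true (goto load) (S f [] [] [] u none₃) →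
             ∃[ n′ ] Wins n′ a true (loadK nothing) (G (u ʳ++ f) [])
load-sound (suc (suc n)) a [] f h = n , h
load-sound (suc (suc (suc n))) a (x ∷ u) f h = load-sound n a u (x ∷ f) h

-- The input sits on `gm` with its first symbol at the bottom; `load` pours it onto `fm`, so that
-- the first symbol comes to the top.
module Machine = Compile prog enumLabel gm load

wins-sound : ∀ n a w → Wins n a true (prog load) (Machine.initial w) → SAT w
wins-sound n a w h =
  let n′ , h′ = load-sound (suc n) a (reverse w) [] h
  in conclude n′ a (subst (λ z → Wins n′ a true (loadK nothing) (G z [])) (List.reverse-involutive w) h′)
  where
  conclude : ∀ n a → Wins n a true (loadK nothing) (G w []) → SAT w
  conclude (suc (suc (suc n))) (suc (suc a)) (hf , hc)
    -- The parser's win shows that the word is an encoding; only then does `eval-val` say what a win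
    -- in the other branch means.
    with φ , _ , refl , refl ← val (formula-val w []) true n a hf
    with X , X≢[] , m , b , he ← choose-sound n a [] hc
    = φ , sym (List.++-identityʳ (encode φ)) , vars φ , All.tabulate id , ⟪ X ⟫ , nonempty X X≢[] ,
      val (eval-val (length (encode φ) + ∥ X ∥ᵗ + 1) φ id X other ≤-refl) true m b he
    where
    nonempty : ∀ X → ¬ X ≡ [] → ¬ ⟪ X ⟫ ≡ []
    nonempty []      ne e = ne refl
    nonempty (_ ∷ _) ne ()

-- Time bounds

length-budget : ∀ w → budget w ≡ 8 + 8 * length w
length-budget []      = refl
length-budget (x ∷ w) = trans (cong (8 +_) (length-budget w)) (cong (8 +_) (sym (*-suc 8 (length w))))

n<2^n : ∀ n → suc n ≤ 2 ^ n
n<2^n zero    = ≤-refl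
n<2^n (suc n) = ≤-trans (linear (con 2 ⊕ x₀) (2 ⊛ (con 1 ⊕ x₀)) (n ∷ [])) (*-monoʳ-≤ 2 (n<2^n n))

-- Bounds the running time of the stack machine on inputs of length n by 2 ^ clock n.
clock : ℕ → ℕ
clock n = n + (7 + (n + (n + 2)))

size-bound-2^ : ∀ n {x} → x ≤ 2 ^ n * (2 + n) → n + x + 1 ≤ 2 ^ (n + (n + 2))
size-bound-2^ n {x} p = begin
  n + x + 1        ≤⟨ linear (x₀ ⊕ x₁ ⊕ con 1) (con 1 ⊕ x₀ ⊕ x₁) (n ∷ x ∷ []) ⟩
  suc n + x        ≤⟨ +-mono-≤ q p ⟩
  N + N * (2 + n)  ≤⟨ +-mono-≤ (m≤m*n N N ⦃ m^n≢0 2 n ⦄) (*-monoʳ-≤ N (s≤s q)) ⟩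
  N * N + N * (1 + N) ≤⟨ +-monoʳ-≤ (N * N) (*-monoʳ-≤ N (+-monoˡ-≤ N (≤-trans (s≤s z≤n) q))) ⟩
  N * N + N * (N + N) ≡⟨ solve 1 (λ N → N :* N :+ N :* (N :+ N) := N :* (N :* con 3)) refl N ⟩
  N * (N * 3)      ≤⟨ *-monoʳ-≤ N (*-monoʳ-≤ N (n≤1+n 3)) ⟩
  N * (N * 4)      ≡⟨ cong (N *_) (sym (^-distribˡ-+-* 2 n 2)) ⟩
  N * 2 ^ (n + 2)  ≡⟨ sym (^-distribˡ-+-* 2 n (n + 2)) ⟩
  2 ^ (n + (n + 2)) ∎
  where
  open ≤-Reasoning
  open +-*-Solver
  N = 2 ^ n
  q = n<2^n n

-- The summands: `3 * n` for loading, 5 for its end and the first branching, `8 + 8 * n` for the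
-- parser, `6 * x` for writing a team of size `x`, the rest for evaluating `k` nodes. In `clock`,
-- the first `n` covers `suc k`, the 7 covers the factor 70, and `n + (n + 2)` the lengths of
-- formula and team.
time-bound : ∀ n x k → k ≤ n → x ≤ 2 ^ n * (2 + n) →
             3 * n + (5 + (8 + 8 * n + (6 * x + k * (70 * (n + x + 1))))) ≤ 2 ^ clock n
time-bound n x k k≤n small = begin
  3 * n + (5 + (8 + 8 * n + (6 * x + y)))
    ≤⟨ linear (3 ⊛ x₀ ⊕ (con 5 ⊕ (con 8 ⊕ 8 ⊛ x₀ ⊕ (6 ⊛ x₁ ⊕ x₂)))) (70 ⊛ (x₀ ⊕ x₁ ⊕ con 1) ⊕ x₂) (n ∷ x ∷ y ∷ []) ⟩
  70 * (n + x + 1) + y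
    ≤⟨ +-monoʳ-≤ (70 * (n + x + 1)) (*-monoˡ-≤ (70 * (n + x + 1)) k≤n) ⟩
  suc n * (70 * (n + x + 1))
    ≤⟨ *-mono-≤ (n<2^n n) (*-mono-≤ (≤ᵇ⇒≤ 70 (2 ^ 7) tt) (size-bound-2^ n small)) ⟩
  2 ^ n * (2 ^ 7 * 2 ^ (n + (n + 2)))
    ≡⟨ cong (2 ^ n *_) (sym (^-distribˡ-+-* 2 7 (n + (n + 2)))) ⟩
  2 ^ n * 2 ^ (7 + (n + (n + 2)))
    ≡⟨ sym (^-distribˡ-+-* 2 n (7 + (n + (n + 2)))) ⟩
  2 ^ clock n ∎
  where
  open ≤-Reasoning
  y = k * (70 * (n + x + 1))

wins-complete : ∀ w → SAT w → Wins (2 ^ clock (length w)) (2 + 6 * length w) true (prog load) (Machine.initial w)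
wins-complete _ (φ , refl , sat) with X , X≢[] , small , h ← canonical φ sat = loaded
  where
  w = encode φ
  len = length w
  M = len + ∥ X ∥ᵗ + 1
  evals : Wins (nodes φ * (70 * M)) (nodes φ * 6) true (goto eval) (G w (team X))
  evals = subst (λ z → Wins (nodes φ * (70 * M)) (nodes φ * 6) true (goto eval) (G z (team X))) (List.++-identityʳ w)
    (acc (eval-val M φ id X other ≤-refl) true ≤-refl ≤-refl h)
  τ = budget w + (6 * ∥ X ∥ᵗ + nodes φ * (70 * M))
  chooses : Wins τ (nodes φ * 6) true (goto choose) (G w [])
  chooses = pad (goto choose) (G w []) (m≤n+m _ (budget w)) (choose-complete X X≢[] evals)
  parses : Wins τ (nodes φ * 6) true (goto formula) (G w [])
  parses = acc (formula-val w []) true (m≤m+n (budget w) _) z≤n (φ , [] , sym (List.++-identityʳ w) , refl)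
  both-win : Wins (3 + τ) (2 + nodes φ * 6) true (loadK nothing) (G (reverse w ʳ++ []) [])
  both-win = subst (λ z → Wins (3 + τ) (2 + nodes φ * 6) true (loadK nothing) (G z [])) (sym (List.reverse-involutive w))
    (parses , chooses)
  time : 3 * length (reverse w) + (2 + (3 + τ)) ≤ suc (2 ^ clock len)
  time = ≤-trans (≤-reflexive (cong₂ (λ y z → 3 * y + (5 + (z + (6 * ∥ X ∥ᵗ + nodes φ * (70 * M)))))
                                     (List.length-reverse w) (length-budget w)))
                 (≤-trans (time-bound len ∥ X ∥ᵗ (nodes φ) (nodes≤length φ) small) (n≤1+n _))
  loaded : Wins (2 ^ clock len) (2 + 6 * len) true (prog load) (Machine.initial w)
  loaded = Wins-mono true (goto load) (Machine.initial w) time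
    (+-monoʳ-≤ 2 (≤-trans (*-monoˡ-≤ 6 (nodes≤length φ)) (≤-reflexive (*-comm len 6))))
    (load-complete (reverse w) [] both-win)

n≤n^c : ∀ c n → n ≤ n ^ suc c
n≤n^c c zero    = z≤n
n≤n^c c (suc n) = m≤m*n (suc n) (suc n ^ c) ⦃ m^n≢0 (suc n) c ⦄

linear≤poly : ∀ c n → suc c * n + suc c ≤ poly (suc c) n
linear≤poly c n = +-monoˡ-≤ (suc c) (*-monoʳ-≤ (suc c) (n≤n^c c n))

abstract

  -- `2 * clock n + 4` is `6 * n + 22`, so every constant from 22 on would do.
  degree : ℕ
  degree = 32

  poly≥ : ∀ n → 2 * clock n + 4 ≤ poly degree n × 2 + 6 * n ≤ poly degree n
  poly≥ n =
    ≤-trans (linear (2 ⊛ (x₀ ⊕ (con 7 ⊕ (x₀ ⊕ (x₀ ⊕ con 2)))) ⊕ con 4) (32 ⊛ x₀ ⊕ con 32) (n ∷ [])) (linear≤poly 31 n) ,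
    ≤-trans (linear (con 2 ⊕ 6 ⊛ x₀) (32 ⊛ x₀ ⊕ con 32) (n ∷ [])) (linear≤poly 31 n)

-- `C` stack operations on stacks of height at most `n + C` make the simulation quadratic; as `n`
-- and 1 are at most `C`, the total is at most `11 * C * C`, and 11 is below `2 ^ 4`.
simulation-time : ∀ n N → let C = 2 ^ clock n in 2 * clock n + 4 ≤ N → suc (C * (2 * (n + C) + 6)) ≤ 2 ^ N
simulation-time n N p = begin
  1 + C * (2 * (n + C) + 6)   ≤⟨ +-mono-≤ (≤-trans 1≤C (m≤m*n C C ⦃ m^n≢0 2 k ⦄)) (*-monoʳ-≤ C (+-mono-≤ (*-monoʳ-≤ 2 (+-monoˡ-≤ C n≤C)) (*-monoʳ-≤ 6 1≤C))) ⟩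
  C * C + C * (2 * (C + C) + 6 * C) ≡⟨ solve 1 (λ C → C :* C :+ C :* (con 2 :* (C :+ C) :+ con 6 :* C) := C :* C :* con 11) refl C ⟩
  C * C * 11                  ≤⟨ *-monoʳ-≤ (C * C) (≤ᵇ⇒≤ 11 16 tt) ⟩
  C * C * 2 ^ 4               ≡⟨ cong (_* 16) (sym (^-distribˡ-+-* 2 k k)) ⟩
  2 ^ (k + k) * 2 ^ 4         ≡⟨ sym (^-distribˡ-+-* 2 (k + k) 4) ⟩
  2 ^ (k + k + 4)             ≤⟨ ^-monoʳ-≤ 2 (≤-trans (≤-reflexive (cong (λ z → k + z + 4) (sym (+-identityʳ k)))) p) ⟩
  2 ^ N                       ∎
  where
  open ≤-Reasoning
  open +-*-Solver
  k = clock n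
  C = 2 ^ k
  1≤C : 1 ≤ C
  1≤C = m^n>0 2 k
  n≤C : n ≤ C
  n≤C = ≤-trans (m≤m+n n _) (≤-trans (n≤1+n k) (n<2^n k))

accepts : ∀ w N A → 2 * clock (length w) + 4 ≤ N → 2 + 6 * length w ≤ A → SAT w →
          AcceptsWithin Machine.M (2 ^ N) A w
-- `2 ^ N` is split as one plus its predecessor: the one step marks cell 0 before the simulation
-- starts.
accepts w N A p q sat = subst (λ z → AcceptsWithin Machine.M z A w) (m+[n∸m]≡n (m^n>0 2 N))
  (Machine.compile-complete {2 ^ clock (length w)} w
    (Wins-mono {2 ^ clock (length w)} true (prog load) (Machine.initial w) ≤-refl q (wins-complete w sat))
    (∸-monoˡ-≤ 1 (simulation-time (length w) N p)))

theorem5 : InAEXPTIMEpoly SAT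
theorem5 = Machine.M , degree , λ w →
  accepts w (poly degree (length w)) (poly degree (length w)) (proj₁ (poly≥ (length w))) (proj₂ (poly≥ (length w))) ,
  λ h → let t , b , won = Machine.compile-sound w h in wins-sound t b w won
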